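{- Let $q$ be a prime power and let $\mathcal{H}_q$ be the Hermitian curve, i.e. the plane curve with affine equation $X^{q+1}=Y^q+Y$ (projective closure $X^{q+1}=Y^qZ+YZ^q$). If $q$ is large enough, the set $\mathcal{H}_q(\mathbb{F}_{q^6})$ of $\mathbb{F}_{q^6}$-rational points of $\mathcal{H}_q$ is a complete $(|\mathcal{H}_q(\mathbb{F}_{q^6})|,q+1)$-arc in $\mathrm{PG}(2,\mathbb{F}_{q^6})$.
   Context: For a finite field $\mathbb{F}$, a $(k,m)$-arc in $\mathrm{PG}(2,\mathbb{F})$ is a set of $k$ points containing $m$ collinear points but such that no $m+1$ of its points lie on a common line. A $(k,m)$-arc is complete if it is maximal with respect to set-theoretical inclusion, i.e. it is not properly contained in a $(k',m)$-arc of the same plane (equivalently, adding any further point of the plane produces $m+1$ collinear points). -}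

module Defs where

open import Level using (Level; _⊔_)
open import Algebra.Bundles using (CommutativeRing)
open import Data.Nat as ℕ using (ℕ; zero; suc)
open import Data.Nat.Primality using (Prime)
open import Data.Fin using (Fin)
open import Data.Product using (Σ; ∃; _×_; _,_)
open import Data.Sum using (_⊎_)
open import Relation.Nullary using (¬_)
open import Relation.Binary.PropositionalEquality using (_≡_)

IsPrimePower : ℕ → Set
IsPrimePower q = Σ ℕ λ p → Σ ℕ λ e → Prime p × (1 ℕ.≤ e) × (q ≡ p ℕ.^ e)

record Field (c ℓ : Level) : Set (Level.suc (c ⊔ ℓ)) where
  field
    commutativeRing : CommutativeRing c ℓ
  open CommutativeRing commutativeRing public
  field
    0≉1     : ¬ (0# ≈ 1#)
    inverse : ∀ x → ¬ (x ≈ 0#) → Σ Carrier λ y → (x * y) ≈ 1#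

module FieldTheory {c ℓ} (F : Field c ℓ) where
  open Field F

  infixr 8 _^_
  _^_ : Carrier → ℕ → Carrier
  x ^ zero  = 1#
  x ^ suc n = x * (x ^ n)

  HasCard : ℕ → Set (c ⊔ ℓ)
  HasCard n = Σ (Fin n → Carrier) λ f →
                ((i j : Fin n) → f i ≈ f j → i ≡ j) ×
                ((x : Carrier) → Σ (Fin n) λ i → f i ≈ x)

  -- Homogeneous coordinates; points of PG(2,F) are nonzero triples up to
  -- nonzero scalar multiples, lines likewise (dual coordinates).
  record Triple : Set c where
    constructor ⟨_,_,_⟩
    field
      x y z : Carrier

  open Triple public

  NonZero : Triple → Set ℓ
  NonZero t = ¬ ((x t ≈ 0#) × (y t ≈ 0#) × (z t ≈ 0#))

  _∼_ : Triple → Triple → Set (c ⊔ ℓ)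
  P ∼ Q = Σ Carrier λ λ₀ → ¬ (λ₀ ≈ 0#) ×
            ((x Q ≈ (λ₀ * x P)) × (y Q ≈ (λ₀ * y P)) × (z Q ≈ (λ₀ * z P)))

  _on_ : Triple → Triple → Set ℓ
  P on L = ((x L * x P) + (y L * y P) + (z L * z P)) ≈ 0#

  PointSet : (ℓ' : Level) → Set (c ⊔ Level.suc ℓ')
  PointSet ℓ' = Triple → Set ℓ'

  CollinearIn : ∀ {ℓ'} → PointSet ℓ' → ℕ → Triple → Set (c ⊔ ℓ ⊔ ℓ')
  CollinearIn S n L =
    Σ (Fin n → Triple) λ P →
      ((i : Fin n) → NonZero (P i) × S (P i) × (P i on L)) ×
      ((i j : Fin n) → P i ∼ P j → i ≡ j)

  -- S contains m collinear points but no m+1 of its points are collinear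
  -- (the cardinality k of a (k,m)-arc is just the number of points of S)
  IsArc : ∀ {ℓ'} → PointSet ℓ' → ℕ → Set (c ⊔ ℓ ⊔ ℓ')
  IsArc S m =
    (Σ Triple λ L → NonZero L × CollinearIn S m L) ×
    ((L : Triple) → NonZero L → ¬ CollinearIn S (suc m) L)

  IsCompleteArc : ∀ {ℓ'} → PointSet ℓ' → ℕ → Set (c ⊔ ℓ ⊔ ℓ')
  IsCompleteArc S m =
    IsArc S m ×
    ((P : Triple) → NonZero P → ¬ S P →
       Σ Triple λ L → NonZero L × CollinearIn (λ Q → S Q ⊎ (Q ∼ P)) (suc m) L)

  Hermitian : ℕ → PointSet ℓ
  Hermitian q P = NonZero P × ((x P ^ suc q) ≈ ((y P ^ q) * z P + y P * (z P ^ q)))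

{-# OPTIONS --safe #-}
-- Let σ be the q-power map, φ = σ² on coordinates, and h(A,B) = X_A σ(X_B) - Y_A σ(Z_B) - Z_A σ(Y_B),
-- so that the curve is h(P,P) = 0.  If A ≠ B are points of the curve, the other points r A + B of the
-- curve satisfy u + r^(q-1) w = 0 with u, w not both 0; hence lines carry at most q + 1 points.  If
-- h(A,B) + h(B,A) = 0, then h is alternating on the F_q-span of A and B, and the line AB contains
-- q + 1 points of the curve.  It remains to find such A, B on a line through any P with
-- a = h(P,P) ≠ 0.
--
-- If the norm of a to F_{q²} is not in F_q, choose E with h(E, φ(E)) = 0 ≠ h(E,E) such that P lies on
-- the line joining E and φ(E); this line contains the required pair.  If the norm is in F_q, join P to
-- an F_{q²}-rational point R of the curve.  With ε^q = -ε and w = h(P,R), the line PR contains the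
-- required pair if a / (ε w σ(w)) has trace 0 in F_q.  In both cases the auxiliary point comes from a
-- nontrivial zero of a ternary quadratic form over F_q, which exists by the theorem of Chevalley and
-- Warning.
module Submission where

open import Defs
import Algebra.Properties.CommutativeMonoid.Sum as MonoidSum
import Algebra.Properties.CommutativeSemiring.Binomial as Binomial
import Algebra.Properties.Monoid.Mult as MonoidMult
import Algebra.Properties.Ring
import Algebra.Properties.Semiring.Exp as Exp
import Algebra.Properties.Semiring.Mult
import Algebra.Properties.Semiring.Sum as SemiringSum
open import Algebra.Bundles using (CommutativeRing; CommutativeMonoid)
open import Data.Bool using (true; false; if_then_else_; T)
open import Data.Empty using (⊥; ⊥-elim)
open import Data.Fin as Fin using (Fin; zero; suc)
import Data.Fin.Permutation as Perm
import Data.Fin.Properties as Fin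
import Data.Integer as ℤ
import Data.Integer.Properties as ℤ
open import Data.List using (List; []; _∷_; map; foldr)
open import Data.Nat as ℕ using (ℕ; zero; suc; s≤s; z≤n)
import Data.Nat.Combinatorics as ℕ using (_C_)
open import Data.Nat.Combinatorics using (nCn≡1; nCk≡n!/k![n-k]!; k![n∸k]!∣n!)
import Data.Nat.DivMod as ℕ
import Data.Nat.Divisibility as ℕ
open import Data.Nat.Primality using (Prime; prime⇒nonTrivial; euclidsLemma)
import Data.Nat.Properties as ℕ
import Data.Nat.Tactic.RingSolver as NatSolver
open import Data.Product using (Σ; ∃; _×_; _,_; proj₁; proj₂)
open import Data.Sum using (_⊎_; inj₁; inj₂; [_,_]′)
open import Data.Unit using (⊤; tt)
open import Data.Vec using (Vec; []; _∷_)
open import Data.Vec.Functional using (removeAt)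
open import Data.Vec.N-ary using (N-ary; _$ⁿ_)
open import Function using (_∘_; id; case_of_)
open import Level using (_⊔_; 0ℓ)
open import Relation.Binary.PropositionalEquality as ≡ using (_≡_; _≢_)
import Relation.Binary.Reasoning.Setoid as SetoidReasoning
open import Relation.Nullary using (¬_; Dec; yes; no)
open import Relation.Nullary.Decidable using (map′; ¬?; decidable-stable; _×-dec_)

-- The obstacle is that σ has order 6 on the field, so h is not Hermitian: σ(h(A,B)) = h(φ(B),A).
-- Symmetry returns only on vectors fixed by φ, where h(A,A) lies in F_q; the conditions over F_q
-- that Chevalley and Warning can solve have to be manufactured. In the first case E is a
-- combination of P, φ(P), φ²(P) with coefficients built from t in F_{q³} and a constant y. Taking y
-- σ(y) σ²(y) = -a/σ³(a) makes h(E,φ(E)) a quadratic form in t with values in F_q. Since E + y φ(E)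
-- = (1+ν) t P, where ν is the norm of y to F_{q²}, the construction breaks down when ν = -1, and
-- this can happen only if the norm of a is in F_q: hence the division into cases. In the second
-- case Hilbert 90 over F_{q²} gives μ with μ σ(μ)/a in F_q, and R is built from vectors dual to P,
-- φ(P), φ²(P) so that w = σ(t) μ; then a/(w σ(w)) lies in F_{q³}, and division by ε makes its trace
-- vanish. If P, φ(P), φ²(P) are dependent there is no dual basis, but P then lies on a line defined
-- over F_{q²}, which is treated directly.

-- Deciding identities in commutative rings with an endomorphism

record Endomorphism {c ℓ} (R : CommutativeRing c ℓ) : Set (c ⊔ ℓ) where
  open CommutativeRing R
  field
    σ      : Carrier → Carrier
    σ-cong : ∀ {x y} → x ≈ y → σ x ≈ σ y
    σ-+    : ∀ x y → σ (x + y) ≈ σ x + σ y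
    σ-*    : ∀ x y → σ (x * y) ≈ σ x * σ y
    σ-1    : σ 1# ≈ 1#

  σ^ : ℕ → Carrier → Carrier
  σ^ zero    x = x
  σ^ (suc n) x = σ (σ^ n x)

-- A decision procedure for identities of commutative rings with an endomorphism σ; a variable
-- comes with a period of σ on it.  Coefficients are integers, because the test 1 - 1 = 0
-- cannot be evaluated in an abstract ring.
module RingSolver {c ℓ} {R : CommutativeRing c ℓ} (E : Endomorphism R) where
  open CommutativeRing R
  open Endomorphism E
  open Algebra.Properties.Ring ring
  open Algebra.Properties.Semiring.Mult semiring using (×-homo-+; ×1-homo-*) renaming (_×_ to _•_)
  open SetoidReasoning setoid
  open import Data.Integer using (ℤ; +_; -[1+_]; _⊖_)

  ⟦_⟧ᶻ : ℤ → Carrier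
  ⟦ + n ⟧ᶻ      = n • 1#
  ⟦ -[1+ n ] ⟧ᶻ = - (suc n • 1#)

  swap-+ : ∀ a b c d → (a + b) + (c + d) ≈ (a + c) + (b + d)
  swap-+ a b c d = begin
    (a + b) + (c + d) ≈⟨ +-assoc a b _ ⟩
    a + (b + (c + d)) ≈⟨ +-congˡ (+-assoc b c d) ⟨
    a + ((b + c) + d) ≈⟨ +-congˡ (+-congʳ (+-comm b c)) ⟩
    a + ((c + b) + d) ≈⟨ +-congˡ (+-assoc c b d) ⟩
    a + (c + (b + d)) ≈⟨ +-assoc a c _ ⟨
    (a + c) + (b + d) ∎

  swap-* : ∀ a b c d → (a * b) * (c * d) ≈ (a * c) * (b * d)
  swap-* a b c d = begin
    (a * b) * (c * d) ≈⟨ *-assoc a b _ ⟩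
    a * (b * (c * d)) ≈⟨ *-congˡ (*-assoc b c d) ⟨
    a * ((b * c) * d) ≈⟨ *-congˡ (*-congʳ (*-comm b c)) ⟩
    a * ((c * b) * d) ≈⟨ *-congˡ (*-assoc c b d) ⟩
    a * (c * (b * d)) ≈⟨ *-assoc a c _ ⟨
    (a * c) * (b * d) ∎

  -0≈0 : - 0# ≈ 0#
  -0≈0 = begin
    - 0#      ≈⟨ +-identityʳ (- 0#) ⟨
    - 0# + 0# ≈⟨ -‿inverseˡ 0# ⟩
    0#        ∎

  -‿distrib-+ : ∀ a b → - (a + b) ≈ - a + - b
  -‿distrib-+ a b = begin
    - (a + b)   ≈⟨ -‿anti-homo-+ a b ⟩
    - b + - a   ≈⟨ +-comm (- b) (- a) ⟩
    - a + - b   ∎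

  ⟦⊖⟧ : ∀ m n → ⟦ m ⊖ n ⟧ᶻ ≈ m • 1# + - (n • 1#)
  ⟦⊖⟧ m       zero    = sym (trans (+-congˡ -0≈0) (+-identityʳ _))
  ⟦⊖⟧ zero    (suc n) = sym (+-identityˡ _)
  ⟦⊖⟧ (suc m) (suc n) = begin
    ⟦ suc m ⊖ suc n ⟧ᶻ                      ≡⟨ ≡.cong ⟦_⟧ᶻ (ℤ.[1+m]⊖[1+n]≡m⊖n m n) ⟩
    ⟦ m ⊖ n ⟧ᶻ                              ≈⟨ ⟦⊖⟧ m n ⟩
    m • 1# + - (n • 1#)                     ≈⟨ +-identityˡ _ ⟨
    0# + (m • 1# + - (n • 1#))              ≈⟨ +-congʳ (-‿inverseʳ 1#) ⟨
    (1# + - 1#) + (m • 1# + - (n • 1#))     ≈⟨ swap-+ _ _ _ _ ⟩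
    suc m • 1# + (- 1# + - (n • 1#))        ≈⟨ +-congˡ (-‿distrib-+ 1# (n • 1#)) ⟨
    suc m • 1# + - (suc n • 1#)             ∎

  ⟦+⟧ : ∀ i j → ⟦ i ℤ.+ j ⟧ᶻ ≈ ⟦ i ⟧ᶻ + ⟦ j ⟧ᶻ
  ⟦+⟧ (+ m)      (+ n)      = ×-homo-+ 1# m n
  ⟦+⟧ (+ m)      -[1+ n ]   = ⟦⊖⟧ m (suc n)
  ⟦+⟧ -[1+ m ]   (+ n)      = trans (⟦⊖⟧ n (suc m)) (+-comm _ _)
  ⟦+⟧ -[1+ m ]   -[1+ n ]   = begin
    - (suc (suc (m ℕ.+ n)) • 1#)        ≡⟨ ≡.cong (λ k → - (suc k • 1#)) (≡.sym (ℤ-suc m n)) ⟩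
    - ((suc m ℕ.+ suc n) • 1#)          ≈⟨ -‿cong (×-homo-+ 1# (suc m) (suc n)) ⟩
    - (suc m • 1# + suc n • 1#)         ≈⟨ -‿distrib-+ _ _ ⟩
    - (suc m • 1#) + - (suc n • 1#)     ∎
    where
    ℤ-suc : ∀ m n → m ℕ.+ suc n ≡ suc (m ℕ.+ n)
    ℤ-suc zero    n = ≡.refl
    ℤ-suc (suc m) n = ≡.cong suc (ℤ-suc m n)

  ⟦-⟧ : ∀ i → ⟦ ℤ.- i ⟧ᶻ ≈ - ⟦ i ⟧ᶻ
  ⟦-⟧ (+ zero)  = sym -0≈0
  ⟦-⟧ (+ suc n) = refl
  ⟦-⟧ -[1+ n ]  = sym (-‿involutive _)

  ⟦*⟧⁺ : ∀ m j → ⟦ + m ℤ.* j ⟧ᶻ ≈ m • 1# * ⟦ j ⟧ᶻ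
  ⟦*⟧⁺ m (+ n) = begin
    ⟦ + m ℤ.* + n ⟧ᶻ    ≡⟨ ≡.cong ⟦_⟧ᶻ (≡.sym (ℤ.pos-* m n)) ⟩
    (m ℕ.* n) • 1#      ≈⟨ ×1-homo-* m n ⟩
    m • 1# * n • 1#     ∎
  ⟦*⟧⁺ m -[1+ n ] = begin
    ⟦ + m ℤ.* -[1+ n ] ⟧ᶻ          ≡⟨ ≡.cong ⟦_⟧ᶻ (≡.sym (ℤ.neg-distribʳ-* (+ m) (+ suc n))) ⟩
    ⟦ ℤ.- (+ m ℤ.* + suc n) ⟧ᶻ     ≈⟨ ⟦-⟧ (+ m ℤ.* + suc n) ⟩
    - ⟦ + m ℤ.* + suc n ⟧ᶻ         ≈⟨ -‿cong (⟦*⟧⁺ m (+ suc n)) ⟩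
    - (m • 1# * suc n • 1#)        ≈⟨ -‿distribʳ-* _ _ ⟩
    m • 1# * - (suc n • 1#)        ∎

  ⟦*⟧ : ∀ i j → ⟦ i ℤ.* j ⟧ᶻ ≈ ⟦ i ⟧ᶻ * ⟦ j ⟧ᶻ
  ⟦*⟧ (+ m)    j = ⟦*⟧⁺ m j
  ⟦*⟧ -[1+ m ] j = begin
    ⟦ -[1+ m ] ℤ.* j ⟧ᶻ         ≡⟨ ≡.cong ⟦_⟧ᶻ (≡.sym (ℤ.neg-distribˡ-* (+ suc m) j)) ⟩
    ⟦ ℤ.- (+ suc m ℤ.* j) ⟧ᶻ    ≈⟨ ⟦-⟧ (+ suc m ℤ.* j) ⟩
    - ⟦ + suc m ℤ.* j ⟧ᶻ        ≈⟨ -‿cong (⟦*⟧⁺ (suc m) j) ⟩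
    - (suc m • 1# * ⟦ j ⟧ᶻ)     ≈⟨ -‿distribˡ-* _ _ ⟩
    - (suc m • 1#) * ⟦ j ⟧ᶻ     ∎

  σ-0 : σ 0# ≈ 0#
  σ-0 = +-cancelˡ (σ 0#) (σ 0#) 0# (begin
    σ 0# + σ 0#  ≈⟨ σ-+ 0# 0# ⟨
    σ (0# + 0#)  ≈⟨ σ-cong (+-identityˡ 0#) ⟩
    σ 0#         ≈⟨ +-identityʳ (σ 0#) ⟨
    σ 0# + 0#    ∎)

  σ-- : ∀ x → σ (- x) ≈ - σ x
  σ-- x = +-cancelˡ (σ x) (σ (- x)) (- σ x) (begin
    σ x + σ (- x)  ≈⟨ σ-+ x (- x) ⟨
    σ (x + - x)    ≈⟨ σ-cong (-‿inverseʳ x) ⟩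
    σ 0#           ≈⟨ σ-0 ⟩
    0#             ≈⟨ -‿inverseʳ (σ x) ⟨
    σ x + - σ x    ∎)

  σ-• : ∀ n → σ (n • 1#) ≈ n • 1#
  σ-• zero    = σ-0
  σ-• (suc n) = trans (σ-+ 1# (n • 1#)) (+-cong σ-1 (σ-• n))

  σ-⟦⟧ᶻ : ∀ k → σ ⟦ k ⟧ᶻ ≈ ⟦ k ⟧ᶻ
  σ-⟦⟧ᶻ (+ n)      = σ-• n
  σ-⟦⟧ᶻ -[1+ n ]   = trans (σ-- _) (-‿cong (σ-• (suc n)))

  -- The atom (i , j) is σʲ of the i-th variable; monomials are sorted lists of atoms, compared
  -- lexicographically.

  Atom Mono Poly : Set
  Atom = ℕ × ℕ
  Mono = List Atom
  Poly = List (ℤ × Mono)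

  -- Only `equal` carries evidence: soundness of merging never uses the order, which matters only
  -- for reaching a normal form.
  data Order {A : Set} (x y : A) : Set where
    before after : Order x y
    equal        : x ≡ y → Order x y

  compareⁿ : (i j : ℕ) → Order i j
  compareⁿ i j with i ℕ.≟ j
  ... | yes i≡j = equal i≡j
  ... | no  _   = if i ℕ.<ᵇ j then before else after

  compareᵃ : (a b : Atom) → Order a b
  compareᵃ (i , k) (j , l) with compareⁿ i j
  ... | before = before
  ... | after  = after
  ... | equal ≡.refl with compareⁿ k l
  ...   | before = before
  ...   | after  = after
  ...   | equal ≡.refl = equal ≡.refl

  compareᵐ : (m n : Mono) → Order m n
  compareᵐ []      []      = equal ≡.refl
  compareᵐ []      (_ ∷ _) = after
  compareᵐ (_ ∷ _) []      = before
  compareᵐ (a ∷ m) (b ∷ n) with compareᵃ a b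
  ... | before = before
  ... | after  = after
  ... | equal ≡.refl with compareᵐ m n
  ...   | before = before
  ...   | after  = after
  ...   | equal ≡.refl = equal ≡.refl

  -- Merging of sorted lists, with a local recursion on the second list so that each recursive call
  -- is structural. The same shape serves `_+ᵖ_`.
  _·ᵐ_ : Mono → Mono → Mono
  []      ·ᵐ n = n
  (a ∷ m) ·ᵐ n = insert n
    where
    insert : Mono → Mono
    insert []      = a ∷ m
    insert (b ∷ n) with compareᵃ b a
    ... | before = b ∷ insert n
    ... | _      = a ∷ (m ·ᵐ (b ∷ n))

  -- Terms with coefficient 0 must disappear, since `prove` expects a vanishing polynomial to be
  -- literally the empty list.
  cons : ℤ → Mono → Poly → Poly
  cons (+ zero) m p = p
  cons k        m p = (k , m) ∷ p

  _+ᵖ_ : Poly → Poly → Poly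
  []            +ᵖ q = q
  ((k , m) ∷ p) +ᵖ q = merge q
    where
    merge : Poly → Poly
    merge []            = (k , m) ∷ p
    merge ((l , n) ∷ q) with compareᵐ m n
    ... | before  = (k , m) ∷ (p +ᵖ ((l , n) ∷ q))
    ... | after   = (l , n) ∷ merge q
    ... | equal _ = cons (k ℤ.+ l) m (p +ᵖ q)

  scale : ℤ × Mono → Poly → Poly
  scale (k , m) = map (λ (l , n) → k ℤ.* l , m ·ᵐ n)

  _*ᵖ_ : Poly → Poly → Poly
  p *ᵖ q = foldr (λ t r → scale t q +ᵖ r) [] p

  infixl 6 _:+_ _:-_
  infixl 7 _:*_
  infix  8 :-_
  infix  4 _:=_

  data Expr : Set where
    var           : ℕ → Expr
    :0 :1         : Expr
    _:+_ _:*_     : Expr → Expr → Expr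
    :-_ :σ        : Expr → Expr

  _:-_ : Expr → Expr → Expr
  e :- f = e :+ :- f

  _:=_ : Expr → Expr → Expr × Expr
  _:=_ = _,_

  record Var : Set (c ⊔ ℓ) where
    constructor _of-period_by_
    field
      value       : Carrier
      period      : ℕ
      is-period   : σ^ period value ≈ value

  open Var

  module _ {n : ℕ} (ρ : Vec Var n) where

    -- variables outside the environment stand for 0
    lookup : ∀ {m} → Vec Var m → ℕ → Var
    lookup []      _       = 0# of-period 1 by σ-0
    lookup (x ∷ _) zero    = x
    lookup (_ ∷ ρ) (suc i) = lookup ρ i

    ⟦_⟧ : Expr → Carrier
    ⟦ var i ⟧  = value (lookup ρ i)
    ⟦ :0 ⟧     = 0#
    ⟦ :1 ⟧     = 1#
    ⟦ e :+ f ⟧ = ⟦ e ⟧ + ⟦ f ⟧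
    ⟦ e :* f ⟧ = ⟦ e ⟧ * ⟦ f ⟧
    ⟦ :- e ⟧   = - ⟦ e ⟧
    ⟦ :σ e ⟧   = σ ⟦ e ⟧

    shift : Atom → Atom
    shift (i , j) = if suc j ℕ.≡ᵇ period (lookup ρ i) then (i , 0) else (i , suc j)

    shiftᵐ : Mono → Mono
    shiftᵐ = foldr (λ a m → (shift a ∷ []) ·ᵐ m) []

    shiftᵖ : Poly → Poly
    shiftᵖ = foldr (λ (k , m) p → ((k , shiftᵐ m) ∷ []) +ᵖ p) []

    normalise : Expr → Poly
    normalise (var i)  = (+ 1 , (i , 0) ∷ []) ∷ []
    normalise :0       = []
    normalise :1       = (+ 1 , []) ∷ []
    normalise (e :+ f) = normalise e +ᵖ normalise f
    normalise (e :* f) = normalise e *ᵖ normalise f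
    normalise (:- e)   = scale (-[1+ 0 ] , []) (normalise e)
    normalise (:σ e)   = shiftᵖ (normalise e)

    ⟦_⟧ᵃ : Atom → Carrier
    ⟦ i , j ⟧ᵃ = σ^ j (value (lookup ρ i))

    ⟦_⟧ᵐ : Mono → Carrier
    ⟦ [] ⟧ᵐ    = 1#
    ⟦ a ∷ m ⟧ᵐ = ⟦ a ⟧ᵃ * ⟦ m ⟧ᵐ

    ⟦_⟧ᵗ : ℤ × Mono → Carrier
    ⟦ k , m ⟧ᵗ = ⟦ k ⟧ᶻ * ⟦ m ⟧ᵐ

    ⟦_⟧ᵖ : Poly → Carrier
    ⟦ [] ⟧ᵖ    = 0#
    ⟦ t ∷ p ⟧ᵖ = ⟦ t ⟧ᵗ + ⟦ p ⟧ᵖ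

    ·ᵐ-sound : ∀ m n → ⟦ m ·ᵐ n ⟧ᵐ ≈ ⟦ m ⟧ᵐ * ⟦ n ⟧ᵐ
    ·ᵐ-sound []      n = sym (*-identityˡ _)
    ·ᵐ-sound (a ∷ m) n = insert-sound n
      where
      step : ∀ b n → ⟦ a ⟧ᵃ * ⟦ m ·ᵐ (b ∷ n) ⟧ᵐ ≈ ⟦ a ∷ m ⟧ᵐ * ⟦ b ∷ n ⟧ᵐ
      step b n = trans (*-congˡ (·ᵐ-sound m (b ∷ n))) (sym (*-assoc _ _ _))

      insert-sound : ∀ n → ⟦ (a ∷ m) ·ᵐ n ⟧ᵐ ≈ ⟦ a ∷ m ⟧ᵐ * ⟦ n ⟧ᵐ
      insert-sound []      = sym (*-identityʳ _)
      insert-sound (b ∷ n) with compareᵃ b a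
      ... | equal _ = step b n
      ... | after   = step b n
      ... | before  = begin
        ⟦ b ⟧ᵃ * ⟦ (a ∷ m) ·ᵐ n ⟧ᵐ         ≈⟨ *-congˡ (insert-sound n) ⟩
        ⟦ b ⟧ᵃ * (⟦ a ∷ m ⟧ᵐ * ⟦ n ⟧ᵐ)     ≈⟨ *-assoc _ _ _ ⟨
        ⟦ b ⟧ᵃ * ⟦ a ∷ m ⟧ᵐ * ⟦ n ⟧ᵐ       ≈⟨ *-congʳ (*-comm _ _) ⟩
        ⟦ a ∷ m ⟧ᵐ * ⟦ b ⟧ᵃ * ⟦ n ⟧ᵐ       ≈⟨ *-assoc _ _ _ ⟩
        ⟦ a ∷ m ⟧ᵐ * (⟦ b ⟧ᵃ * ⟦ n ⟧ᵐ)     ∎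

    cons-sound : ∀ k m p → ⟦ cons k m p ⟧ᵖ ≈ ⟦ k , m ⟧ᵗ + ⟦ p ⟧ᵖ
    cons-sound (+ zero)   m p = sym (trans (+-congʳ (zeroˡ _)) (+-identityˡ _))
    cons-sound (+ suc k)  m p = refl
    cons-sound -[1+ k ]   m p = refl

    +ᵖ-sound : ∀ p q → ⟦ p +ᵖ q ⟧ᵖ ≈ ⟦ p ⟧ᵖ + ⟦ q ⟧ᵖ
    +ᵖ-sound []            q = sym (+-identityˡ _)
    +ᵖ-sound ((k , m) ∷ p) q = merge-sound q
      where
      merge-sound : ∀ q → ⟦ ((k , m) ∷ p) +ᵖ q ⟧ᵖ ≈ ⟦ (k , m) ∷ p ⟧ᵖ + ⟦ q ⟧ᵖ
      merge-sound []            = sym (+-identityʳ _)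
      merge-sound ((l , n) ∷ q) with compareᵐ m n
      ... | before = trans (+-congˡ (+ᵖ-sound p ((l , n) ∷ q))) (sym (+-assoc _ _ _))
      ... | after  = begin
        ⟦ l , n ⟧ᵗ + ⟦ ((k , m) ∷ p) +ᵖ q ⟧ᵖ           ≈⟨ +-congˡ (merge-sound q) ⟩
        ⟦ l , n ⟧ᵗ + (⟦ (k , m) ∷ p ⟧ᵖ + ⟦ q ⟧ᵖ)       ≈⟨ +-assoc _ _ _ ⟨
        ⟦ l , n ⟧ᵗ + ⟦ (k , m) ∷ p ⟧ᵖ + ⟦ q ⟧ᵖ         ≈⟨ +-congʳ (+-comm _ _) ⟩
        ⟦ (k , m) ∷ p ⟧ᵖ + ⟦ l , n ⟧ᵗ + ⟦ q ⟧ᵖ         ≈⟨ +-assoc _ _ _ ⟩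
        ⟦ (k , m) ∷ p ⟧ᵖ + (⟦ l , n ⟧ᵗ + ⟦ q ⟧ᵖ)       ∎
      ... | equal ≡.refl = begin
        ⟦ cons (k ℤ.+ l) m (p +ᵖ q) ⟧ᵖ                     ≈⟨ cons-sound (k ℤ.+ l) m (p +ᵖ q) ⟩
        ⟦ k ℤ.+ l ⟧ᶻ * ⟦ m ⟧ᵐ + ⟦ p +ᵖ q ⟧ᵖ                ≈⟨ +-cong (trans (*-congʳ (⟦+⟧ k l)) (distribʳ _ _ _)) (+ᵖ-sound p q) ⟩
        (⟦ k , m ⟧ᵗ + ⟦ l , m ⟧ᵗ) + (⟦ p ⟧ᵖ + ⟦ q ⟧ᵖ)      ≈⟨ swap-+ _ _ _ _ ⟩
        (⟦ k , m ⟧ᵗ + ⟦ p ⟧ᵖ) + (⟦ l , m ⟧ᵗ + ⟦ q ⟧ᵖ)      ∎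

    scale-sound : ∀ t q → ⟦ scale t q ⟧ᵖ ≈ ⟦ t ⟧ᵗ * ⟦ q ⟧ᵖ
    scale-sound t       []            = sym (zeroʳ _)
    scale-sound (k , m) ((l , n) ∷ q) = begin
      ⟦ k ℤ.* l ⟧ᶻ * ⟦ m ·ᵐ n ⟧ᵐ + ⟦ scale (k , m) q ⟧ᵖ
        ≈⟨ +-cong (*-cong (⟦*⟧ k l) (·ᵐ-sound m n)) (scale-sound (k , m) q) ⟩
      (⟦ k ⟧ᶻ * ⟦ l ⟧ᶻ) * (⟦ m ⟧ᵐ * ⟦ n ⟧ᵐ) + ⟦ k , m ⟧ᵗ * ⟦ q ⟧ᵖ
        ≈⟨ +-congʳ (swap-* _ _ _ _) ⟩
      ⟦ k , m ⟧ᵗ * ⟦ l , n ⟧ᵗ + ⟦ k , m ⟧ᵗ * ⟦ q ⟧ᵖ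
        ≈⟨ distribˡ _ _ _ ⟨
      ⟦ k , m ⟧ᵗ * (⟦ l , n ⟧ᵗ + ⟦ q ⟧ᵖ) ∎

    *ᵖ-sound : ∀ p q → ⟦ p *ᵖ q ⟧ᵖ ≈ ⟦ p ⟧ᵖ * ⟦ q ⟧ᵖ
    *ᵖ-sound []      q = sym (zeroˡ _)
    *ᵖ-sound (t ∷ p) q = begin
      ⟦ scale t q +ᵖ (p *ᵖ q) ⟧ᵖ              ≈⟨ +ᵖ-sound (scale t q) (p *ᵖ q) ⟩
      ⟦ scale t q ⟧ᵖ + ⟦ p *ᵖ q ⟧ᵖ            ≈⟨ +-cong (scale-sound t q) (*ᵖ-sound p q) ⟩
      ⟦ t ⟧ᵗ * ⟦ q ⟧ᵖ + ⟦ p ⟧ᵖ * ⟦ q ⟧ᵖ       ≈⟨ distribʳ _ _ _ ⟨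
      (⟦ t ⟧ᵗ + ⟦ p ⟧ᵖ) * ⟦ q ⟧ᵖ              ∎

    shift-sound : ∀ a → ⟦ shift a ⟧ᵃ ≈ σ ⟦ a ⟧ᵃ
    shift-sound (i , j) with suc j ℕ.≡ᵇ period (lookup ρ i) in eq
    ... | false = refl
    ... | true  = begin
      value (lookup ρ i)                                 ≈⟨ is-period (lookup ρ i) ⟨
      σ^ (period (lookup ρ i)) (value (lookup ρ i))      ≡⟨ ≡.cong (λ k → σ^ k (value (lookup ρ i))) suc-j≡period ⟨
      σ^ (suc j) (value (lookup ρ i))                    ∎
      where
      suc-j≡period : suc j ≡ period (lookup ρ i)
      suc-j≡period = ℕ.≡ᵇ⇒≡ (suc j) _ (≡.subst T (≡.sym eq) _)

    shiftᵐ-sound : ∀ m → ⟦ shiftᵐ m ⟧ᵐ ≈ σ ⟦ m ⟧ᵐ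
    shiftᵐ-sound []      = sym σ-1
    shiftᵐ-sound (a ∷ m) = begin
      ⟦ (shift a ∷ []) ·ᵐ shiftᵐ m ⟧ᵐ         ≈⟨ ·ᵐ-sound (shift a ∷ []) (shiftᵐ m) ⟩
      ⟦ shift a ⟧ᵃ * 1# * ⟦ shiftᵐ m ⟧ᵐ       ≈⟨ *-cong (trans (*-identityʳ _) (shift-sound a)) (shiftᵐ-sound m) ⟩
      σ ⟦ a ⟧ᵃ * σ ⟦ m ⟧ᵐ                     ≈⟨ σ-* _ _ ⟨
      σ (⟦ a ⟧ᵃ * ⟦ m ⟧ᵐ)                     ∎

    shiftᵖ-sound : ∀ p → ⟦ shiftᵖ p ⟧ᵖ ≈ σ ⟦ p ⟧ᵖ
    shiftᵖ-sound []            = sym σ-0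
    shiftᵖ-sound ((k , m) ∷ p) = begin
      ⟦ ((k , shiftᵐ m) ∷ []) +ᵖ shiftᵖ p ⟧ᵖ             ≈⟨ +ᵖ-sound ((k , shiftᵐ m) ∷ []) (shiftᵖ p) ⟩
      ⟦ k ⟧ᶻ * ⟦ shiftᵐ m ⟧ᵐ + 0# + ⟦ shiftᵖ p ⟧ᵖ        ≈⟨ +-cong (+-identityʳ _) (shiftᵖ-sound p) ⟩
      ⟦ k ⟧ᶻ * ⟦ shiftᵐ m ⟧ᵐ + σ ⟦ p ⟧ᵖ                  ≈⟨ +-congʳ (*-cong (sym (σ-⟦⟧ᶻ k)) (shiftᵐ-sound m)) ⟩
      σ ⟦ k ⟧ᶻ * σ ⟦ m ⟧ᵐ + σ ⟦ p ⟧ᵖ                     ≈⟨ +-congʳ (σ-* _ _) ⟨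
      σ ⟦ k , m ⟧ᵗ + σ ⟦ p ⟧ᵖ                            ≈⟨ σ-+ _ _ ⟨
      σ (⟦ k , m ⟧ᵗ + ⟦ p ⟧ᵖ)                            ∎

    1•1≈1 : 1# + 0# ≈ 1#
    1•1≈1 = +-identityʳ 1#

    normalise-sound : ∀ e → ⟦ normalise e ⟧ᵖ ≈ ⟦ e ⟧
    normalise-sound (var i)  = begin
      (1# + 0#) * (⟦ i , 0 ⟧ᵃ * 1#) + 0#   ≈⟨ +-identityʳ _ ⟩
      (1# + 0#) * (⟦ i , 0 ⟧ᵃ * 1#)        ≈⟨ *-cong 1•1≈1 (*-identityʳ _) ⟩
      1# * ⟦ i , 0 ⟧ᵃ                      ≈⟨ *-identityˡ _ ⟩
      ⟦ i , 0 ⟧ᵃ                           ∎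
    normalise-sound :0       = refl
    normalise-sound :1       = begin
      (1# + 0#) * 1# + 0#   ≈⟨ +-identityʳ _ ⟩
      (1# + 0#) * 1#        ≈⟨ *-identityʳ _ ⟩
      1# + 0#               ≈⟨ 1•1≈1 ⟩
      1#                    ∎
    normalise-sound (e :+ f) = trans (+ᵖ-sound (normalise e) (normalise f)) (+-cong (normalise-sound e) (normalise-sound f))
    normalise-sound (e :* f) = trans (*ᵖ-sound (normalise e) (normalise f)) (*-cong (normalise-sound e) (normalise-sound f))
    normalise-sound (:- e)   = begin
      ⟦ scale (-[1+ 0 ] , []) (normalise e) ⟧ᵖ      ≈⟨ scale-sound (-[1+ 0 ] , []) (normalise e) ⟩
      (- (1# + 0#) * 1#) * ⟦ normalise e ⟧ᵖ         ≈⟨ *-cong (trans (*-identityʳ _) (-‿cong 1•1≈1)) (normalise-sound e) ⟩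
      - 1# * ⟦ e ⟧                                  ≈⟨ -‿distribˡ-* 1# ⟦ e ⟧ ⟨
      - (1# * ⟦ e ⟧)                                ≈⟨ -‿cong (*-identityˡ _) ⟩
      - ⟦ e ⟧                                       ∎

    normalise-sound (:σ e)   = trans (shiftᵖ-sound (normalise e)) (σ-cong (normalise-sound e))

    -- The difference of the two sides normalises by computation, so each use discharges the premise
    -- by `≡.refl`.
    prove : ∀ e f → normalise (e :- f) ≡ [] → ⟦ e ⟧ ≈ ⟦ f ⟧
    prove e f eq = begin
      ⟦ e ⟧                      ≈⟨ +-identityʳ _ ⟨
      ⟦ e ⟧ + 0#                 ≈⟨ +-congˡ (-‿inverseˡ ⟦ f ⟧) ⟨
      ⟦ e ⟧ + (- ⟦ f ⟧ + ⟦ f ⟧)  ≈⟨ +-assoc _ _ _ ⟨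
      ⟦ e :- f ⟧ + ⟦ f ⟧         ≈⟨ +-congʳ (normalise-sound (e :- f)) ⟨
      ⟦ normalise (e :- f) ⟧ᵖ + ⟦ f ⟧  ≡⟨ ≡.cong (λ p → ⟦ p ⟧ᵖ + ⟦ f ⟧) eq ⟩
      0# + ⟦ f ⟧                 ≈⟨ +-identityˡ _ ⟩
      ⟦ f ⟧                      ∎

  variables : ∀ n → ℕ → Vec Expr n
  variables zero    i = []
  variables (suc n) i = var i ∷ variables n (suc i)

  equation : ∀ {n} → N-ary n Expr (Expr × Expr) → Expr × Expr
  equation {n} f = f $ⁿ variables n 0

  solve : ∀ {n} (ρ : Vec Var n) (f : N-ary n Expr (Expr × Expr)) →
          let e , e′ = equation {n} f in normalise ρ (e :- e′) ≡ [] → ⟦_⟧ ρ e ≈ ⟦_⟧ ρ e′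
  solve ρ f = let e , e′ = equation f in prove ρ e e′

-- Elementary arithmetic in a field

module FieldLemmas {c ℓ} (F : Field c ℓ) where
  open Field F public hiding (zero)
  open FieldTheory F public using (_^_; HasCard)
  open Algebra.Properties.Ring ring public
    using (-‿involutive; -‿distribˡ-*; -‿distribʳ-*; +-cancelˡ)
  open SetoidReasoning setoid

  -- With the identity as endomorphism the solver decides plain ring identities, every variable
  -- having period 1.
  identity : Endomorphism commutativeRing
  identity = record
    { σ = id ; σ-cong = id ; σ-+ = λ _ _ → refl ; σ-* = λ _ _ → refl ; σ-1 = refl }

  module PlainSolver where
    open RingSolver identity public

    ⌜_⌝ : Carrier → Var
    ⌜ x ⌝ = x of-period 1 by refl

  x≈y⇒x-y≈0 : ∀ {x y} → x ≈ y → x - y ≈ 0#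
  x≈y⇒x-y≈0 {x} {y} x≈y = trans (+-congʳ x≈y) (-‿inverseʳ y)

  x-y≈0⇒x≈y : ∀ {x y} → x - y ≈ 0# → x ≈ y
  x-y≈0⇒x≈y {x} {y} x-y≈0 = begin
    x              ≈⟨ solve (⌜ x ⌝ ∷ ⌜ y ⌝ ∷ []) (λ x y → x := (x :- y) :+ y) ≡.refl ⟩
    (x - y) + y    ≈⟨ +-congʳ x-y≈0 ⟩
    0# + y         ≈⟨ +-identityˡ y ⟩
    y              ∎
    where open PlainSolver

  1≉0 : ¬ 1# ≈ 0#
  1≉0 = 0≉1 ∘ sym

  inv : ∀ {x} → ¬ x ≈ 0# → Carrier
  inv {x} x≉0 = proj₁ (inverse x x≉0)

  inv-right : ∀ {x} (x≉0 : ¬ x ≈ 0#) → x * inv x≉0 ≈ 1#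
  inv-right {x} x≉0 = proj₂ (inverse x x≉0)

  inv-left : ∀ {x} (x≉0 : ¬ x ≈ 0#) → inv x≉0 * x ≈ 1#
  inv-left x≉0 = trans (*-comm _ _) (inv-right x≉0)

  *-cancel : ∀ {x y} → ¬ x ≈ 0# → x * y ≈ 0# → y ≈ 0#
  *-cancel {x} {y} x≉0 xy≈0 = begin
    y                  ≈⟨ *-identityˡ y ⟨
    1# * y             ≈⟨ *-congʳ (inv-left x≉0) ⟨
    inv x≉0 * x * y    ≈⟨ *-assoc _ _ _ ⟩
    inv x≉0 * (x * y)  ≈⟨ *-congˡ xy≈0 ⟩
    inv x≉0 * 0#       ≈⟨ zeroʳ _ ⟩
    0#                 ∎

  *-≉0 : ∀ {x y} → ¬ x ≈ 0# → ¬ y ≈ 0# → ¬ x * y ≈ 0#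
  *-≉0 x≉0 y≉0 = y≉0 ∘ *-cancel x≉0

  unit-≉0 : ∀ {x y} → x * y ≈ 1# → ¬ x ≈ 0#
  unit-≉0 xy≈1 x≈0 = 0≉1 (trans (sym (trans (*-congʳ x≈0) (zeroˡ _))) xy≈1)

  inv-≉0 : ∀ {x} (x≉0 : ¬ x ≈ 0#) → ¬ inv x≉0 ≈ 0#
  inv-≉0 x≉0 = unit-≉0 (inv-left x≉0)

  *-cancelˡ : ∀ {x y z} → ¬ x ≈ 0# → x * y ≈ x * z → y ≈ z
  *-cancelˡ {x} {y} {z} x≉0 xy≈xz = x-y≈0⇒x≈y (*-cancel x≉0 (begin
    x * (y - z)      ≈⟨ solve (⌜ x ⌝ ∷ ⌜ y ⌝ ∷ ⌜ z ⌝ ∷ []) (λ x y z → x :* (y :- z) := x :* y :- x :* z) ≡.refl ⟩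
    x * y - x * z    ≈⟨ x≈y⇒x-y≈0 xy≈xz ⟩
    0#               ∎))
    where open PlainSolver

  ^-congˡ : ∀ n {x y} → x ≈ y → x ^ n ≈ y ^ n
  ^-congˡ zero    x≈y = refl
  ^-congˡ (suc n) x≈y = *-cong x≈y (^-congˡ n x≈y)

  ^-+ : ∀ x m n → x ^ (m ℕ.+ n) ≈ x ^ m * x ^ n
  ^-+ x zero    n = sym (*-identityˡ _)
  ^-+ x (suc m) n = trans (*-congˡ (^-+ x m n)) (sym (*-assoc _ _ _))

  ^-* : ∀ x m n → x ^ (m ℕ.* n) ≈ (x ^ n) ^ m
  ^-* x zero    n = refl
  ^-* x (suc m) n = trans (^-+ x n (m ℕ.* n)) (*-congˡ (^-* x m n))

  1^ : ∀ n → 1# ^ n ≈ 1#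
  1^ zero    = refl
  1^ (suc n) = trans (*-identityˡ _) (1^ n)

  *-^ : ∀ x y n → (x * y) ^ n ≈ x ^ n * y ^ n
  *-^ x y zero    = sym (*-identityˡ 1#)
  *-^ x y (suc n) = trans (*-congˡ (*-^ x y n)) (swap-* _ _ _ _)
    where open RingSolver identity

  ^-≉0 : ∀ {x} n → ¬ x ≈ 0# → ¬ x ^ n ≈ 0#
  ^-≉0 zero    x≉0 = 1≉0
  ^-≉0 (suc n) x≉0 = *-≉0 x≉0 (^-≉0 n x≉0)

-- Polynomial functions and their roots

module Polynomials {c ℓ} (F : Field c ℓ) where
  open FieldLemmas F
  open PlainSolver using (⌜_⌝; solve; _:+_; _:*_; _:-_; _:=_; :0; :1)
  open SetoidReasoning setoid

  -- Polynomials are kept as functions together with a Horner scheme: degree less than n here, monic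
  -- of degree exactly n in `Monic`. Leading zeros are allowed in `Below`, so that it is closed
  -- under sums.
  data Below : ℕ → (Carrier → Carrier) → Set (c ⊔ ℓ) where
    null : ∀ {f} → (∀ x → f x ≈ 0#) → Below 0 f
    step : ∀ {n f} k {g} → Below n g → (∀ x → f x ≈ k + x * g x) → Below (suc n) f

  data Monic : ℕ → (Carrier → Carrier) → Set (c ⊔ ℓ) where
    one  : ∀ {f} → (∀ x → f x ≈ 1#) → Monic 0 f
    step : ∀ {n f} k {g} → Monic n g → (∀ x → f x ≈ k + x * g x) → Monic (suc n) f

  below-resp : ∀ {n f g} → (∀ x → f x ≈ g x) → Below n f → Below n g
  below-resp f≈g (null f≈0)      = null (λ x → trans (sym (f≈g x)) (f≈0 x))
  below-resp f≈g (step k b eq)   = step k b (λ x → trans (sym (f≈g x)) (eq x))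

  monic-resp : ∀ {n f g} → (∀ x → f x ≈ g x) → Monic n f → Monic n g
  monic-resp f≈g (one f≈1)       = one (λ x → trans (sym (f≈g x)) (f≈1 x))
  monic-resp f≈g (step k m eq)   = step k m (λ x → trans (sym (f≈g x)) (eq x))

  below-zero : ∀ n {f} → (∀ x → f x ≈ 0#) → Below n f
  below-zero zero    f≈0 = null f≈0
  below-zero (suc n) f≈0 = step 0# (below-zero n {λ _ → 0#} (λ _ → refl))
    (λ x → trans (f≈0 x) (sym (trans (+-identityˡ _) (zeroʳ x))))

  below-≤ : ∀ {m n f} → m ℕ.≤ n → Below m f → Below n f
  below-≤ {n = n} _      (null f≈0)      = below-zero n f≈0
  below-≤ (s≤s m≤n)      (step k b eq)   = step k (below-≤ m≤n b) eq

  below-scale : ∀ {n f} s → Below n f → Below n (λ x → s * f x)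
  below-scale s (null f≈0)               = null (λ x → trans (*-congˡ (f≈0 x)) (zeroʳ s))
  below-scale {f = f} s (step k {g} b eq) = step (s * k) (below-scale s b) λ x → begin
    s * f x                    ≈⟨ *-congˡ (eq x) ⟩
    s * (k + x * g x)          ≈⟨ solve (⌜ s ⌝ ∷ ⌜ k ⌝ ∷ ⌜ x ⌝ ∷ ⌜ g x ⌝ ∷ []) (λ s k x y → s :* (k :+ x :* y) := s :* k :+ x :* (s :* y)) ≡.refl ⟩
    s * k + x * (s * g x)      ∎

  add-step : ∀ k x y l z → (k + x * y) + (l + x * z) ≈ (k + l) + x * (y + z)
  add-step k x y l z = solve (⌜ k ⌝ ∷ ⌜ x ⌝ ∷ ⌜ y ⌝ ∷ ⌜ l ⌝ ∷ ⌜ z ⌝ ∷ [])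
    (λ k x y l z → (k :+ x :* y) :+ (l :+ x :* z) := (k :+ l) :+ x :* (y :+ z)) ≡.refl

  below-+ : ∀ {n f g} → Below n f → Below n g → Below n (λ x → f x + g x)
  below-+ (null f≈0)      (null g≈0)      = null (λ x → trans (+-cong (f≈0 x) (g≈0 x)) (+-identityˡ 0#))
  below-+ (step k b eq)   (step l d eq′)  = step (k + l) (below-+ b d)
    (λ x → trans (+-cong (eq x) (eq′ x)) (add-step k x _ l _))

  monic-+ : ∀ {n f g} → Monic n f → Below n g → Monic n (λ x → f x + g x)
  monic-+ (one f≈1)       (null g≈0)      = one (λ x → trans (+-cong (f≈1 x) (g≈0 x)) (+-identityʳ 1#))
  monic-+ (step k m eq)   (step l b eq′)  = step (k + l) (monic-+ m b)
    (λ x → trans (+-cong (eq x) (eq′ x)) (add-step k x _ l _))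

  monic⇒below : ∀ {n f} → Monic n f → Below (suc n) f
  monic⇒below (one f≈1)     = step 1# (below-zero 0 {λ _ → 0#} (λ _ → refl))
    (λ x → trans (f≈1 x) (sym (trans (+-congˡ (zeroʳ x)) (+-identityʳ 1#))))
  monic⇒below (step k m eq) = step k (monic⇒below m) eq

  monic-* : ∀ {m n f g} → Monic m f → Monic n g → Monic (m ℕ.+ n) (λ x → f x * g x)
  monic-* (one f≈1) q = monic-resp (λ x → sym (trans (*-congʳ (f≈1 x)) (*-identityˡ _))) q
  monic-* {suc m} {n} {f} {g} (step k {h} p eq) q =
    monic-resp (λ x → sym (begin
        f x * g x                          ≈⟨ *-congʳ (eq x) ⟩
        (k + x * h x) * g x                ≈⟨ solve (⌜ k ⌝ ∷ ⌜ x ⌝ ∷ ⌜ h x ⌝ ∷ ⌜ g x ⌝ ∷ [])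
                                                (λ k x h g → (k :+ x :* h) :* g := (:0 :+ x :* (h :* g)) :+ k :* g) ≡.refl ⟩
        (0# + x * (h x * g x)) + k * g x   ∎))
      (monic-+ (step 0# (monic-* p q) (λ _ → refl))
               (below-scale k (below-≤ (s≤s (ℕ.m≤n+m n m)) (monic⇒below q))))

  monic-id : Monic 1 (λ x → x)
  monic-id = step 0# (one {λ _ → 1#} (λ _ → refl)) (λ x → sym (trans (+-identityˡ _) (*-identityʳ x)))

  below-const : ∀ k → Below 1 (λ _ → k)
  below-const k = step k (below-zero 0 {λ _ → 0#} (λ _ → refl)) (λ x → sym (trans (+-congˡ (zeroʳ x)) (+-identityʳ k)))

  monic-^ : ∀ n → Monic n (_^ n)
  monic-^ zero    = one (λ _ → refl)
  monic-^ (suc n) = monic-* monic-id (monic-^ n)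

  monic-power : ∀ {m f} n → Monic m f → Monic (n ℕ.* m) (λ x → f x ^ n)
  monic-power zero    p = one (λ _ → refl)
  monic-power (suc n) p = monic-* p (monic-power n p)

  -- Division by x - r.
  quotient : ∀ {n f} → Monic (suc n) f → ∀ r →
             Σ (Carrier → Carrier) λ g → Monic n g × (∀ x → f x - f r ≈ (x - r) * g x)
  quotient {zero} {f} (step k {g} (one g≈1) eq) r = (λ _ → 1#) , one (λ _ → refl) , λ x → begin
    f x - f r                        ≈⟨ +-cong (trans (eq x) (+-congˡ (*-congˡ (g≈1 x)))) (-‿cong (trans (eq r) (+-congˡ (*-congˡ (g≈1 r))))) ⟩
    (k + x * 1#) - (k + r * 1#)      ≈⟨ solve (⌜ k ⌝ ∷ ⌜ x ⌝ ∷ ⌜ r ⌝ ∷ []) (λ k x r → (k :+ x :* :1) :- (k :+ r :* :1) := (x :- r) :* :1) ≡.refl ⟩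
    (x - r) * 1#                     ∎
  quotient {suc n} {f} (step k {g} m@(step _ _ _) eq) r with quotient m r
  ... | h , h-monic , g-eq = (λ x → g x + r * h x) , monic-+ m (below-scale r (monic⇒below h-monic)) , λ x → begin
    f x - f r                                ≈⟨ +-cong (eq x) (-‿cong (eq r)) ⟩
    (k + x * g x) - (k + r * g r)            ≈⟨ solve (⌜ k ⌝ ∷ ⌜ x ⌝ ∷ ⌜ r ⌝ ∷ ⌜ g x ⌝ ∷ ⌜ g r ⌝ ∷ [])
                                                 (λ k x r y z → (k :+ x :* y) :- (k :+ r :* z) := (x :- r) :* y :+ r :* (y :- z)) ≡.refl ⟩
    (x - r) * g x + r * (g x - g r)          ≈⟨ +-congˡ (*-congˡ (g-eq x)) ⟩
    (x - r) * g x + r * ((x - r) * h x)      ≈⟨ solve (⌜ x - r ⌝ ∷ ⌜ r ⌝ ∷ ⌜ g x ⌝ ∷ ⌜ h x ⌝ ∷ [])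
                                                 (λ d r y z → d :* y :+ r :* (d :* z) := d :* (y :+ r :* z)) ≡.refl ⟩
    (x - r) * (g x + r * h x)                ∎

  -- Division by x - r leaves a monic quotient of degree one less, which all the other roots must
  -- annihilate because their difference from r is invertible.
  root-bound : ∀ {n f} → Monic n f → (r : Fin (suc n) → Carrier) →
               (∀ i j → r i ≈ r j → i ≡ j) → ¬ (∀ i → f (r i) ≈ 0#)
  root-bound {zero}      (one f≈1) r r-inj r-root = 0≉1 (trans (sym (r-root zero)) (f≈1 (r zero)))
  root-bound {suc n} {f} m         r r-inj r-root with quotient m (r zero)
  ... | g , g-monic , eq = root-bound g-monic (r ∘ suc) (λ i j → Fin.suc-injective ∘ r-inj (suc i) (suc j))
    λ i → *-cancel (λ d≈0 → Fin.0≢1+n (r-inj zero (suc i) (sym (x-y≈0⇒x≈y d≈0)))) (begin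
      (r (suc i) - r zero) * g (r (suc i))   ≈⟨ eq (r (suc i)) ⟨
      f (r (suc i)) - f (r zero)             ≈⟨ x≈y⇒x-y≈0 (trans (r-root (suc i)) (sym (r-root zero))) ⟩
      0#                                     ∎)

-- Sums and products over enumerated subsets of a field

record Enumeration {c ℓ s} (F : Field c ℓ) (S : Field.Carrier F → Set s) (n : ℕ) : Set (c ⊔ ℓ ⊔ s) where
  open Field F
  field
    enum      : Fin n → Carrier
    injective : ∀ i j → enum i ≈ enum j → i ≡ j
    member    : ∀ i → S (enum i)
    complete  : ∀ x → S x → Σ (Fin n) λ i → enum i ≈ x

module Enumerated {c ℓ s} (F : Field c ℓ) {S : Field.Carrier F → Set s} {n : ℕ} (E : Enumeration F S n) where
  open FieldLemmas F
  open Enumeration E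
  open SetoidReasoning setoid
  open SemiringSum semiring public using (sum)
  open MonoidSum +-commutativeMonoid using (sum-cong-≋; ∑-distrib-+; sum-replicate)
  open MonoidMult +-monoid using () renaming (_×_ to _•_)

  record Bijection : Set (c ⊔ ℓ ⊔ s) where
    field
      to from : Carrier → Carrier
      to-cong : ∀ {x y} → x ≈ y → to x ≈ to y
      from-cong : ∀ {x y} → x ≈ y → from x ≈ from y
      to-mem : ∀ {x} → S x → S (to x)
      from-mem : ∀ {x} → S x → S (from x)
      to-from : ∀ x → to (from x) ≈ x
      from-to : ∀ x → from (to x) ≈ x

  module _ (φ : Bijection) where
    open Bijection φ

    toᶠ fromᶠ : Fin n → Fin n
    toᶠ   i = proj₁ (complete (to (enum i)) (to-mem (member i)))
    fromᶠ i = proj₁ (complete (from (enum i)) (from-mem (member i)))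

    enum-to : ∀ i → enum (toᶠ i) ≈ to (enum i)
    enum-to i = proj₂ (complete (to (enum i)) (to-mem (member i)))

    enum-from : ∀ i → enum (fromᶠ i) ≈ from (enum i)
    enum-from i = proj₂ (complete (from (enum i)) (from-mem (member i)))

    permutation : Perm.Permutation n n
    permutation = Perm.permutation toᶠ fromᶠ
      (λ i → injective _ _ (trans (enum-to _) (trans (to-cong (enum-from i)) (to-from _))))
      (λ i → injective _ _ (trans (enum-from _) (trans (from-cong (enum-to i)) (from-to _))))

  module _ {m k} (M : CommutativeMonoid m k) where
    private module M = CommutativeMonoid M
    open MonoidSum M renaming (sum to fold; sum-permute to fold-permute; sum-cong-≋ to fold-cong)

    -- Stated for any commutative monoid because it serves sums under translations and homotheties
    -- as well as products under homotheties.
    fold-reindex : (φ : Bijection) (g : Carrier → M.Carrier) → (∀ {x y} → x ≈ y → g x M.≈ g y) →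
                   fold (λ i → g (enum i)) M.≈ fold (λ i → g (Bijection.to φ (enum i)))
    fold-reindex φ g g-cong = M.trans (fold-permute (λ i → g (enum i)) (permutation φ))
      (fold-cong (λ i → g-cong (enum-to φ i)))

  translation : ∀ t → (∀ {x} → S x → S (x + t)) → (∀ {x} → S x → S (x - t)) → Bijection
  translation t S+t S-t = record
    { to = _+ t ; from = _- t ; to-cong = +-congʳ ; from-cong = +-congʳ
    ; to-mem = S+t ; from-mem = S-t
    ; to-from = λ x → solve (⌜ x ⌝ ∷ ⌜ t ⌝ ∷ []) (λ x t → x :- t :+ t := x) ≡.refl
    ; from-to = λ x → solve (⌜ x ⌝ ∷ ⌜ t ⌝ ∷ []) (λ x t → x :+ t :- t := x) ≡.refl }
    where open PlainSolver using (⌜_⌝; solve; _:=_; _:+_; _:-_)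

  homothety : ∀ {t} (t≉0 : ¬ t ≈ 0#) → (∀ {x} → S x → S (t * x)) → (∀ {x} → S x → S (inv t≉0 * x)) → Bijection
  homothety {t} t≉0 tS t⁻¹S = record
    { to = t *_ ; from = inv t≉0 *_ ; to-cong = *-congˡ ; from-cong = *-congˡ
    ; to-mem = tS ; from-mem = t⁻¹S
    ; to-from = λ x → trans (sym (*-assoc _ _ _)) (trans (*-congʳ (inv-right t≉0)) (*-identityˡ x))
    ; from-to = λ x → trans (sym (*-assoc _ _ _)) (trans (*-congʳ (inv-left t≉0)) (*-identityˡ x)) }

  -- Translation by 1 permutes S, so the sum of S changes by |S| and does not change.
  card•1≈0 : (∀ {x} → S x → S (x + 1#)) → (∀ {x} → S x → S (x - 1#)) → n • 1# ≈ 0#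
  card•1≈0 S+1 S-1 = sym (+-cancelˡ (sum enum) 0# (n • 1#) (begin
    sum enum + 0#                      ≈⟨ +-identityʳ _ ⟩
    sum enum                           ≈⟨ fold-reindex +-commutativeMonoid (translation 1# S+1 S-1) (λ x → x) (λ x≈y → x≈y) ⟩
    sum (λ i → enum i + 1#)            ≈⟨ ∑-distrib-+ enum (λ _ → 1#) ⟩
    sum enum + sum (λ (i : Fin n) → 1#)  ≈⟨ +-congˡ (sum-replicate n) ⟩
    sum enum + n • 1#                  ∎))

-- Finite fields

module FiniteField {c ℓ} (F : Field c ℓ) {N : ℕ} (card : FieldTheory.HasCard F N) where
  open FieldLemmas F
  open Polynomials F
  open SetoidReasoning setoid

  all : Enumeration F (λ _ → ⊤) N
  all = record { enum = proj₁ card ; injective = proj₁ (proj₂ card) ; member = λ _ → tt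
               ; complete = λ x _ → proj₂ (proj₂ card) x }

  open Enumeration all
  open Enumerated F all

  index : Carrier → Fin N
  index x = proj₁ (complete x tt)

  enum-index : ∀ x → enum (index x) ≈ x
  enum-index x = proj₂ (complete x tt)

  infix 4 _≟_
  _≟_ : ∀ x y → Dec (x ≈ y)
  x ≟ y = map′ (λ eq → trans (sym (enum-index x)) (trans (reflexive (≡.cong enum eq)) (enum-index y)))
               (λ eq → injective _ _ (trans (enum-index x) (trans eq (sym (enum-index y)))))
               (index x Fin.≟ index y)

  search : ∀ {p} {P : Carrier → Set p} → (∀ {x y} → x ≈ y → P x → P y) → (∀ x → Dec (P x)) → Dec (∃ P)
  search P-resp P? = map′ (λ (i , p) → enum i , p)
    (λ (x , p) → index x , P-resp (sym (enum-index x)) p) (Fin.any? (P? ∘ enum))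

  -- Degree below N cannot accommodate N roots; equality being decidable, an exhaustive search turns
  -- this into a witness.
  nonroot : ∀ {n f} → (∀ {x y} → x ≈ y → f x ≈ f y) → n ℕ.< N → Monic n f → ∃ λ x → ¬ f x ≈ 0#
  nonroot {n} {f} f-cong n<N m with search {P = λ x → ¬ f x ≈ 0#} (λ x≈y fx fy → fx (trans (f-cong x≈y) fy)) (λ x → ¬? (f x ≟ 0#))
  ... | yes p  = p
  ... | no  ∄x = ⊥-elim (root-bound m (λ i → enum (Fin.inject≤ i n<N))
                   (λ i j eq → Fin.inject≤-injective n<N n<N i j (injective _ _ eq))
                   (λ i → decidable-stable (f _ ≟ 0#) (λ f≉0 → ∄x (_ , f≉0))))

  zero-product : ∀ {x y} → x * y ≈ 0# → x ≈ 0# ⊎ y ≈ 0#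
  zero-product {x} xy≈0 with x ≟ 0#
  ... | yes x≈0 = inj₁ x≈0
  ... | no  x≉0 = inj₂ (*-cancel x≉0 xy≈0)

  ^≈0⇒≈0 : ∀ {x} n → x ^ n ≈ 0# → x ≈ 0#
  ^≈0⇒≈0 {x} n xⁿ≈0 = decidable-stable (x ≟ 0#) (λ x≉0 → ^-≉0 n x≉0 xⁿ≈0)

  -- Multiplication by x ≉ 0 permutes the nonzero elements.
  x^N≈x : ∀ x → x ^ N ≈ x
  x^N≈x x with x ≟ 0#
  ... | yes x≈0 = power N (index 0#)
    where
    -- The index serves only to exclude N = 0, where the power would be 1 instead of 0.
    power : ∀ n → Fin n → x ^ n ≈ x
    power (suc n) _ = trans (*-congʳ x≈0) (trans (zeroˡ _) (sym x≈0))
  ... | no  x≉0 = sym (go N enum (index 0#) (enum-index 0#) injective fact)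
    where
    open MonoidSum *-commutativeMonoid using () renaming (sum to product; sum-cong-≋ to product-cong; sum-remove to product-remove; ∑-distrib-+ to product-*)

    -- The product runs over the whole field, with 0 replaced by 1; `weight` is the factor by which
    -- multiplication by x changes each entry, namely 1 at 0 and x elsewhere.
    nz : Carrier → Carrier
    nz y with y ≟ 0#
    ... | yes _ = 1#
    ... | no  _ = y

    weight : Carrier → Carrier
    weight y with y ≟ 0#
    ... | yes _ = 1#
    ... | no  _ = x

    nz-≉0 : ∀ y → ¬ nz y ≈ 0#
    nz-≉0 y with y ≟ 0#
    ... | yes _   = 1≉0
    ... | no  y≉0 = y≉0

    nz-cong : ∀ {y z} → y ≈ z → nz y ≈ nz z
    nz-cong {y} {z} y≈z with y ≟ 0# | z ≟ 0#
    ... | yes _   | yes _   = refl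
    ... | yes y≈0 | no  z≉0 = ⊥-elim (z≉0 (trans (sym y≈z) y≈0))
    ... | no  y≉0 | yes z≈0 = ⊥-elim (y≉0 (trans y≈z z≈0))
    ... | no  _   | no  _   = y≈z

    nz-* : ∀ y → nz (x * y) ≈ weight y * nz y
    nz-* y with y ≟ 0# | x * y ≟ 0#
    ... | yes _   | yes _    = sym (*-identityˡ 1#)
    ... | yes y≈0 | no  xy≉0 = ⊥-elim (xy≉0 (trans (*-congˡ y≈0) (zeroʳ x)))
    ... | no  y≉0 | yes xy≈0 = ⊥-elim (*-≉0 x≉0 y≉0 xy≈0)
    ... | no  _   | no  _    = refl

    product-≉0 : ∀ n (f : Fin n → Carrier) → (∀ i → ¬ f i ≈ 0#) → ¬ product f ≈ 0#
    product-≉0 zero    f f≉0 = 1≉0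
    product-≉0 (suc n) f f≉0 = *-≉0 (f≉0 zero) (product-≉0 n (f ∘ suc) (f≉0 ∘ suc))

    P = product (λ i → nz (enum i))

    fact : product (λ i → weight (enum i)) ≈ 1#
    fact = *-cancelˡ (product-≉0 N (λ i → nz (enum i)) (λ i → nz-≉0 (enum i))) (begin
      P * product (λ i → weight (enum i))            ≈⟨ *-comm _ _ ⟩
      product (λ i → weight (enum i)) * P            ≈⟨ product-* (λ i → weight (enum i)) (λ i → nz (enum i)) ⟨
      product (λ i → weight (enum i) * nz (enum i))  ≈⟨ product-cong (λ i → nz-* (enum i)) ⟨
      product (λ i → nz (x * enum i))                ≈⟨ fold-reindex *-commutativeMonoid (homothety x≉0 (λ _ → tt) (λ _ → tt)) nz nz-cong ⟨
      P                                              ≈⟨ *-identityʳ P ⟨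
      P * 1#                                         ∎)

    -- Stated for any length so that N can be matched as a successor. Removing the index of 0 leaves
    -- one factor x fewer than the length, and the extra x on the left makes up for it.
    go : ∀ n (f : Fin n → Carrier) i → f i ≈ 0# → (∀ i j → f i ≈ f j → i ≡ j) →
         product (λ i → weight (f i)) ≈ 1# → x ≈ x ^ n
    go (suc n) f i fi≈0 f-inj eq = begin
      x                                            ≈⟨ *-identityʳ x ⟨
      x * 1#                                       ≈⟨ *-congˡ eq ⟨
      x * product (λ j → weight (f j))             ≈⟨ *-congˡ (product-remove {i = i} (λ j → weight (f j))) ⟩
      x * (weight (f i) * product (removeAt (λ j → weight (f j)) i))   ≈⟨ *-congˡ (*-cong weight-0 (product-cong rest)) ⟩
      x * (1# * product (λ (j : Fin n) → x))       ≈⟨ *-congˡ (*-identityˡ _) ⟩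
      x * product (λ (j : Fin n) → x)              ≈⟨ *-congˡ (power n) ⟩
      x * x ^ n                                    ∎
      where
      weight-0 : weight (f i) ≈ 1#
      weight-0 with f i ≟ 0#
      ... | yes _   = refl
      ... | no  f≉0 = ⊥-elim (f≉0 fi≈0)

      rest : ∀ j → removeAt (λ j → weight (f j)) i j ≈ x
      rest j with f (Fin.punchIn i j) ≟ 0#
      ... | yes f≈0 = ⊥-elim (Fin.punchInᵢ≢i i j (f-inj _ _ (trans f≈0 (sym fi≈0))))
      ... | no  _   = refl

      power : ∀ n → product (λ (j : Fin n) → x) ≈ x ^ n
      power zero    = refl
      power (suc n) = *-congˡ (power n)

-- Additivity of powers in prime characteristic

prime>1 : ∀ {p} → Prime p → 1 ℕ.< p
prime>1 p-prime = ℕ.nonTrivial⇒n>1 _ {{prime⇒nonTrivial p-prime}}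

prime∤! : ∀ {p} → Prime p → ∀ {j} → j ℕ.< p → ¬ p ℕ.∣ j ℕ.!
prime∤! {p} p-prime {zero}  _   p∣1 = ℕ.<⇒≱ (prime>1 p-prime) (ℕ.∣⇒≤ p∣1)
prime∤! {p} p-prime {suc j} j<p p∣  with euclidsLemma (suc j) (j ℕ.!) p-prime p∣
... | inj₁ p∣j  = ℕ.<⇒≱ j<p (ℕ.∣⇒≤ p∣j)
... | inj₂ p∣j! = prime∤! p-prime (ℕ.<-trans (ℕ.n<1+n j) j<p) p∣j!

-- The product of the binomial coefficient with k! and (p-k)! is p!, and p divides neither of the
-- two factorials.
prime∣C : ∀ {p} → Prime p → ∀ {k} → 0 ℕ.< k → k ℕ.< p → p ℕ.∣ p ℕ.C k
prime∣C {suc p} p-prime {k} 0<k k<p with euclidsLemma (suc p ℕ.C k) (k ℕ.! ℕ.* (suc p ℕ.∸ k) ℕ.!) p-prime p∣product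
  where
  instance _ = k ℕ.!* (suc p ℕ.∸ k) !≢0
  p∣product : suc p ℕ.∣ (suc p ℕ.C k) ℕ.* (k ℕ.! ℕ.* (suc p ℕ.∸ k) ℕ.!)
  p∣product = ≡.subst (suc p ℕ.∣_)
    (≡.sym (≡.trans (≡.cong (ℕ._* (k ℕ.! ℕ.* (suc p ℕ.∸ k) ℕ.!)) (nCk≡n!/k![n-k]! (ℕ.<⇒≤ k<p))) (ℕ.m/n*n≡m (k![n∸k]!∣n! (ℕ.<⇒≤ k<p)))))
    (ℕ.m∣m*n (p ℕ.!))
... | inj₁ p∣C = p∣C
... | inj₂ p∣k![p-k]! with euclidsLemma (k ℕ.!) ((suc p ℕ.∸ k) ℕ.!) p-prime p∣k![p-k]!
...   | inj₁ p∣k!     = ⊥-elim (prime∤! p-prime k<p p∣k!)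
...   | inj₂ p∣[p-k]! = ⊥-elim (prime∤! p-prime (ℕ.∸-monoʳ-< 0<k (ℕ.<⇒≤ k<p)) p∣[p-k]!)

module Characteristic {c ℓ} (F : Field c ℓ) {p : ℕ} (p-prime : Prime p) where
  open FieldLemmas F
  open SetoidReasoning setoid
  open Algebra.Properties.Semiring.Mult semiring using (×-assoc-*; ×1-homo-*; ×-congʳ) renaming (_×_ to _•_; ×-assocˡ to •-assoc)
  open Exp semiring using () renaming (_^_ to _^′_)
  open MonoidSum +-commutativeMonoid using (sum; sum-init-last; sum-cong-≋; sum-replicate-zero)

  -- The multiple p^k of 1 is the k-th power of the multiple p of 1, and a field has no nilpotent
  -- elements other than 0.
  prime•1≈0 : (∀ n → ∀ {x} → x ^ n ≈ 0# → x ≈ 0#) → ∀ k → (p ℕ.^ k) • 1# ≈ 0# → p • 1# ≈ 0#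
  prime•1≈0 ^≈0 k eq = ^≈0 k (trans (sym (go k)) eq)
    where
    go : ∀ k → (p ℕ.^ k) • 1# ≈ (p • 1#) ^ k
    go zero    = +-identityʳ 1#
    go (suc k) = trans (×1-homo-* p (p ℕ.^ k)) (*-congˡ (go k))

  module _ (p•1≈0 : p • 1# ≈ 0#) where

    multiple≈0 : ∀ {n} → p ℕ.∣ n → ∀ x → n • x ≈ 0#
    multiple≈0 (ℕ.divides k ≡.refl) x = begin
      (k ℕ.* p) • x        ≈⟨ •-assoc x k p ⟨
      k • (p • x)          ≈⟨ ×-congʳ k (begin
        p • x              ≈⟨ ×-congʳ p (*-identityˡ x) ⟨
        p • (1# * x)       ≈⟨ ×-assoc-* p 1# x ⟨
        (p • 1#) * x       ≈⟨ *-congʳ p•1≈0 ⟩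
        0# * x             ≈⟨ zeroˡ x ⟩
        0#                 ∎) ⟩
      k • 0#               ≈⟨ •0 k ⟩
      0#                   ∎
      where
      •0 : ∀ k → k • 0# ≈ 0#
      •0 zero    = refl
      •0 (suc k) = trans (+-identityˡ _) (•0 k)

    ^′≡^ : ∀ x n → x ^′ n ≡ x ^ n
    ^′≡^ x zero    = ≡.refl
    ^′≡^ x (suc n) = ≡.cong (x *_) (^′≡^ x n)

    prime-frobenius : ∀ x y → (x + y) ^ p ≈ x ^ p + y ^ p
    prime-frobenius = go p ≡.refl
      where
      go : ∀ n → n ≡ p → ∀ x y → (x + y) ^ n ≈ x ^ n + y ^ n
      go zero    0≡p x y = ⊥-elim (ℕ.<⇒≢ (ℕ.<-trans (s≤s z≤n) (prime>1 p-prime)) 0≡p)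
      go (suc n) ≡.refl x y = begin
        (x + y) ^ suc n                          ≡⟨ ^′≡^ (x + y) (suc n) ⟨
        (x + y) ^′ suc n                         ≈⟨ Binomial.theorem commutativeSemiring (suc n) x y ⟩
        t zero + sum (λ i → t (suc i))           ≈⟨ +-cong first (trans (sum-init-last (λ i → t (suc i))) (+-cong middle last)) ⟩
        y ^ suc n + (0# + x ^ suc n)             ≈⟨ trans (+-congˡ (+-identityˡ _)) (+-comm _ _) ⟩
        x ^ suc n + y ^ suc n                    ∎
        where
        t : Fin (suc (suc n)) → Carrier
        t = Binomial.binomialTerm commutativeSemiring x y (suc n)

        first : t zero ≈ y ^ suc n
        first = trans (+-identityʳ _) (trans (*-identityˡ _) (reflexive (^′≡^ y (suc n))))

        last : t (suc (Fin.fromℕ n)) ≈ x ^ suc n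
        last = begin
          (suc n ℕ.C suc (Fin.toℕ (Fin.fromℕ n))) • ((x ^′ suc (Fin.toℕ (Fin.fromℕ n))) * (y ^′ (n ℕ.∸ Fin.toℕ (Fin.fromℕ n))))
            ≡⟨ ≡.cong (λ j → (suc n ℕ.C suc j) • ((x ^′ suc j) * (y ^′ (n ℕ.∸ j)))) (Fin.toℕ-fromℕ n) ⟩
          (suc n ℕ.C suc n) • ((x ^′ suc n) * (y ^′ (n ℕ.∸ n)))
            ≡⟨ ≡.cong₂ (λ k j → k • ((x ^′ suc n) * (y ^′ j))) (nCn≡1 (suc n)) (ℕ.n∸n≡0 n) ⟩
          (x ^′ suc n) * 1# + 0#    ≈⟨ trans (+-identityʳ _) (*-identityʳ _) ⟩
          x ^′ suc n                ≡⟨ ^′≡^ x (suc n) ⟩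
          x ^ suc n                 ∎

        middle : sum (λ i → t (suc (Fin.inject₁ i))) ≈ 0#
        middle = trans (sum-cong-≋ (λ i → multiple≈0 (prime∣C p-prime (s≤s z≤n)
                   (s≤s (≡.subst (ℕ._< n) (≡.sym (Fin.toℕ-inject₁ i)) (Fin.toℕ<n i)))) _)) (sum-replicate-zero n)

    frobenius : ∀ e x y → (x + y) ^ (p ℕ.^ e) ≈ x ^ (p ℕ.^ e) + y ^ (p ℕ.^ e)
    frobenius zero    x y = distribʳ 1# x y
    frobenius (suc e) x y = begin
      (x + y) ^ (p ℕ.* p ℕ.^ e)                        ≈⟨ ^-* _ p (p ℕ.^ e) ⟩
      ((x + y) ^ (p ℕ.^ e)) ^ p                        ≈⟨ ^-congˡ p (frobenius e x y) ⟩
      (x ^ (p ℕ.^ e) + y ^ (p ℕ.^ e)) ^ p              ≈⟨ prime-frobenius _ _ ⟩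
      (x ^ (p ℕ.^ e)) ^ p + (y ^ (p ℕ.^ e)) ^ p        ≈⟨ +-cong (^-* x p _) (^-* y p _) ⟨
      x ^ (p ℕ.* p ℕ.^ e) + y ^ (p ℕ.* p ℕ.^ e)        ∎

primePower>1 : ∀ {q} → IsPrimePower q → 1 ℕ.< q
primePower>1 (p , zero  , p-prime , () , _)
primePower>1 (p , suc e , p-prime , _ , ≡.refl) =
  ℕ.<-≤-trans (prime>1 p-prime) (ℕ.m≤m*n p (p ℕ.^ e) {{ℕ.m^n≢0 p e {{ℕ.>-nonZero (ℕ.<-trans (s≤s z≤n) (prime>1 p-prime))}}}})

-- The Frobenius map σ on the field with q⁶ elements

module Frobenius {c ℓ} (F : Field c ℓ) {q : ℕ} (q-primePower : IsPrimePower q)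
                 (card : FieldTheory.HasCard F (q ℕ.^ 6)) where
  open FieldLemmas F public
  open Polynomials F
  open FiniteField F card public using (_≟_; search; nonroot; zero-product; ^≈0⇒≈0; x^N≈x)
  open SetoidReasoning setoid

  q>1 : 1 ℕ.< q
  q>1 = primePower>1 q-primePower

  instance
    q-nonZero : ℕ.NonZero q
    q-nonZero = ℕ.>-nonZero (ℕ.<-trans (s≤s z≤n) q>1)

  σ : Carrier → Carrier
  σ x = x ^ q

  frobenius : Endomorphism commutativeRing
  frobenius = record
    { σ = σ ; σ-cong = ^-congˡ q ; σ-+ = additive q-primePower card ; σ-* = λ x y → *-^ x y q ; σ-1 = 1^ q }
    where
    additive : IsPrimePower q → HasCard (q ℕ.^ 6) → ∀ x y → (x + y) ^ q ≈ x ^ q + y ^ q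
    additive (p , e , p-prime , _ , ≡.refl) card = C.frobenius p•1≈0 e
      where
      module C = Characteristic F p-prime
      open FiniteField F card using (all)
      -- The field has q⁶ = p^(6e) elements, and this multiple of 1 vanishes by translation
      -- invariance of the sum of all elements.
      p•1≈0 = C.prime•1≈0 (λ n → ^≈0⇒≈0 n) (e ℕ.* 6) (trans
        (reflexive (≡.cong (λ n → MonoidSumMult._×_ n 1#) (≡.sym (ℕ.^-*-assoc p e 6))))
        (Enumerated.card•1≈0 F all (λ _ → tt) (λ _ → tt)))
        where import Algebra.Properties.Monoid.Mult +-monoid as MonoidSumMult

  open Endomorphism frobenius public using (σ-cong; σ-+; σ-*; σ-1; σ^)
  open RingSolver frobenius public
    using (σ-0; σ--; Var; Expr; _of-period_by_; solve; _:+_; _:*_; _:-_; :-_; _:=_; :σ; :0; :1)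

  ^q^ : ∀ k x → x ^ (q ℕ.^ k) ≈ σ^ k x
  ^q^ zero    x = *-identityʳ x
  ^q^ (suc k) x = trans (^-* x q (q ℕ.^ k)) (σ-cong (^q^ k x))

  σ⁶ : ∀ x → σ^ 6 x ≈ x
  σ⁶ x = trans (sym (^q^ 6 x)) (x^N≈x x)

  ⌜_⌝ : Carrier → Var
  ⌜ x ⌝ = x of-period 6 by σ⁶ x

  σ≈0⇒≈0 : ∀ {x} → σ x ≈ 0# → x ≈ 0#
  σ≈0⇒≈0 = ^≈0⇒≈0 q

  σ-≉0 : ∀ {x} → ¬ x ≈ 0# → ¬ σ x ≈ 0#
  σ-≉0 x≉0 = x≉0 ∘ σ≈0⇒≈0

  -- Linearized polynomials

  Tr : Carrier → Carrier
  Tr x = x + σ x + σ^ 2 x + σ^ 3 x + σ^ 4 x + σ^ 5 x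

  linear : (c₀ c₁ c₂ c₃ c₄ c₅ : Carrier) → Carrier → Carrier
  linear c₀ c₁ c₂ c₃ c₄ c₅ z = c₀ * z + c₁ * σ z + c₂ * σ^ 2 z + c₃ * σ^ 3 z + c₄ * σ^ 4 z + c₅ * σ^ 5 z

  linear-monic : ∀ c₀ c₁ c₂ c₃ c₄ → Monic (q ℕ.^ 5) (linear c₀ c₁ c₂ c₃ c₄ 1#)
  linear-monic c₀ c₁ c₂ c₃ c₄ = monic-resp (λ z → trans (+-comm _ _) (+-congˡ (sym (*-identityˡ _))))
    (monic-+ (monic-resp (^q^ 5) (monic-^ (q ℕ.^ 5)))
      (below-+ (below-+ (below-+ (below-+ (term 0 (s≤s z≤n) c₀) (term 1 (s≤s (s≤s z≤n)) c₁))
        (term 2 (s≤s (s≤s (s≤s z≤n))) c₂)) (term 3 (s≤s (s≤s (s≤s (s≤s z≤n)))) c₃)) (term 4 ℕ.≤-refl c₄)))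
    where
    term : ∀ k → k ℕ.< 5 → ∀ c → Below (q ℕ.^ 5) (λ z → c * σ^ k z)
    term k k<5 c = below-scale c (below-resp (^q^ k)
      (below-≤ (ℕ.^-monoʳ-< q q>1 k<5) (monic⇒below (monic-^ (q ℕ.^ k)))))

  Tr-monic : Monic (q ℕ.^ 5) Tr
  Tr-monic = monic-resp (λ z → +-cong (+-cong (+-cong (+-cong (+-cong (*-identityˡ _) (*-identityˡ _)) (*-identityˡ _))
    (*-identityˡ _)) (*-identityˡ _)) (*-identityˡ _)) (linear-monic 1# 1# 1# 1# 1#)

  σ^-cong : ∀ n {x y} → x ≈ y → σ^ n x ≈ σ^ n y
  σ^-cong zero    x≈y = x≈y
  σ^-cong (suc n) x≈y = σ-cong (σ^-cong n x≈y)

  linear-cong : ∀ c₀ c₁ c₂ c₃ c₄ c₅ {x y} → x ≈ y → linear c₀ c₁ c₂ c₃ c₄ c₅ x ≈ linear c₀ c₁ c₂ c₃ c₄ c₅ y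
  linear-cong c₀ c₁ c₂ c₃ c₄ c₅ x≈y = +-cong (+-cong (+-cong (+-cong (+-cong (*-congˡ x≈y) (*-congˡ (σ^-cong 1 x≈y)))
    (*-congˡ (σ^-cong 2 x≈y))) (*-congˡ (σ^-cong 3 x≈y))) (*-congˡ (σ^-cong 4 x≈y))) (*-congˡ (σ^-cong 5 x≈y))

  -- Made monic, the function has degree q⁵, while there are q⁶ arguments. The auxiliary elements
  -- needed later only have to make some linear expression in their conjugates nonzero, and are
  -- obtained from here.
  linear-nonzero : ∀ c₀ c₁ c₂ c₃ c₄ {c₅} → ¬ c₅ ≈ 0# → ∃ λ z → ¬ linear c₀ c₁ c₂ c₃ c₄ c₅ z ≈ 0#
  linear-nonzero c₀ c₁ c₂ c₃ c₄ {c₅} c₅≉0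
    with nonroot (linear-cong _ _ _ _ _ _) (ℕ.^-monoʳ-< q q>1 {5} {6} ℕ.≤-refl)
           (linear-monic (d * c₀) (d * c₁) (d * c₂) (d * c₃) (d * c₄))
    where d = inv c₅≉0
  ... | z , Lz≉0 = z , λ cz≈0 → Lz≉0 (begin
    linear (d * c₀) (d * c₁) (d * c₂) (d * c₃) (d * c₄) 1# z
      ≈⟨ +-congˡ (*-congʳ (inv-left c₅≉0)) ⟨
    linear (d * c₀) (d * c₁) (d * c₂) (d * c₃) (d * c₄) (d * c₅) z
      ≈⟨ solve (⌜ d ⌝ ∷ ⌜ c₀ ⌝ ∷ ⌜ c₁ ⌝ ∷ ⌜ c₂ ⌝ ∷ ⌜ c₃ ⌝ ∷ ⌜ c₄ ⌝ ∷ ⌜ c₅ ⌝ ∷ ⌜ z ⌝ ∷ [])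
           (λ d c₀ c₁ c₂ c₃ c₄ c₅ z → let z₁ = :σ z; z₂ = :σ z₁; z₃ = :σ z₂; z₄ = :σ z₃; z₅ = :σ z₄ in
             (d :* c₀) :* z :+ (d :* c₁) :* z₁ :+ (d :* c₂) :* z₂ :+ (d :* c₃) :* z₃ :+ (d :* c₄) :* z₄ :+ (d :* c₅) :* z₅
             := d :* (c₀ :* z :+ c₁ :* z₁ :+ c₂ :* z₂ :+ c₃ :* z₃ :+ c₄ :* z₄ :+ c₅ :* z₅)) ≡.refl ⟩
    d * linear c₀ c₁ c₂ c₃ c₄ c₅ z
      ≈⟨ *-congˡ cz≈0 ⟩
    d * 0#
      ≈⟨ zeroʳ d ⟩
    0# ∎)
    where d = inv c₅≉0

  -- The fixed field of σ

  Fixed : Carrier → Set ℓ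
  Fixed x = σ x ≈ x

  ⌜_∣_⌝ : ∀ x → Fixed x → Var
  ⌜ x ∣ fixed ⌝ = x of-period 1 by fixed

  Tr-fixed : ∀ x → Fixed (Tr x)
  Tr-fixed x = solve (⌜ x ⌝ ∷ []) (λ x → let x₁ = :σ x; x₂ = :σ x₁; x₃ = :σ x₂; x₄ = :σ x₃; x₅ = :σ x₄
                                             t = x :+ x₁ :+ x₂ :+ x₃ :+ x₄ :+ x₅ in :σ t := t) ≡.refl

  fixed-+ : ∀ {x y} → Fixed x → Fixed y → Fixed (x + y)
  fixed-+ x y = trans (σ-+ _ _) (+-cong x y)

  fixed-* : ∀ {x y} → Fixed x → Fixed y → Fixed (x * y)
  fixed-* x y = trans (σ-* _ _) (*-cong x y)

  fixed-neg : ∀ {x} → Fixed x → Fixed (- x)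
  fixed-neg x = trans (σ-- _) (-‿cong x)

  σ-inv : ∀ {x} (x≉0 : ¬ x ≈ 0#) → σ x * σ (inv x≉0) ≈ 1#
  σ-inv x≉0 = trans (sym (σ-* _ _)) (trans (σ-cong (inv-right x≉0)) σ-1)

  inv-unique : ∀ {x y z} → x * y ≈ 1# → x * z ≈ 1# → y ≈ z
  inv-unique xy≈1 xz≈1 = *-cancelˡ (unit-≉0 xy≈1) (trans xy≈1 (sym xz≈1))

  fixed-inv : ∀ {x} (x≉0 : ¬ x ≈ 0#) → Fixed x → Fixed (inv x≉0)
  fixed-inv x≉0 x-fixed = inv-unique (trans (*-congʳ (sym x-fixed)) (σ-inv x≉0)) (inv-right x≉0)

  ∏[Tr-_] : ∀ {m} → (Fin m → Carrier) → Carrier → Carrier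
  ∏[Tr-_] {zero}  f z = 1#
  ∏[Tr-_] {suc m} f z = (Tr z - f zero) * ∏[Tr- f ∘ suc ] z

  product-monic : ∀ {m} (f : Fin m → Carrier) → Monic (m ℕ.* q ℕ.^ 5) ∏[Tr- f ]
  product-monic {zero}  f = one (λ _ → refl)
  product-monic {suc m} f = monic-* (monic-+ Tr-monic (below-≤ (ℕ.m^n>0 q 5) (below-const (- f zero)))) (product-monic (f ∘ suc))

  product-cong : ∀ {m} (f : Fin m → Carrier) {x y} → x ≈ y → ∏[Tr- f ] x ≈ ∏[Tr- f ] y
  product-cong {zero}  f x≈y = refl
  product-cong {suc m} f x≈y = *-cong (+-congʳ (+-cong (+-cong (+-cong (+-cong (+-cong x≈y (σ^-cong 1 x≈y))
    (σ^-cong 2 x≈y)) (σ^-cong 3 x≈y)) (σ^-cong 4 x≈y)) (σ^-cong 5 x≈y))) (product-cong (f ∘ suc) x≈y)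

  product-zero : ∀ {m} (f : Fin m → Carrier) {z} i → Tr z ≈ f i → ∏[Tr- f ] z ≈ 0#
  product-zero f zero    eq = trans (*-congʳ (x≈y⇒x-y≈0 eq)) (zeroˡ _)
  product-zero f (suc i) eq = trans (*-congˡ (product-zero (f ∘ suc) i eq)) (zeroʳ _)

  -- A trace avoiding a list of m < q elements exists because the product of the Tr z - fᵢ has
  -- degree m q⁵ < q⁶ in z.
  fixed-list : ∀ m → m ℕ.≤ q → Σ (Fin m → Carrier) λ f → (∀ i j → f i ≈ f j → i ≡ j) × (∀ i → Fixed (f i))
  fixed-list zero    _   = (λ ()) , (λ ()) , λ ()
  fixed-list (suc m) m<q with fixed-list m (ℕ.<⇒≤ m<q)
  ... | f , f-inj , f-fixed with nonroot (product-cong f) (ℕ.*-monoˡ-< (q ℕ.^ 5) {{ℕ.m^n≢0 q 5}} m<q) (product-monic f)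
  ... | z , fz≉0 = f′ , inj , λ { zero → Tr-fixed z ; (suc i) → f-fixed i }
    where
    f′ : Fin (suc m) → Carrier
    f′ zero    = Tr z
    f′ (suc i) = f i

    inj : ∀ i j → f′ i ≈ f′ j → i ≡ j
    inj zero    zero    eq = ≡.refl
    inj zero    (suc j) eq = ⊥-elim (fz≉0 (product-zero f j eq))
    inj (suc i) zero    eq = ⊥-elim (fz≉0 (product-zero f i (sym eq)))
    inj (suc i) (suc j) eq = ≡.cong suc (f-inj i j eq)

  -- Any q distinct fixed elements exhaust the fixed field, because x^q - x is monic of degree q;
  -- the traces of `fixed-list` supply them.
  F-q : Enumeration F Fixed q
  F-q with fixed-list q ℕ.≤-refl
  ... | f , f-inj , f-fixed = record { enum = f ; injective = f-inj ; member = f-fixed ; complete = complete }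
    where
    x^q-x : Monic q (λ x → x ^ q - x)
    x^q-x = monic-+ (monic-^ q) (below-≤ q>1 (below-resp (λ x → trans (sym (-‿distribˡ-* 1# x)) (-‿cong (*-identityˡ x)))
      (below-scale (- 1#) (monic⇒below monic-id))))

    complete : ∀ x → Fixed x → Σ (Fin q) λ i → f i ≈ x
    complete x x-fixed with Fin.any? (λ i → f i ≟ x)
    ... | yes p = p
    ... | no  ∄ = ⊥-elim (root-bound x^q-x r r-inj λ { zero → x≈y⇒x-y≈0 x-fixed ; (suc i) → x≈y⇒x-y≈0 (f-fixed i) })
      where
      r : Fin (suc q) → Carrier
      r zero    = x
      r (suc i) = f i

      r-inj : ∀ i j → r i ≈ r j → i ≡ j
      r-inj zero    zero    eq = ≡.refl
      r-inj zero    (suc j) eq = ⊥-elim (∄ (j , sym eq))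
      r-inj (suc i) zero    eq = ⊥-elim (∄ (i , eq))
      r-inj (suc i) (suc j) eq = ≡.cong suc (f-inj i j eq)

  open Enumeration F-q public using () renaming (enum to fixed; injective to fixed-injective; member to fixed-member; complete to fixed-complete)

-- Zeros of ternary quadratic polynomials, after Chevalley and Warning

module Chevalley {c ℓ} (F : Field c ℓ) {q : ℕ} (q-primePower : IsPrimePower q)
                 (card : FieldTheory.HasCard F (q ℕ.^ 6)) where
  open Frobenius F q-primePower card
  open Polynomials F
  open SetoidReasoning setoid
  open SemiringSum semiring using (sum; *-distribˡ-sum; *-distribʳ-sum)
  open MonoidSum +-commutativeMonoid using (sum-cong-≋; sum-replicate-zero; sum-replicate; ∑-distrib-+)
  open Enumerated F F-q using (fold-reindex; homothety; card•1≈0)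

  Σ-F-q : (Carrier → Carrier) → Carrier
  Σ-F-q f = sum (λ i → f (fixed i))

  -- At exponent 0 the sum is q times 1. At a positive exponent, scaling by g in F_q permutes F_q
  -- and multiplies the sum by that power of g; if this power were 1 for every nonzero g, then
  -- x^(k+2) - x would have more than k+2 roots.
  power-sum : ∀ k → suc k ℕ.< q → Σ-F-q (_^ k) ≈ 0#
  power-sum zero    _   = trans (sum-replicate q) (card•1≈0 (λ x → fixed-+ x σ-1) (λ x → fixed-+ x (fixed-neg σ-1)))
  power-sum (suc k) k+2<q with Fin.any? (λ i → ¬? (fixed i ^ suc (suc k) - fixed i ≟ 0#))
  ... | no ∄ = ⊥-elim (root-bound (monic-+ (monic-^ (suc (suc k))) (below-≤ (s≤s (s≤s z≤n)) (monic-negate))) (fixed ∘ inject)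
        (λ i j eq → Fin.inject≤-injective k+2<q k+2<q i j (fixed-injective _ _ eq))
        (λ i → decidable-stable (_ ≟ 0#) (λ ≉0 → ∄ (inject i , ≉0))))
    where
    inject : Fin (suc (suc (suc k))) → Fin q
    inject i = Fin.inject≤ i k+2<q
    monic-negate : Below 2 (λ x → - x)
    monic-negate = below-resp (λ x → trans (sym (-‿distribˡ-* 1# x)) (-‿cong (*-identityˡ x))) (below-scale (- 1#) (monic⇒below monic-id))
  ... | yes (i , gᵏ⁺²≉g) = *-cancel gᵏ⁺¹-1≉0 (begin
      (g ^ suc k - 1#) * S              ≈⟨ solve (⌜ g ^ suc k ⌝ ∷ ⌜ S ⌝ ∷ []) (λ g S → (g :- :1) :* S := g :* S :- S) ≡.refl ⟩
      g ^ suc k * S - S                 ≈⟨ x≈y⇒x-y≈0 (begin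
        g ^ suc k * S                             ≈⟨ *-distribˡ-sum (g ^ suc k) (λ j → fixed j ^ suc k) ⟩
        sum (λ j → g ^ suc k * fixed j ^ suc k)   ≈⟨ sum-cong-≋ (λ j → *-^ g (fixed j) (suc k)) ⟨
        sum (λ j → (g * fixed j) ^ suc k)         ≈⟨ fold-reindex +-commutativeMonoid
                                                       (homothety g≉0 (fixed-* g-fixed) (fixed-* (fixed-inv g≉0 g-fixed))) (_^ suc k) (^-congˡ (suc k)) ⟨
        S                                         ∎) ⟩
      0#                                ∎)
    where
    g = fixed i
    g-fixed = fixed-member i
    S = Σ-F-q (_^ suc k)

    g≉0 : ¬ g ≈ 0#
    g≉0 g≈0 = gᵏ⁺²≉g (trans (+-cong (trans (*-congʳ g≈0) (zeroˡ _)) (-‿cong g≈0)) (-‿inverseʳ 0#))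

    gᵏ⁺¹-1≉0 : ¬ g ^ suc k - 1# ≈ 0#
    gᵏ⁺¹-1≉0 eq = gᵏ⁺²≉g (x≈y⇒x-y≈0 (trans (*-congˡ (x-y≈0⇒x≈y eq)) (*-identityʳ g)))

  -- Functions which on triples of fixed elements are polynomials of degree at most d.
  data Poly₃ : ℕ → (Carrier → Carrier → Carrier → Carrier) → Set (c ⊔ ℓ) where
    mono : ∀ {d f} a i j k → i ℕ.+ (j ℕ.+ k) ℕ.≤ d →
           (∀ {x y z} → Fixed x → Fixed y → Fixed z → f x y z ≈ a * (x ^ i * (y ^ j * z ^ k))) → Poly₃ d f
    plus : ∀ {d f g h} → Poly₃ d g → Poly₃ d h →
           (∀ {x y z} → Fixed x → Fixed y → Fixed z → f x y z ≈ g x y z + h x y z) → Poly₃ d f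

  resp₃ : ∀ {d f g} → (∀ {x y z} → Fixed x → Fixed y → Fixed z → g x y z ≈ f x y z) → Poly₃ d f → Poly₃ d g
  resp₃ g≈f (mono a i j k ≤d eq) = mono a i j k ≤d (λ x y z → trans (g≈f x y z) (eq x y z))
  resp₃ g≈f (plus p r eq)        = plus p r (λ x y z → trans (g≈f x y z) (eq x y z))

  _+₃_ : ∀ {d f g} → Poly₃ d f → Poly₃ d g → Poly₃ d (λ x y z → f x y z + g x y z)
  p +₃ r = plus p r (λ _ _ _ → refl)

  _*₃_ : ∀ {d e f g} → Poly₃ d f → Poly₃ e g → Poly₃ (d ℕ.+ e) (λ x y z → f x y z * g x y z)
  plus p p′ eq *₃ r = plus (p *₃ r) (p′ *₃ r) (λ x y z → trans (*-congʳ (eq x y z)) (distribʳ _ _ _))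
  p@(mono _ _ _ _ _ _) *₃ plus r r′ eq = plus (p *₃ r) (p *₃ r′) (λ x y z → trans (*-congˡ (eq x y z)) (distribˡ _ _ _))
  mono {d} {f} a i j k ≤d eq *₃ mono {e} {g} b i′ j′ k′ ≤e eq′ =
    mono (a * b) (i ℕ.+ i′) (j ℕ.+ j′) (k ℕ.+ k′) degree λ {x} {y} {z} x∈ y∈ z∈ → begin
      f x y z * g x y z
        ≈⟨ *-cong (eq x∈ y∈ z∈) (eq′ x∈ y∈ z∈) ⟩
      (a * (x ^ i * (y ^ j * z ^ k))) * (b * (x ^ i′ * (y ^ j′ * z ^ k′)))
        ≈⟨ solve (⌜ a ⌝ ∷ ⌜ x ^ i ⌝ ∷ ⌜ y ^ j ⌝ ∷ ⌜ z ^ k ⌝ ∷ ⌜ b ⌝ ∷ ⌜ x ^ i′ ⌝ ∷ ⌜ y ^ j′ ⌝ ∷ ⌜ z ^ k′ ⌝ ∷ [])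
             (λ a x y z b x′ y′ z′ → (a :* (x :* (y :* z))) :* (b :* (x′ :* (y′ :* z′))) := (a :* b) :* ((x :* x′) :* ((y :* y′) :* (z :* z′)))) ≡.refl ⟩
      (a * b) * ((x ^ i * x ^ i′) * ((y ^ j * y ^ j′) * (z ^ k * z ^ k′)))
        ≈⟨ *-congˡ (*-cong (^-+ x i i′) (*-cong (^-+ y j j′) (^-+ z k k′))) ⟨
      (a * b) * (x ^ (i ℕ.+ i′) * (y ^ (j ℕ.+ j′) * z ^ (k ℕ.+ k′))) ∎
    where
    degree : i ℕ.+ i′ ℕ.+ (j ℕ.+ j′ ℕ.+ (k ℕ.+ k′)) ℕ.≤ d ℕ.+ e
    degree = ≡.subst (ℕ._≤ d ℕ.+ e) (ℕ-solve i j k i′ j′ k′) (ℕ.+-mono-≤ ≤d ≤e)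
      where
      ℕ-solve : ∀ i j k i′ j′ k′ → i ℕ.+ (j ℕ.+ k) ℕ.+ (i′ ℕ.+ (j′ ℕ.+ k′)) ≡ i ℕ.+ i′ ℕ.+ (j ℕ.+ j′ ℕ.+ (k ℕ.+ k′))
      ℕ-solve = NatSolver.solve-∀

  const₃ : ∀ {d} a → Poly₃ d (λ _ _ _ → a)
  const₃ a = mono a 0 0 0 z≤n (λ _ _ _ → sym (trans (*-congˡ (trans (*-identityˡ _) (*-identityˡ _))) (*-identityʳ a)))

  _^₃_ : ∀ {d f} → Poly₃ d f → ∀ n → Poly₃ (n ℕ.* d) (λ x y z → f x y z ^ n)
  p ^₃ zero  = const₃ 1#
  p ^₃ suc n = p *₃ (p ^₃ n)

  Σ₃ : (Carrier → Carrier → Carrier → Carrier) → Carrier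
  Σ₃ f = Σ-F-q (λ x → Σ-F-q (λ y → Σ-F-q (λ z → f x y z)))

  Σ₃-cong : ∀ f g → (∀ {x y z} → Fixed x → Fixed y → Fixed z → f x y z ≈ g x y z) → Σ₃ f ≈ Σ₃ g
  Σ₃-cong f g eq = sum-cong-≋ λ i → sum-cong-≋ λ j → sum-cong-≋ λ k → eq (fixed-member i) (fixed-member j) (fixed-member k)

  Σ₃-+ : ∀ f g → Σ₃ (λ x y z → f x y z + g x y z) ≈ Σ₃ f + Σ₃ g
  Σ₃-+ f g = trans
    (sum-cong-≋ λ i → trans (sum-cong-≋ λ j → ∑-distrib-+ (λ k → f (fixed i) (fixed j) (fixed k)) (λ k → g (fixed i) (fixed j) (fixed k)))
      (∑-distrib-+ (λ j → Σ-F-q (f (fixed i) (fixed j))) (λ j → Σ-F-q (g (fixed i) (fixed j)))))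
    (∑-distrib-+ (λ i → Σ-F-q (λ y → Σ-F-q (f (fixed i) y))) (λ i → Σ-F-q (λ y → Σ-F-q (g (fixed i) y))))

  sum-factor : ∀ {n} a b (v : Fin n → Carrier) → sum (λ i → a * (v i * b)) ≈ a * (sum v * b)
  sum-factor a b v = sym (trans (*-congˡ (*-distribʳ-sum b v)) (*-distribˡ-sum a (λ i → v i * b)))

  Σ₃-mono : ∀ a i j k → Σ₃ (λ x y z → a * (x ^ i * (y ^ j * z ^ k))) ≈
            a * (Σ-F-q (_^ i) * (Σ-F-q (_^ j) * Σ-F-q (_^ k)))
  Σ₃-mono a i j k = begin
    Σ₃ (λ x y z → a * (x ^ i * (y ^ j * z ^ k)))
      ≈⟨ (sum-cong-≋ λ r → sum-cong-≋ λ s → sum-cong-≋ λ t → solve (⌜ a ⌝ ∷ ⌜ fixed r ^ i ⌝ ∷ ⌜ fixed s ^ j ⌝ ∷ ⌜ fixed t ^ k ⌝ ∷ [])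
            (λ a x y z → a :* (x :* (y :* z)) := (a :* x :* y) :* (z :* :1)) ≡.refl) ⟩
    sum (λ r → sum (λ s → sum (λ t → (a * fixed r ^ i * fixed s ^ j) * (fixed t ^ k * 1#))))
      ≈⟨ (sum-cong-≋ λ r → sum-cong-≋ λ s → sum-factor (a * fixed r ^ i * fixed s ^ j) 1# (λ t → fixed t ^ k)) ⟩
    sum (λ r → sum (λ s → (a * fixed r ^ i * fixed s ^ j) * (Z * 1#)))
      ≈⟨ (sum-cong-≋ λ r → sum-cong-≋ λ s → solve (⌜ a ⌝ ∷ ⌜ fixed r ^ i ⌝ ∷ ⌜ fixed s ^ j ⌝ ∷ ⌜ Z ⌝ ∷ [])
            (λ a x y z → (a :* x :* y) :* (z :* :1) := (a :* x) :* (y :* z)) ≡.refl) ⟩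
    sum (λ r → sum (λ s → (a * fixed r ^ i) * (fixed s ^ j * Z)))
      ≈⟨ (sum-cong-≋ λ r → sum-factor (a * fixed r ^ i) Z (λ s → fixed s ^ j)) ⟩
    sum (λ r → (a * fixed r ^ i) * (Y * Z))
      ≈⟨ (sum-cong-≋ λ r → *-assoc a (fixed r ^ i) (Y * Z)) ⟩
    sum (λ r → a * (fixed r ^ i * (Y * Z)))
      ≈⟨ sum-factor a (Y * Z) (λ r → fixed r ^ i) ⟩
    a * (Σ-F-q (_^ i) * (Y * Z)) ∎
    where
    Y = Σ-F-q (_^ j)
    Z = Σ-F-q (_^ k)

  q-1 : ℕ
  q-1 = ℕ.pred q

  -- The sum over a monomial factors into three power sums. A degree below 3(q-1) forces one
  -- exponent below q-1, and the corresponding factor is 0.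
  Σ₃-vanishes : ∀ {d f} → d ℕ.< 3 ℕ.* q-1 → Poly₃ d f → Σ₃ f ≈ 0#
  Σ₃-vanishes d< (plus {f = f} {g} {h} p r eq) = trans (Σ₃-cong f (λ x y z → g x y z + h x y z) eq) (trans (Σ₃-+ g h) (trans (+-cong (Σ₃-vanishes d< p) (Σ₃-vanishes d< r)) (+-identityˡ 0#)))
  Σ₃-vanishes d< (mono {f = f} a i j k ≤d eq) = trans (Σ₃-cong f (λ x y z → a * (x ^ i * (y ^ j * z ^ k))) eq) (trans (Σ₃-mono a i j k) (trans (*-congˡ factor) (zeroʳ a)))
    where
    small : ∀ {n} → n ℕ.< q-1 → Σ-F-q (_^ n) ≈ 0#
    small {n} n< = power-sum n (≡.subst (suc n ℕ.<_) (ℕ.suc-pred q) (s≤s n<))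

    factor : Σ-F-q (_^ i) * (Σ-F-q (_^ j) * Σ-F-q (_^ k)) ≈ 0#
    factor with i ℕ.<? q-1 | j ℕ.<? q-1 | k ℕ.<? q-1
    ... | yes i< | _      | _      = trans (*-congʳ (small i<)) (zeroˡ _)
    ... | no _   | yes j< | _      = trans (*-congˡ (trans (*-congʳ (small j<)) (zeroˡ _))) (zeroʳ _)
    ... | no _   | no _   | yes k< = trans (*-congˡ (trans (*-congˡ (small k<)) (zeroʳ _))) (zeroʳ _)
    ... | no i≮  | no j≮  | no k≮  = ⊥-elim (ℕ.<⇒≱ d< (ℕ.≤-trans
          (ℕ.+-mono-≤ (ℕ.≮⇒≥ i≮) (ℕ.+-mono-≤ (ℕ.≮⇒≥ j≮) (≡.subst (ℕ._≤ k) (≡.sym (ℕ.+-identityʳ q-1)) (ℕ.≮⇒≥ k≮)))) ≤d))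

  sum-single : ∀ {n} (t : Fin n → Carrier) i → (∀ j → j ≢ i → t j ≈ 0#) → sum t ≈ t i
  sum-single {suc n} t zero    others = trans (+-congˡ (trans (sum-cong-≋ (λ j → others (suc j) (λ ()))) (sum-replicate-zero n))) (+-identityʳ _)
  sum-single {suc n} t (suc i) others = trans (+-cong (others zero (λ ())) (sum-single (t ∘ suc) i (λ j j≢i → others (suc j) (j≢i ∘ Fin.suc-injective)))) (+-identityˡ _)

  Nontrivial : (x y z : Carrier) → Set ℓ
  Nontrivial x y z = ¬ (x ≈ 0# × y ≈ 0# × z ≈ 0#)

  record Zero (f : Carrier → Carrier → Carrier → Carrier) : Set (c ⊔ ℓ) where
    field
      {x y z}     : Carrier
      x-fixed     : Fixed x
      y-fixed     : Fixed y
      z-fixed     : Fixed z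
      nontrivial  : Nontrivial x y z
      is-zero     : f x y z ≈ 0#

  fixed^[q-1] : ∀ {x} → Fixed x → ¬ x ≈ 0# → x ^ q-1 ≈ 1#
  fixed^[q-1] {x} x-fixed x≉0 = *-cancelˡ x≉0 (begin
    x ^ suc q-1   ≡⟨ ≡.cong (x ^_) (ℕ.suc-pred q) ⟩
    x ^ q         ≈⟨ x-fixed ⟩
    x             ≈⟨ *-identityʳ x ⟨
    x * 1#        ∎)

  -- Otherwise Σ (1 - f^{q-1}) = 1, while its degree is too small.
  conic : ∀ {f} → Poly₃ 2 f → (∀ {x y z} → Fixed x → Fixed y → Fixed z → Fixed (f x y z)) →
          (∀ {x y z} → x ≈ 0# → y ≈ 0# → z ≈ 0# → f x y z ≈ 0#) → Zero f
  conic {f} f-poly f-fixed f-zero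
    with Fin.any? (λ i → Fin.any? (λ j → Fin.any? (λ k →
           ¬? (fixed i ≟ 0# ×-dec fixed j ≟ 0# ×-dec fixed k ≟ 0#) ×-dec f (fixed i) (fixed j) (fixed k) ≟ 0#)))
  ... | yes (i , j , k , nontrivial , is-zero) = record
        { x-fixed = fixed-member i ; y-fixed = fixed-member j ; z-fixed = fixed-member k ; nontrivial = nontrivial ; is-zero = is-zero }
  ... | no ∄ = ⊥-elim (0≉1 (trans (sym (Σ₃-vanishes 2[q-1]<3[q-1] g-poly)) Σg≈1))
    where
    g : Carrier → Carrier → Carrier → Carrier
    g x y z = 1# + - 1# * f x y z ^ q-1

    0<q-1 : 0 ℕ.< q-1
    0<q-1 = ℕ.≤-pred (≡.subst (1 ℕ.<_) (≡.sym (ℕ.suc-pred q)) q>1)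

    2[q-1]<3[q-1] : q-1 ℕ.* 2 ℕ.< 3 ℕ.* q-1
    2[q-1]<3[q-1] = ≡.subst (ℕ._< 3 ℕ.* q-1) (ℕ.*-comm 2 q-1) (ℕ.*-monoˡ-< q-1 {{ℕ.>-nonZero 0<q-1}} (ℕ.n<1+n 2))

    g-poly : Poly₃ (q-1 ℕ.* 2) g
    g-poly = const₃ 1# +₃ (const₃ {0} (- 1#) *₃ (f-poly ^₃ q-1))

    g-nontrivial : ∀ i j k → Nontrivial (fixed i) (fixed j) (fixed k) → g (fixed i) (fixed j) (fixed k) ≈ 0#
    g-nontrivial i j k nt = begin
      1# + - 1# * f (fixed i) (fixed j) (fixed k) ^ q-1
        ≈⟨ +-congˡ (*-congˡ (fixed^[q-1] (f-fixed (fixed-member i) (fixed-member j) (fixed-member k)) (λ f≈0 → ∄ (i , j , k , nt , f≈0)))) ⟩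
      1# + - 1# * 1#   ≈⟨ +-congˡ (*-identityʳ _) ⟩
      1# - 1#          ≈⟨ -‿inverseʳ 1# ⟩
      0#               ∎

    o : Fin q
    o = proj₁ (fixed-complete 0# σ-0)

    o≈0 : fixed o ≈ 0#
    o≈0 = proj₂ (fixed-complete 0# σ-0)

    ≢o : ∀ {i} → i ≢ o → ¬ fixed i ≈ 0#
    ≢o i≢o eq = i≢o (fixed-injective _ _ (trans eq (sym o≈0)))

    Σ0 : ∀ {v : Fin q → Carrier} → (∀ i → v i ≈ 0#) → sum v ≈ 0#
    Σ0 v≈0 = trans (sum-cong-≋ v≈0) (sum-replicate-zero q)

    Σg≈1 : Σ₃ g ≈ 1#
    Σg≈1 = begin
      Σ₃ g
        ≈⟨ sum-single (λ i → Σ-F-q (λ y → Σ-F-q (λ z → g (fixed i) y z))) o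
             (λ i i≢o → Σ0 (λ j → Σ0 (λ k → g-nontrivial i j k (≢o i≢o ∘ proj₁)))) ⟩
      Σ-F-q (λ y → Σ-F-q (λ z → g (fixed o) y z))
        ≈⟨ sum-single (λ j → Σ-F-q (λ z → g (fixed o) (fixed j) z)) o
             (λ j j≢o → Σ0 (λ k → g-nontrivial o j k (≢o j≢o ∘ proj₁ ∘ proj₂))) ⟩
      Σ-F-q (λ z → g (fixed o) (fixed o) z)
        ≈⟨ sum-single (λ k → g (fixed o) (fixed o) (fixed k)) o (λ k k≢o → g-nontrivial o o k (≢o k≢o ∘ proj₂ ∘ proj₂)) ⟩
      1# + - 1# * f (fixed o) (fixed o) (fixed o) ^ q-1
        ≈⟨ +-congˡ (*-congˡ (trans (^-congˡ q-1 (f-zero o≈0 o≈0 o≈0)) (0^ 0<q-1))) ⟩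
      1# + - 1# * 0#   ≈⟨ +-congˡ (zeroʳ _) ⟩
      1# + 0#          ≈⟨ +-identityʳ 1# ⟩
      1#               ∎
      where
      0^ : ∀ {n} → 0 ℕ.< n → 0# ^ n ≈ 0#
      0^ {suc n} _ = zeroˡ _

-- The form h, collinearity, and lines meeting the curve

module Plane {c ℓ} (F : Field c ℓ) {q : ℕ} (q-primePower : IsPrimePower q)
             (card : FieldTheory.HasCard F (q ℕ.^ 6)) where
  open Frobenius F q-primePower card public
  open Polynomials F using (Monic; monic-^; monic-+; below-≤; below-const; root-bound)
  open FieldTheory F public using (Triple; ⟨_,_,_⟩; NonZero; _∼_; _on_; CollinearIn; Hermitian)
    renaming (x to X; y to Y; z to Z)
  open SetoidReasoning setoid

  infix 4 _≋_
  _≋_ : Triple → Triple → Set ℓ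
  A ≋ B = X A ≈ X B × Y A ≈ Y B × Z A ≈ Z B

  ≋-sym : ∀ {A B} → A ≋ B → B ≋ A
  ≋-sym (x , y , z) = sym x , sym y , sym z

  ≋-trans : ∀ {A B C} → A ≋ B → B ≋ C → A ≋ C
  ≋-trans (x , y , z) (x′ , y′ , z′) = trans x x′ , trans y y′ , trans z z′

  𝟎 : Triple
  𝟎 = ⟨ 0# , 0# , 0# ⟩

  infixr 7 _·_
  infixl 6 _⊕_
  _·_ : Carrier → Triple → Triple
  s · A = ⟨ s * X A , s * Y A , s * Z A ⟩

  _⊕_ : Triple → Triple → Triple
  A ⊕ B = ⟨ X A + X B , Y A + Y B , Z A + Z B ⟩

  ·-cong : ∀ {s t A B} → s ≈ t → A ≋ B → s · A ≋ t · B
  ·-cong s≈t (x , y , z) = *-cong s≈t x , *-cong s≈t y , *-cong s≈t z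

  -- The sesquilinear form whose isotropic vectors are the points of the Hermitian curve

  h : Triple → Triple → Carrier
  h A B = X A * σ (X B) - (Y A * σ (Z B) + Z A * σ (Y B))

  h-cong : ∀ {A A′ B B′} → A ≋ A′ → B ≋ B′ → h A B ≈ h A′ B′
  h-cong (x , y , z) (x′ , y′ , z′) =
    +-cong (*-cong x (σ-cong x′)) (-‿cong (+-cong (*-cong y (σ-cong z′)) (*-cong z (σ-cong y′))))

  h-⊕ˡ : ∀ A B C → h (A ⊕ B) C ≈ h A C + h B C
  h-⊕ˡ ⟨ a , b , c ⟩ ⟨ d , e , f ⟩ ⟨ u , v , w ⟩ = solve
    (⌜ a ⌝ ∷ ⌜ b ⌝ ∷ ⌜ c ⌝ ∷ ⌜ d ⌝ ∷ ⌜ e ⌝ ∷ ⌜ f ⌝ ∷ ⌜ u ⌝ ∷ ⌜ v ⌝ ∷ ⌜ w ⌝ ∷ [])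
    (λ a b c d e f u v w → (a :+ d) :* :σ u :- ((b :+ e) :* :σ w :+ (c :+ f) :* :σ v)
      := (a :* :σ u :- (b :* :σ w :+ c :* :σ v)) :+ (d :* :σ u :- (e :* :σ w :+ f :* :σ v))) ≡.refl

  h-⊕ʳ : ∀ A B C → h A (B ⊕ C) ≈ h A B + h A C
  h-⊕ʳ ⟨ u , v , w ⟩ ⟨ a , b , c ⟩ ⟨ d , e , f ⟩ = solve
    (⌜ a ⌝ ∷ ⌜ b ⌝ ∷ ⌜ c ⌝ ∷ ⌜ d ⌝ ∷ ⌜ e ⌝ ∷ ⌜ f ⌝ ∷ ⌜ u ⌝ ∷ ⌜ v ⌝ ∷ ⌜ w ⌝ ∷ [])
    (λ a b c d e f u v w → u :* :σ (a :+ d) :- (v :* :σ (c :+ f) :+ w :* :σ (b :+ e))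
      := (u :* :σ a :- (v :* :σ c :+ w :* :σ b)) :+ (u :* :σ d :- (v :* :σ f :+ w :* :σ e))) ≡.refl

  h-·ˡ : ∀ s A B → h (s · A) B ≈ s * h A B
  h-·ˡ s ⟨ a , b , c ⟩ ⟨ u , v , w ⟩ = solve (⌜ s ⌝ ∷ ⌜ a ⌝ ∷ ⌜ b ⌝ ∷ ⌜ c ⌝ ∷ ⌜ u ⌝ ∷ ⌜ v ⌝ ∷ ⌜ w ⌝ ∷ [])
    (λ s a b c u v w → s :* a :* :σ u :- (s :* b :* :σ w :+ s :* c :* :σ v)
      := s :* (a :* :σ u :- (b :* :σ w :+ c :* :σ v))) ≡.refl

  h-·ʳ : ∀ s A B → h A (s · B) ≈ σ s * h A B
  h-·ʳ s ⟨ a , b , c ⟩ ⟨ u , v , w ⟩ = solve (⌜ s ⌝ ∷ ⌜ a ⌝ ∷ ⌜ b ⌝ ∷ ⌜ c ⌝ ∷ ⌜ u ⌝ ∷ ⌜ v ⌝ ∷ ⌜ w ⌝ ∷ [])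
    (λ s a b c u v w → a :* :σ (s :* u) :- (b :* :σ (s :* w) :+ c :* :σ (s :* v))
      := :σ s :* (a :* :σ u :- (b :* :σ w :+ c :* :σ v))) ≡.refl

  h-·· : ∀ s t A B → h (s · A) (t · B) ≈ s * σ t * h A B
  h-·· s t A B = trans (h-·ˡ s A (t · B)) (trans (*-congˡ (h-·ʳ t A B)) (sym (*-assoc _ _ _)))

  h-combination : ∀ s A t B u C v D → h (s · A ⊕ t · B) (u · C ⊕ v · D) ≈
                  (s * σ u * h A C + s * σ v * h A D) + (t * σ u * h B C + t * σ v * h B D)
  h-combination s A t B u C v D = begin
    h (s · A ⊕ t · B) (u · C ⊕ v · D)
      ≈⟨ h-⊕ˡ (s · A) (t · B) _ ⟩
    h (s · A) (u · C ⊕ v · D) + h (t · B) (u · C ⊕ v · D)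
      ≈⟨ +-cong (h-⊕ʳ (s · A) (u · C) (v · D)) (h-⊕ʳ (t · B) (u · C) (v · D)) ⟩
    (h (s · A) (u · C) + h (s · A) (v · D)) + (h (t · B) (u · C) + h (t · B) (v · D))
      ≈⟨ +-cong (+-cong (h-·· s u A C) (h-·· s v A D)) (+-cong (h-·· t u B C) (h-·· t v B D)) ⟩
    (s * σ u * h A C + s * σ v * h A D) + (t * σ u * h B C + t * σ v * h B D) ∎

  φ : Triple → Triple
  φ A = ⟨ σ^ 2 (X A) , σ^ 2 (Y A) , σ^ 2 (Z A) ⟩

  -- The substitute for Hermitian symmetry: exchanging the arguments costs an application of φ,
  -- because σ applied twice does not return to the start.
  σ-h : ∀ A B → σ (h A B) ≈ h (φ B) A
  σ-h ⟨ a , b , c ⟩ ⟨ u , v , w ⟩ = solve (⌜ a ⌝ ∷ ⌜ b ⌝ ∷ ⌜ c ⌝ ∷ ⌜ u ⌝ ∷ ⌜ v ⌝ ∷ ⌜ w ⌝ ∷ [])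
    (λ a b c u v w → :σ (a :* :σ u :- (b :* :σ w :+ c :* :σ v))
      := :σ (:σ u) :* :σ a :- (:σ (:σ v) :* :σ c :+ :σ (:σ w) :* :σ b)) ≡.refl

  isotropic⇒hermitian : ∀ {P} → NonZero P → h P P ≈ 0# → Hermitian q P
  isotropic⇒hermitian P≉0 hPP≈0 = P≉0 , trans (x-y≈0⇒x≈y hPP≈0) (trans (+-comm _ _) (+-congʳ (*-comm _ _)))

  hermitian⇒isotropic : ∀ {P} → Hermitian q P → h P P ≈ 0#
  hermitian⇒isotropic (_ , eq) = x≈y⇒x-y≈0 (trans eq (sym (trans (+-comm _ _) (+-congʳ (*-comm _ _)))))

  _•_ : Triple → Triple → Carrier
  L • P = X L * X P + Y L * Y P + Z L * Z P

  infixl 7 _⊗_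
  _⊗_ : Triple → Triple → Triple
  A ⊗ B = ⟨ Y A * Z B - Z A * Y B , Z A * X B - X A * Z B , X A * Y B - Y A * X B ⟩

  -- Cross products commute with cyclic permutation of the coordinates, so case distinctions on a
  -- nonzero coordinate reduce to one case.
  rotate : Triple → Triple
  rotate A = ⟨ Y A , Z A , X A ⟩

  Independent : Triple → Triple → Set (c ⊔ ℓ)
  Independent A B = ∀ s t → s · A ⊕ t · B ≋ 𝟎 → s ≈ 0# × t ≈ 0#

  proportional-X : ∀ {A B} → ¬ X A ≈ 0# → A ⊗ B ≋ 𝟎 → ∃ λ s → B ≋ s · A
  proportional-X {A} {B} X≉0 (_ , y≈0 , z≈0) = inv X≉0 * X B ,
    quotient refl , quotient (x-y≈0⇒x≈y z≈0) , quotient (sym (x-y≈0⇒x≈y y≈0))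
    where
    quotient : ∀ {a b} → X A * b ≈ a * X B → b ≈ inv X≉0 * X B * a
    quotient {a} {b} eq = *-cancelˡ X≉0 (begin
      X A * b                        ≈⟨ eq ⟩
      a * X B                        ≈⟨ *-identityˡ _ ⟨
      1# * (a * X B)                 ≈⟨ *-congʳ (inv-right X≉0) ⟨
      X A * inv X≉0 * (a * X B)      ≈⟨ solve (⌜ X A ⌝ ∷ ⌜ inv X≉0 ⌝ ∷ ⌜ a ⌝ ∷ ⌜ X B ⌝ ∷ []) (λ x i a b → x :* i :* (a :* b) := x :* (i :* b :* a)) ≡.refl ⟩
      X A * (inv X≉0 * X B * a)      ∎)

  nonzero-coordinate : ∀ {A} → NonZero A → ¬ X A ≈ 0# ⊎ ¬ Y A ≈ 0# ⊎ ¬ Z A ≈ 0#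
  nonzero-coordinate {A} A≉0 with X A ≟ 0# | Y A ≟ 0# | Z A ≟ 0#
  ... | no  X≉0 | _       | _       = inj₁ X≉0
  ... | yes _   | no  Y≉0 | _       = inj₂ (inj₁ Y≉0)
  ... | yes _   | yes _   | no  Z≉0 = inj₂ (inj₂ Z≉0)
  ... | yes X≈0 | yes Y≈0 | yes Z≈0 = ⊥-elim (A≉0 (X≈0 , Y≈0 , Z≈0))

  ⊗≈0⇒proportional : ∀ {A B} → NonZero A → A ⊗ B ≋ 𝟎 → ∃ λ s → B ≋ s · A
  ⊗≈0⇒proportional {A} {B} A≉0 N≈0@(x≈0 , y≈0 , z≈0) =
    [ (λ X≉0 → proportional-X X≉0 N≈0) , [ case-Y , case-Z ]′ ]′ (nonzero-coordinate A≉0)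
    where
    case-Y : ¬ Y A ≈ 0# → ∃ λ s → B ≋ s · A
    case-Y Y≉0 = let s , y , z , x = proportional-X {rotate A} {rotate B} Y≉0 (y≈0 , z≈0 , x≈0) in s , x , y , z

    case-Z : ¬ Z A ≈ 0# → ∃ λ s → B ≋ s · A
    case-Z Z≉0 = let s , z , x , y = proportional-X {rotate (rotate A)} {rotate (rotate B)} Z≉0 (z≈0 , x≈0 , y≈0) in s , x , y , z

  factor-≉0 : ∀ {s A B} → NonZero B → B ≋ s · A → ¬ s ≈ 0#
  factor-≉0 B≉0 (x , y , z) s≈0 = B≉0 (trans x (trans (*-congʳ s≈0) (zeroˡ _)) , trans y (trans (*-congʳ s≈0) (zeroˡ _)) , trans z (trans (*-congʳ s≈0) (zeroˡ _)))

  ⊗≈0⇒∼ : ∀ {A B} → NonZero A → NonZero B → A ⊗ B ≋ 𝟎 → A ∼ B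
  ⊗≈0⇒∼ A≉0 B≉0 N≈0 with ⊗≈0⇒proportional A≉0 N≈0
  ... | s , B≋sA = s , factor-≉0 B≉0 B≋sA , B≋sA

  det : Triple → Triple → Triple → Carrier
  det A B C = C • (A ⊗ B)

  -- Cramer's rule on the first two coordinates determines s and t; the vanishing determinant takes
  -- care of the third.
  span-Z : ∀ {A B C} → ¬ Z (A ⊗ B) ≈ 0# → det A B C ≈ 0# → ∃ λ s → ∃ λ t → C ≋ s · A ⊕ t · B
  span-Z {A@(⟨ a , b , c ⟩)} {B@(⟨ d , e , f ⟩)} {C@(⟨ u , v , w ⟩)} N≉0 det≈0 =
    inv N≉0 * Z (C ⊗ B) , inv N≉0 * Z (A ⊗ C) ,
    coordinate (solve (⌜ a ⌝ ∷ ⌜ b ⌝ ∷ ⌜ d ⌝ ∷ ⌜ e ⌝ ∷ ⌜ u ⌝ ∷ ⌜ v ⌝ ∷ [])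
      (λ a b d e u v → (a :* e :- b :* d) :* u := (u :* e :- v :* d) :* a :+ (a :* v :- b :* u) :* d) ≡.refl) ,
    coordinate (solve (⌜ a ⌝ ∷ ⌜ b ⌝ ∷ ⌜ d ⌝ ∷ ⌜ e ⌝ ∷ ⌜ u ⌝ ∷ ⌜ v ⌝ ∷ [])
      (λ a b d e u v → (a :* e :- b :* d) :* v := (u :* e :- v :* d) :* b :+ (a :* v :- b :* u) :* e) ≡.refl) ,
    coordinate (trans (solve (⌜ a ⌝ ∷ ⌜ b ⌝ ∷ ⌜ c ⌝ ∷ ⌜ d ⌝ ∷ ⌜ e ⌝ ∷ ⌜ f ⌝ ∷ ⌜ u ⌝ ∷ ⌜ v ⌝ ∷ ⌜ w ⌝ ∷ [])
      (λ a b c d e f u v w → (a :* e :- b :* d) :* w := ((u :* e :- v :* d) :* c :+ (a :* v :- b :* u) :* f)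
        :+ (u :* (b :* f :- c :* e) :+ v :* (c :* d :- a :* f) :+ w :* (a :* e :- b :* d))) ≡.refl)
      (trans (+-congˡ det≈0) (+-identityʳ _)))
    where
    N = Z (A ⊗ B)
    coordinate : ∀ {x s y t z} → N * x ≈ s * y + t * z → x ≈ inv N≉0 * s * y + inv N≉0 * t * z
    coordinate {x} {s} {y} {t} {z} eq = *-cancelˡ N≉0 (begin
      N * x                                            ≈⟨ eq ⟩
      s * y + t * z                                    ≈⟨ *-identityˡ _ ⟨
      1# * (s * y + t * z)                             ≈⟨ *-congʳ (inv-right N≉0) ⟨
      N * inv N≉0 * (s * y + t * z)                    ≈⟨ solve (⌜ N ⌝ ∷ ⌜ inv N≉0 ⌝ ∷ ⌜ s ⌝ ∷ ⌜ y ⌝ ∷ ⌜ t ⌝ ∷ ⌜ z ⌝ ∷ [])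
                                                            (λ n i s y t z → n :* i :* (s :* y :+ t :* z) := n :* (i :* s :* y :+ i :* t :* z)) ≡.refl ⟩
      N * (inv N≉0 * s * y + inv N≉0 * t * z)          ∎)

  span : ∀ {A B C} → NonZero (A ⊗ B) → det A B C ≈ 0# → ∃ λ s → ∃ λ t → C ≋ s · A ⊕ t · B
  span {A} {B} {C} N≉0 det≈0 =
    [ case-X , [ case-Y , (λ Z≉0 → span-Z Z≉0 det≈0) ]′ ]′ (nonzero-coordinate N≉0)
    where
    case-X : ¬ X (A ⊗ B) ≈ 0# → ∃ λ s → ∃ λ t → C ≋ s · A ⊕ t · B
    case-X X≉0 = let s , t , y , z , x = span-Z {rotate A} {rotate B} {rotate C} X≉0
                                           (trans (trans (+-comm _ _) (sym (+-assoc _ _ _))) det≈0)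
                 in s , t , x , y , z

    case-Y : ¬ Y (A ⊗ B) ≈ 0# → ∃ λ s → ∃ λ t → C ≋ s · A ⊕ t · B
    case-Y Y≉0 = let s , t , z , x , y = span-Z {rotate (rotate A)} {rotate (rotate B)} {rotate (rotate C)} Y≉0
                                           (trans (trans (+-assoc _ _ _) (+-comm _ _)) det≈0)
                 in s , t , x , y , z

  -- Each coordinate of L times the determinant is a combination of the three incidence equations,
  -- with minors as coefficients, and one coordinate of L is invertible.
  collinear⇒det≈0 : ∀ {L A B C} → NonZero L → A on L → B on L → C on L → det A B C ≈ 0#
  collinear⇒det≈0 {L@(⟨ l , m , n ⟩)} {A@(⟨ a , b , c ⟩)} {B@(⟨ d , e , f ⟩)} {C@(⟨ u , v , w ⟩)} L≉0 A∈L B∈L C∈L =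
    case nonzero-coordinate L≉0 of λ where
      (inj₁ l≉0)        → *-cancel l≉0 (trans (solve vars (λ l m n a b c d e f u v w → l :* (u :* (b :* f :- c :* e) :+ v :* (c :* d :- a :* f) :+ w :* (a :* e :- b :* d))
          := ((l :* u :+ m :* v :+ n :* w) :* (b :* f :- c :* e) :+ (l :* a :+ m :* b :+ n :* c) :* (e :* w :- f :* v)) :+ (l :* d :+ m :* e :+ n :* f) :* (v :* c :- w :* b)) ≡.refl) vanish)
      (inj₂ (inj₁ m≉0)) → *-cancel m≉0 (trans (solve vars (λ l m n a b c d e f u v w → m :* (u :* (b :* f :- c :* e) :+ v :* (c :* d :- a :* f) :+ w :* (a :* e :- b :* d))
          := ((l :* u :+ m :* v :+ n :* w) :* (c :* d :- a :* f) :+ (l :* a :+ m :* b :+ n :* c) :* (f :* u :- d :* w)) :+ (l :* d :+ m :* e :+ n :* f) :* (w :* a :- u :* c)) ≡.refl) vanish)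
      (inj₂ (inj₂ n≉0)) → *-cancel n≉0 (trans (solve vars (λ l m n a b c d e f u v w → n :* (u :* (b :* f :- c :* e) :+ v :* (c :* d :- a :* f) :+ w :* (a :* e :- b :* d))
          := ((l :* u :+ m :* v :+ n :* w) :* (a :* e :- b :* d) :+ (l :* a :+ m :* b :+ n :* c) :* (d :* v :- e :* u)) :+ (l :* d :+ m :* e :+ n :* f) :* (u :* b :- v :* a)) ≡.refl) vanish)
    where
    vars = ⌜ l ⌝ ∷ ⌜ m ⌝ ∷ ⌜ n ⌝ ∷ ⌜ a ⌝ ∷ ⌜ b ⌝ ∷ ⌜ c ⌝ ∷ ⌜ d ⌝ ∷ ⌜ e ⌝ ∷ ⌜ f ⌝ ∷ ⌜ u ⌝ ∷ ⌜ v ⌝ ∷ ⌜ w ⌝ ∷ []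
    vanish : ∀ {p q r} → (L • C) * p + (L • A) * q + (L • B) * r ≈ 0#
    vanish = trans (+-cong (trans (+-cong (trans (*-congʳ C∈L) (zeroˡ _)) (trans (*-congʳ A∈L) (zeroˡ _))) (+-identityˡ _))
      (trans (*-congʳ B∈L) (zeroˡ _))) (+-identityˡ _)

  -- A 2-dimensional subspace on which h vanishes would contain two independent vectors A, B, and
  -- A ⊗ B would be orthogonal to both, hence isotropic in every coordinate.
  not-totally-isotropic : ∀ A B → h A A ≈ 0# → h A B ≈ 0# → h B A ≈ 0# → h B B ≈ 0# → A ⊗ B ≋ 𝟎
  not-totally-isotropic A@(⟨ a , b , c ⟩) B@(⟨ d , e , f ⟩) AA AB BA BB =
    norm (trans (solve vars (λ a b c d e f → (b :* f :- c :* e) :* :σ (b :* f :- c :* e) :=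
        combine (:- (:σ a :* d) , :σ e :* f :+ :σ f :* e , :σ a :* a , :- (:σ e :* c :+ :σ f :* b)) a b c d e f) ≡.refl) vanish) ,
    norm (trans (solve vars (λ a b c d e f → (c :* d :- a :* f) :* :σ (c :* d :- a :* f) :=
        combine (:- (:σ c :* f) , :σ f :* f , :σ c :* c , :- (:σ f :* c)) a b c d e f) ≡.refl) vanish) ,
    norm (trans (solve vars (λ a b c d e f → (a :* e :- b :* d) :* :σ (a :* e :- b :* d) :=
        combine (:- (:σ b :* e) , :σ e :* e , :σ b :* b , :- (:σ e :* b)) a b c d e f) ≡.refl) vanish)
    where
    vars = ⌜ a ⌝ ∷ ⌜ b ⌝ ∷ ⌜ c ⌝ ∷ ⌜ d ⌝ ∷ ⌜ e ⌝ ∷ ⌜ f ⌝ ∷ []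

    combine : Expr × Expr × Expr × Expr → (a b c d e f : Expr) → Expr
    combine (p , q , r , s) a b c d e f = p :* form a b c d e f :+ q :* form a b c a b c :+ r :* form d e f d e f :+ s :* form d e f a b c
      where
      form : (a b c u v w : Expr) → Expr
      form a b c u v w = a :* :σ u :- (b :* :σ w :+ c :* :σ v)

    vanish : ∀ {p q r s} → p * h A B + q * h A A + r * h B B + s * h B A ≈ 0#
    vanish = trans (+-cong (+-cong (+-cong (kill AB) (kill AA)) (kill BB)) (kill BA)) (solve [] (:0 :+ :0 :+ :0 :+ :0 := :0) ≡.refl)
      where
      kill : ∀ {x y} → x ≈ 0# → y * x ≈ 0#
      kill x≈0 = trans (*-congˡ x≈0) (zeroʳ _)

    norm : ∀ {x} → x * σ x ≈ 0# → x ≈ 0#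
    norm {x} eq = [ id , σ≈0⇒≈0 ]′ (zero-product eq)

  -- Two of the points serve as a basis. The remaining q have pairwise different ratios r of
  -- coordinates, all roots of x^(q-1) + u/w, which is one root too many.
  no-more : ∀ L → NonZero L → ¬ CollinearIn (Hermitian q) (suc (suc q)) L
  no-more L L≉0 (P , on-curve , P-inj) = contradiction
    where
    P≉0 : ∀ i → NonZero (P i)
    P≉0 i = proj₁ (on-curve i)

    isotropic : ∀ i → h (P i) (P i) ≈ 0#
    isotropic i = hermitian⇒isotropic (proj₁ (proj₂ (on-curve i)))

    A B : Triple
    A = P zero
    B = P (suc zero)
    u w : Carrier
    u = h A B
    w = h B A

    A⊗B≉0 : NonZero (A ⊗ B)
    A⊗B≉0 N≈0 = Fin.0≢1+n (P-inj zero (suc zero) (⊗≈0⇒∼ (P≉0 zero) (P≉0 (suc zero)) N≈0))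

    other : Fin q → Fin (suc (suc q))
    other i = suc (suc i)

    coordinates : ∀ i → ∃ λ s → ∃ λ t → P (other i) ≋ s · A ⊕ t · B
    coordinates i = span A⊗B≉0 (collinear⇒det≈0 L≉0 (on-L zero) (on-L (suc zero)) (on-L (other i)))
      where
      on-L : ∀ j → P j on L
      on-L j = proj₂ (proj₂ (on-curve j))

    s t : Fin q → Carrier
    s i = proj₁ (coordinates i)
    t i = proj₁ (proj₂ (coordinates i))

    decomposition : ∀ i → P (other i) ≋ s i · A ⊕ t i · B
    decomposition i = proj₂ (proj₂ (coordinates i))

    s≉0 : ∀ i → ¬ s i ≈ 0#
    s≉0 i s≈0 = Fin.0≢1+n (Fin.suc-injective (P-inj (suc zero) (other i) (t i , factor-≉0 (P≉0 (other i)) P≋tB , P≋tB)))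
      where
      P≋tB : P (other i) ≋ t i · B
      P≋tB = ≋-trans (decomposition i) (drop , drop , drop)
        where
        drop : ∀ {x y} → s i * x + y ≈ y
        drop = trans (+-congʳ (trans (*-congʳ s≈0) (zeroˡ _))) (+-identityˡ _)

    t≉0 : ∀ i → ¬ t i ≈ 0#
    t≉0 i t≈0 = Fin.0≢1+n (P-inj zero (other i) (s i , factor-≉0 (P≉0 (other i)) P≋sA , P≋sA))
      where
      P≋sA : P (other i) ≋ s i · A
      P≋sA = ≋-trans (decomposition i) (drop , drop , drop)
        where
        drop : ∀ {x y} → x + t i * y ≈ x
        drop = trans (+-congˡ (trans (*-congʳ t≈0) (zeroˡ _))) (+-identityʳ _)

    ratio : Fin q → Carrier
    ratio i = s i * inv (t≉0 i)

    ratio-≉0 : ∀ i → ¬ ratio i ≈ 0#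
    ratio-≉0 i = *-≉0 (s≉0 i) (inv-≉0 (t≉0 i))

    ratio-spec : ∀ i → s i ≈ ratio i * t i
    ratio-spec i = sym (trans (*-assoc _ _ _) (trans (*-congˡ (inv-left (t≉0 i))) (*-identityʳ _)))

    equation : ∀ i → ratio i * u + σ (ratio i) * w ≈ 0#
    equation i = *-cancel (*-≉0 (t≉0 i) (σ-≉0 (t≉0 i))) (begin
      t i * σ (t i) * (r * u + σ r * w)
        ≈⟨ solve (⌜ t i ⌝ ∷ ⌜ r ⌝ ∷ ⌜ u ⌝ ∷ ⌜ w ⌝ ∷ []) (λ t r u w → t :* :σ t :* (r :* u :+ :σ r :* w)
             := (r :* t) :* :σ t :* u :+ t :* :σ (r :* t) :* w) ≡.refl ⟩
      r * t i * σ (t i) * u + t i * σ (r * t i) * w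
        ≈⟨ +-cong (*-congʳ (*-congʳ (ratio-spec i))) (*-congʳ (*-congˡ (σ-cong (ratio-spec i)))) ⟨
      s i * σ (t i) * u + t i * σ (s i) * w
        ≈⟨ +-cong (trans (+-congʳ (trans (*-congˡ (isotropic zero)) (zeroʳ _))) (+-identityˡ _))
                  (trans (+-congˡ (trans (*-congˡ (isotropic (suc zero))) (zeroʳ _))) (+-identityʳ _)) ⟨
      (s i * σ (s i) * h A A + s i * σ (t i) * u) + (t i * σ (s i) * w + t i * σ (t i) * h B B)
        ≈⟨ h-combination (s i) A (t i) B (s i) A (t i) B ⟨
      h (s i · A ⊕ t i · B) (s i · A ⊕ t i · B)
        ≈⟨ h-cong (decomposition i) (decomposition i) ⟨
      h (P (other i)) (P (other i))
        ≈⟨ isotropic (other i) ⟩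
      0# ∎)
      where r = ratio i

    q-1 : ℕ
    q-1 = ℕ.pred q

    equation′ : ∀ i → u + ratio i ^ q-1 * w ≈ 0#
    equation′ i = *-cancel (ratio-≉0 i) (begin
      r * (u + r ^ q-1 * w)        ≈⟨ solve (⌜ r ⌝ ∷ ⌜ u ⌝ ∷ ⌜ r ^ q-1 ⌝ ∷ ⌜ w ⌝ ∷ []) (λ r u s w → r :* (u :+ s :* w) := r :* u :+ (r :* s) :* w) ≡.refl ⟩
      r * u + r ^ suc q-1 * w      ≡⟨ ≡.cong (λ n → r * u + r ^ n * w) (ℕ.suc-pred q) ⟩
      r * u + σ r * w              ≈⟨ equation i ⟩
      0#                           ∎)
      where r = ratio i

    -- A third point on the line is needed to pass from w = 0 to u = 0; then h would vanish on the
    -- whole line.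
    some : Fin q
    some = Fin.fromℕ< {0} (ℕ.<-trans (s≤s z≤n) q>1)

    w≉0 : ¬ w ≈ 0#
    w≉0 w≈0 = A⊗B≉0 (not-totally-isotropic A B (isotropic zero) u≈0 w≈0 (isotropic (suc zero)))
      where
      u≈0 : u ≈ 0#
      u≈0 = trans (sym (trans (+-congˡ (trans (*-congˡ w≈0) (zeroʳ _))) (+-identityʳ u))) (equation′ some)

    ratio-injective : ∀ i j → ratio i ≈ ratio j → i ≡ j
    ratio-injective i j eq = Fin.suc-injective (Fin.suc-injective (P-inj (other i) (other j) (k , k≉0 , P≋kP)))
      where
      k = t j * inv (t≉0 i)
      k≉0 : ¬ k ≈ 0#
      k≉0 = *-≉0 (t≉0 j) (inv-≉0 (t≉0 i))

      coordinate : ∀ {x y} → s j * x + t j * y ≈ k * (s i * x + t i * y)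
      coordinate {x} {y} = begin
        s j * x + t j * y                          ≈⟨ +-cong (*-congʳ (trans (ratio-spec j) (*-congʳ (sym eq)))) refl ⟩
        ratio i * t j * x + t j * y                ≈⟨ *-identityˡ _ ⟨
        1# * (ratio i * t j * x + t j * y)         ≈⟨ *-congʳ (inv-right (t≉0 i)) ⟨
        t i * inv (t≉0 i) * (ratio i * t j * x + t j * y)   ≈⟨ solve (⌜ t i ⌝ ∷ ⌜ inv (t≉0 i) ⌝ ∷ ⌜ ratio i ⌝ ∷ ⌜ t j ⌝ ∷ ⌜ x ⌝ ∷ ⌜ y ⌝ ∷ [])
          (λ t i r t′ x y → t :* i :* (r :* t′ :* x :+ t′ :* y) := t′ :* i :* (r :* t :* x :+ t :* y)) ≡.refl ⟩
        k * (ratio i * t i * x + t i * y)          ≈⟨ *-congˡ (+-congʳ (*-congʳ (ratio-spec i))) ⟨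
        k * (s i * x + t i * y)                    ∎

      P≋kP : P (other j) ≋ k · P (other i)
      P≋kP = ≋-trans (decomposition j) (≋-trans (coordinate , coordinate , coordinate) (·-cong refl (≋-sym (decomposition i))))

    contradiction : ⊥
    contradiction = root-bound polynomial (λ i → ratio (cast i)) (λ i j eq → cast-injective i j (ratio-injective _ _ eq)) root
      where
      v = inv w≉0 * u

      polynomial : Monic q-1 (λ x → x ^ q-1 + v)
      polynomial = monic-+ (monic-^ q-1) (below-≤ (ℕ.≤-pred (≡.subst (1 ℕ.<_) (≡.sym (ℕ.suc-pred q)) q>1)) (below-const v))

      cast : Fin (suc q-1) → Fin q
      cast = Fin.cast (ℕ.suc-pred q)

      cast-injective : ∀ i j → cast i ≡ cast j → i ≡ j
      cast-injective i j eq = Fin.toℕ-injective (≡.trans (≡.sym (Fin.toℕ-cast _ i)) (≡.trans (≡.cong Fin.toℕ eq) (Fin.toℕ-cast _ j)))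

      root : ∀ i → ratio (cast i) ^ q-1 + v ≈ 0#
      root i = *-cancel w≉0 (begin
        w * (r + inv w≉0 * u)    ≈⟨ solve (⌜ w ⌝ ∷ ⌜ r ⌝ ∷ ⌜ inv w≉0 ⌝ ∷ ⌜ u ⌝ ∷ []) (λ w r i u → w :* (r :+ i :* u) := w :* i :* u :+ r :* w) ≡.refl ⟩
        w * inv w≉0 * u + r * w  ≈⟨ +-congʳ (trans (*-congʳ (inv-right w≉0)) (*-identityˡ u)) ⟩
        u + r * w                ≈⟨ equation′ (cast i) ⟩
        0#                       ∎)
        where r = ratio (cast i) ^ q-1

  -- Lines with q + 1 points of the curve: h is alternating on the F_q-span of A and B.

  record SplitLine (A B : Triple) : Set (c ⊔ ℓ) where
    field
      independent : Independent A B
      isotropicˡ  : h A A ≈ 0#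
      isotropicʳ  : h B B ≈ 0#
      alternating : h A B + h B A ≈ 0#

    line : Triple
    line = A ⊗ B

    relation : ∀ {s t} → s * X A + t * X B ≈ 0# → s * Y A + t * Y B ≈ 0# → s * Z A + t * Z B ≈ 0# → s ≈ 0# × t ≈ 0#
    relation x y z = independent _ _ (x , y , z)

    -- If all minors vanish, then X_B A - X_A B = 0 and likewise for the other coordinates.
    -- Independence then makes every coordinate of A zero, which contradicts independence again.
    line-NonZero : NonZero line
    line-NonZero (x≈0 , y≈0 , z≈0) = 1≉0 (proj₁ (relation {1#} {0#} (kill X≈0) (kill Y≈0) (kill Z≈0)))
      where
      kill : ∀ {a b} → a ≈ 0# → 1# * a + 0# * b ≈ 0#
      kill a≈0 = trans (+-cong (trans (*-identityˡ _) a≈0) (zeroˡ _)) (+-identityˡ 0#)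

      same : ∀ {a b} → b * a + - a * b ≈ 0#
      same {a} {b} = solve (⌜ a ⌝ ∷ ⌜ b ⌝ ∷ []) (λ a b → b :* a :+ (:- a) :* b := :0) ≡.refl

      minor : ∀ {a b c d} → a * d - c * b ≈ 0# → b * c + - a * d ≈ 0#
      minor {a} {b} {c} {d} eq = trans (solve (⌜ a ⌝ ∷ ⌜ b ⌝ ∷ ⌜ c ⌝ ∷ ⌜ d ⌝ ∷ []) (λ a b c d → b :* c :+ (:- a) :* d := :- (a :* d :- c :* b)) ≡.refl)
        (trans (-‿cong eq) (solve [] (:- :0 := :0) ≡.refl))

      flip : ∀ {a b c d} → c * b - a * d ≈ 0# → b * c + - a * d ≈ 0#
      flip eq = trans (+-cong (*-comm _ _) (sym (-‿distribˡ-* _ _))) eq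

      neg≈0 : ∀ {a} → - a ≈ 0# → a ≈ 0#
      neg≈0 -a≈0 = trans (sym (-‿involutive _)) (trans (-‿cong -a≈0) (solve [] (:- :0 := :0) ≡.refl))

      X≈0 : X A ≈ 0#
      X≈0 = neg≈0 (proj₂ (relation {X B} {t = - X A} same (minor z≈0) (flip y≈0)))
      Y≈0 : Y A ≈ 0#
      Y≈0 = neg≈0 (proj₂ (relation {Y B} {t = - Y A} (flip z≈0) same (minor x≈0)))
      Z≈0 : Z A ≈ 0#
      Z≈0 = neg≈0 (proj₂ (relation {Z B} {t = - Z A} (minor y≈0) (flip x≈0) same))

    combination-on-line : ∀ s t → (s · A ⊕ t · B) on line
    combination-on-line s t = solve (⌜ s ⌝ ∷ ⌜ t ⌝ ∷ ⌜ X A ⌝ ∷ ⌜ Y A ⌝ ∷ ⌜ Z A ⌝ ∷ ⌜ X B ⌝ ∷ ⌜ Y B ⌝ ∷ ⌜ Z B ⌝ ∷ [])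
      (λ s t a b c d e f → (b :* f :- c :* e) :* (s :* a :+ t :* d) :+ (c :* d :- a :* f) :* (s :* b :+ t :* e)
        :+ (a :* e :- b :* d) :* (s :* c :+ t :* f) := :0) ≡.refl

    isotropic : ∀ {s t} → Fixed s → Fixed t → h (s · A ⊕ t · B) (s · A ⊕ t · B) ≈ 0#
    isotropic {s} {t} s-fixed t-fixed = begin
      h (s · A ⊕ t · B) (s · A ⊕ t · B)
        ≈⟨ h-combination s A t B s A t B ⟩
      (s * σ s * h A A + s * σ t * h A B) + (t * σ s * h B A + t * σ t * h B B)
        ≈⟨ solve (⌜ s ∣ s-fixed ⌝ ∷ ⌜ t ∣ t-fixed ⌝ ∷ ⌜ h A A ⌝ ∷ ⌜ h A B ⌝ ∷ ⌜ h B A ⌝ ∷ ⌜ h B B ⌝ ∷ [])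
             (λ s t a u w b → (s :* :σ s :* a :+ s :* :σ t :* u) :+ (t :* :σ s :* w :+ t :* :σ t :* b)
               := s :* s :* a :+ t :* t :* b :+ s :* t :* (u :+ w)) ≡.refl ⟩
      s * s * h A A + t * t * h B B + s * t * (h A B + h B A)
        ≈⟨ +-cong (+-cong (trans (*-congˡ isotropicˡ) (zeroʳ _)) (trans (*-congˡ isotropicʳ) (zeroʳ _))) (trans (*-congˡ alternating) (zeroʳ _)) ⟩
      0# + 0# + 0#
        ≈⟨ trans (+-congʳ (+-identityˡ 0#)) (+-identityˡ 0#) ⟩
      0# ∎

    coefficients-unique : ∀ {k s t u v} → u · A ⊕ v · B ≋ k · (s · A ⊕ t · B) → u ≈ k * s × v ≈ k * t
    coefficients-unique {k} {s} {t} {u} {v} (x , y , z) =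
      let u-ks≈0 , v-kt≈0 = relation (difference x) (difference y) (difference z)
      in x-y≈0⇒x≈y u-ks≈0 , x-y≈0⇒x≈y v-kt≈0
      where
      difference : ∀ {a b} → u * a + v * b ≈ k * (s * a + t * b) → (u - k * s) * a + (v - k * t) * b ≈ 0#
      difference {a} {b} eq = trans
        (solve (⌜ k ⌝ ∷ ⌜ s ⌝ ∷ ⌜ t ⌝ ∷ ⌜ u ⌝ ∷ ⌜ v ⌝ ∷ ⌜ a ⌝ ∷ ⌜ b ⌝ ∷ []) (λ k s t u v a b →
          (u :- k :* s) :* a :+ (v :- k :* t) :* b := (u :* a :+ v :* b) :- k :* (s :* a :+ t :* b)) ≡.refl)
        (x≈y⇒x-y≈0 eq)

    combination-NonZero : ∀ {s t} → ¬ (s ≈ 0# × t ≈ 0#) → NonZero (s · A ⊕ t · B)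
    combination-NonZero st≉0 (x , y , z) = st≉0 (relation x y z)

    -- Representatives (r : 1) and (1 : 0) of the q + 1 points of the projective line over F_q.
    coefficients : Fin q ⊎ Fin 1 → Carrier × Carrier
    coefficients (inj₁ j) = fixed j , 1#
    coefficients (inj₂ _) = 1# , 0#

    point′ : Fin q ⊎ Fin 1 → Triple
    point′ i = let s , t = coefficients i in s · A ⊕ t · B

    point′-hermitian : ∀ i → Hermitian q (point′ i)
    point′-hermitian (inj₁ j) = isotropic⇒hermitian (combination-NonZero (1≉0 ∘ proj₂)) (isotropic (fixed-member j) σ-1)
    point′-hermitian (inj₂ _) = isotropic⇒hermitian (combination-NonZero (1≉0 ∘ proj₁)) (isotropic σ-1 σ-0)

    point′-injective : ∀ i j → point′ i ∼ point′ j → i ≡ j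
    point′-injective i j (k , k≉0 , eq) = go i j (coefficients-unique {k} eq)
      where
      go : ∀ i j → proj₁ (coefficients j) ≈ k * proj₁ (coefficients i) × proj₂ (coefficients j) ≈ k * proj₂ (coefficients i) → i ≡ j
      go (inj₁ i)    (inj₁ j)    (fj≈kfi , 1≈k1) = ≡.cong inj₁ (fixed-injective i j
        (sym (trans fj≈kfi (trans (*-congʳ (trans (sym (*-identityʳ k)) (sym 1≈k1))) (*-identityˡ _)))))
      go (inj₁ i)    (inj₂ _)    (_ , 0≈k1)      = ⊥-elim (k≉0 (trans (sym (*-identityʳ k)) (sym 0≈k1)))
      go (inj₂ _)    (inj₁ j)    (_ , 1≈k0)      = ⊥-elim (1≉0 (trans 1≈k0 (zeroʳ k)))
      go (inj₂ zero) (inj₂ zero) _               = ≡.refl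

    point : Fin (q ℕ.+ 1) → Triple
    point i = point′ (Fin.splitAt q i)

    point-injective : ∀ i j → point i ∼ point j → i ≡ j
    point-injective i j eq = ≡.trans (≡.sym (Fin.join-splitAt q 1 i))
      (≡.trans (≡.cong (Fin.join q 1) (point′-injective (Fin.splitAt q i) (Fin.splitAt q j) eq)) (Fin.join-splitAt q 1 j))

    collinear-points : CollinearIn (Hermitian q) (q ℕ.+ 1) line
    collinear-points = point , (λ i → proj₁ (point′-hermitian (Fin.splitAt q i)) , point′-hermitian (Fin.splitAt q i) ,
      combination-on-line _ _) , point-injective

    -- Isotropy is unaffected by nonzero scalars, so P cannot coincide with any of the q + 1 points
    -- of the curve on the line.
    with-point : ∀ {P s t} → NonZero P → ¬ Hermitian q P → P ≋ s · A ⊕ t · B →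
                 CollinearIn (λ Q → Hermitian q Q ⊎ Q ∼ P) (suc (q ℕ.+ 1)) line
    with-point {P} {s} {t} P≉0 P∉H P≋ = P′ , good , inj
      where
      P′ : Fin (suc (q ℕ.+ 1)) → Triple
      P′ zero    = P
      P′ (suc i) = point i

      P∈line : P on line
      P∈line = let x , y , z = P≋ in
        trans (+-cong (+-cong (*-congˡ x) (*-congˡ y)) (*-congˡ z)) (combination-on-line s t)

      good : ∀ i → NonZero (P′ i) × (Hermitian q (P′ i) ⊎ P′ i ∼ P) × P′ i on line
      good zero    = P≉0 , inj₂ (1# , 1≉0 , sym (*-identityˡ _) , sym (*-identityˡ _) , sym (*-identityˡ _)) , P∈line
      good (suc i) = let nz , herm , on = proj₁ (proj₂ collinear-points) i in nz , inj₁ herm , on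

      scaled : ∀ {k A B} → h A A ≈ 0# → B ≋ k · A → h B B ≈ 0#
      scaled {k} {A} hAA≈0 B≋kA = trans (h-cong B≋kA B≋kA) (trans (h-·· k k A A) (trans (*-congˡ hAA≈0) (zeroʳ _)))

      inj : ∀ i j → P′ i ∼ P′ j → i ≡ j
      inj zero    zero    _ = ≡.refl
      inj (suc i) (suc j) eq = ≡.cong suc (point-injective i j eq)
      inj (suc i) zero    (k , _ , eq) = ⊥-elim (P∉H (isotropic⇒hermitian P≉0
        (scaled (hermitian⇒isotropic (point′-hermitian (Fin.splitAt q i))) eq)))
      inj zero    (suc j) (k , k≉0 , eq) = ⊥-elim (P∉H (isotropic⇒hermitian P≉0
        (*-cancel (*-≉0 k≉0 (σ-≉0 k≉0)) (begin
          k * σ k * h P P           ≈⟨ h-·· k k P P ⟨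
          h (k · P) (k · P)         ≈⟨ h-cong eq eq ⟨
          h (point j) (point j)     ≈⟨ hermitian⇒isotropic (point′-hermitian (Fin.splitAt q j)) ⟩
          0#                        ∎))))

-- Two ways to find a split line through a point, and quadratic forms on F_{q³}

module Splitting {c ℓ} (F : Field c ℓ) {q : ℕ} (q-primePower : IsPrimePower q)
                 (card : FieldTheory.HasCard F (q ℕ.^ 6)) where
  open Plane F q-primePower card public
  open Chevalley F q-primePower card public
  open SetoidReasoning setoid

  +≈0 : ∀ {x y} → x ≈ 0# → y ≈ 0# → x + y ≈ 0#
  +≈0 x≈0 y≈0 = trans (+-cong x≈0 y≈0) (+-identityˡ 0#)

  *≈0ʳ : ∀ {x y} → y ≈ 0# → x * y ≈ 0#
  *≈0ʳ y≈0 = trans (*-congˡ y≈0) (zeroʳ _)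

  *≈0ˡ : ∀ {x y} → x ≈ 0# → x * y ≈ 0#
  *≈0ˡ x≈0 = trans (*-congʳ x≈0) (zeroˡ _)

  +-dropʳ : ∀ {x y} → y ≈ 0# → x + y ≈ x
  +-dropʳ y≈0 = trans (+-congˡ y≈0) (+-identityʳ _)

  +-dropˡ : ∀ {x y} → x ≈ 0# → x + y ≈ y
  +-dropˡ x≈0 = trans (+-congʳ x≈0) (+-identityˡ _)

  neg-≉0 : ∀ {x} → ¬ x ≈ 0# → ¬ - x ≈ 0#
  neg-≉0 x≉0 -x≈0 = x≉0 (trans (sym (-‿involutive _)) (trans (-‿cong -x≈0) (solve [] (:- :0 := :0) ≡.refl)))

  -- An alternating sum of the six conjugates changes sign under σ. The construction is uniform in
  -- the characteristic: in characteristic 2 it yields an element of F_q.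
  ε∃ : ∃ λ ε → σ ε ≈ - ε × ¬ ε ≈ 0#
  ε∃ = let z , ≉0 = linear-nonzero 1# (- 1#) 1# (- 1#) 1# (neg-≉0 1≉0) in
    _ , solve (⌜ z ⌝ ∷ []) (λ z → let z₁ = :σ z; z₂ = :σ z₁; z₃ = :σ z₂; z₄ = :σ z₃; z₅ = :σ z₄; e = :1 :* z :+ :- :1 :* z₁ :+ :1 :* z₂ :+ :- :1 :* z₃ :+ :1 :* z₄ :+ :- :1 :* z₅ in :σ e := :- e) ≡.refl , ≉0

  ε : Carrier
  ε = proj₁ ε∃

  σ-ε : σ ε ≈ - ε
  σ-ε = proj₁ (proj₂ ε∃)

  ε≉0 : ¬ ε ≈ 0#
  ε≉0 = proj₂ (proj₂ ε∃)

  Tr-* : ∀ {s} → Fixed s → ∀ z → Tr (z * s) ≈ Tr z * s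
  Tr-* {s} s-fixed z = solve (⌜ z ⌝ ∷ ⌜ s ∣ s-fixed ⌝ ∷ []) (λ z s →
    let tr = λ z → z :+ :σ z :+ :σ (:σ z) :+ :σ (:σ (:σ z)) :+ :σ (:σ (:σ (:σ z))) :+ :σ (:σ (:σ (:σ (:σ z)))) in
    tr (z :* s) := tr z :* s) ≡.refl

  trace-one : ∃ λ θ → Tr θ ≈ 1#
  trace-one = let z , ≉0 = linear-nonzero 1# 1# 1# 1# 1# 1≉0
                  Trz≉0 : ¬ Tr z ≈ 0#
                  Trz≉0 Trz≈0 = ≉0 (trans (solve (⌜ z ⌝ ∷ []) (λ z → let z₁ = :σ z; z₂ = :σ z₁; z₃ = :σ z₂; z₄ = :σ z₃; z₅ = :σ z₄ in
                    :1 :* z :+ :1 :* z₁ :+ :1 :* z₂ :+ :1 :* z₃ :+ :1 :* z₄ :+ :1 :* z₅ := z :+ z₁ :+ z₂ :+ z₃ :+ z₄ :+ z₅) ≡.refl) Trz≈0)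
              in z * inv Trz≉0 , trans (Tr-* (fixed-inv Trz≉0 (Tr-fixed z)) z) (inv-right Trz≉0)

  -- The witness, inferred from the solver identity, is the classical one: with Tr(θ) = 1, the sum
  -- over j of σ^j(θ) (z + ... + σ^(j-1)(z)).
  additive-Hilbert90 : ∀ {z} → Tr z ≈ 0# → ∃ λ y → y - σ y ≈ z
  additive-Hilbert90 {z} Trz≈0 = let θ , Trθ≈1 = trace-one in
    _ , (begin
      _
        ≈⟨ solve (⌜ θ ⌝ ∷ ⌜ z ⌝ ∷ []) (λ θ z →
             let z₁ = :σ z; z₂ = :σ z₁; z₃ = :σ z₂; z₄ = :σ z₃; z₅ = :σ z₄; θ₁ = :σ θ; θ₂ = :σ θ₁; θ₃ = :σ θ₂; θ₄ = :σ θ₃; θ₅ = :σ θ₄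
                 y = θ₁ :* z :+ θ₂ :* (z :+ z₁) :+ θ₃ :* (z :+ z₁ :+ z₂) :+ θ₄ :* (z :+ z₁ :+ z₂ :+ z₃)
                       :+ θ₅ :* (z :+ z₁ :+ z₂ :+ z₃ :+ z₄)
             in y :- :σ y := z :* (θ :+ θ₁ :+ θ₂ :+ θ₃ :+ θ₄ :+ θ₅) :- θ :* (z :+ z₁ :+ z₂ :+ z₃ :+ z₄ :+ z₅)) ≡.refl ⟩
      z * Tr θ - θ * Tr z
        ≈⟨ +-cong (trans (*-congˡ Trθ≈1) (*-identityʳ z)) (trans (-‿cong (*≈0ʳ Trz≈0)) (solve [] (:- :0 := :0) ≡.refl)) ⟩
      z + 0#   ≈⟨ +-identityʳ z ⟩
      z        ∎)

  Splits : Triple → Set (c ⊔ ℓ)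
  Splits P = ∃ λ A → ∃ λ B → SplitLine A B × ∃ λ s → ∃ λ t → P ≋ s · A ⊕ t · B

  -- Used to prove independence: with C chosen so that one of the two values of h is zero and the
  -- other is not, a coefficient is seen to vanish.
  functional : ∀ {s t A B} → s · A ⊕ t · B ≋ 𝟎 → ∀ C → s * h A C + t * h B C ≈ 0#
  functional {s} {t} {A} {B} eq C = begin
    s * h A C + t * h B C              ≈⟨ +-cong (h-·ˡ s A C) (h-·ˡ t B C) ⟨
    h (s · A) C + h (t · B) C          ≈⟨ h-⊕ˡ (s · A) (t · B) C ⟨
    h (s · A ⊕ t · B) C                ≈⟨ h-cong eq (refl , refl , refl) ⟩
    h 𝟎 C                              ≈⟨ solve (⌜ X C ⌝ ∷ ⌜ Y C ⌝ ∷ ⌜ Z C ⌝ ∷ []) (λ x y z →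
                                            :0 :* :σ x :- (:0 :* :σ z :+ :0 :* :σ y) := :0) ≡.refl ⟩
    0#                                 ∎

  -- The vectors with coordinates in F_{q²}. Restricted to them, h is a genuine Hermitian form by
  -- `σ-h`.
  Rational : Triple → Set ℓ
  Rational R = φ R ≋ R

  -- The points R + s P of the curve, for R rational on the curve, are given by an additive
  -- equation in s.
  rational-split : ∀ {P R g} → Rational R → h R R ≈ 0# → ¬ h P R ≈ 0# →
                   g * (ε * (h P R * σ (h P R))) ≈ h P P → Tr g ≈ 0# → Splits P
  rational-split {P} {R} {g} R-rational hRR≈0 w≉0 g-eq Trg≈0 = A , B , split , s′ , 1# , P≋
    where
    w = h P R

    hRP : h R P ≈ σ w
    hRP = sym (trans (σ-h P R) (h-cong R-rational (refl , refl , refl)))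

    s′ = proj₁ (additive-Hilbert90 Trg≈0)
    s′-eq : s′ - σ s′ ≈ g
    s′-eq = proj₂ (additive-Hilbert90 Trg≈0)

    -- P + s R lies on the curve when h(P,P) + σ(s) w + s σ(w) = 0. Substituting s = -ε w s′ and
    -- using σ(ε) = -ε turns this into s′ - σ(s′) = g. The same factor ε w on R makes h(A,B) and
    -- h(B,A) opposite. The summand `0# · R` in A only brings it into the form required by
    -- `h-combination`.
    τ s : Carrier
    τ = ε * w
    s = - (τ * s′)

    A B : Triple
    A = τ · R ⊕ 0# · R
    B = 1# · P ⊕ s · R

    open-σε : ∀ x → σ (ε * x) ≈ - ε * σ x
    open-σε x = trans (σ-* ε x) (*-congʳ σ-ε)

    σs : σ s ≈ ε * σ w * σ s′
    σs = trans (σ-- _) (trans (-‿cong (trans (σ-* _ _) (*-congʳ (open-σε w))))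
      (solve (⌜ ε ⌝ ∷ ⌜ w ⌝ ∷ ⌜ s′ ⌝ ∷ []) (λ e w s → :- (:- e :* :σ w :* :σ s) := e :* :σ w :* :σ s) ≡.refl))

    BB : h B B ≈ 0#
    BB = begin
      h B B
        ≈⟨ h-combination 1# P s R 1# P s R ⟩
      (1# * σ 1# * h P P + 1# * σ s * w) + (s * σ 1# * h R P + s * σ s * h R R)
        ≈⟨ +-cong (+-cong (*-cong (trans (*-identityˡ _) σ-1) (sym g-eq)) (*-congʳ (trans (*-identityˡ _) σs)))
                  (+-cong (*-cong (trans (*-congˡ σ-1) (*-identityʳ s)) hRP) (*≈0ʳ hRR≈0)) ⟩
      (1# * (g * (ε * (w * σ w))) + ε * σ w * σ s′ * w) + (s * σ w + 0#)
        ≈⟨ solve (⌜ g ⌝ ∷ ⌜ ε ⌝ ∷ ⌜ w ⌝ ∷ ⌜ s′ ⌝ ∷ []) (λ g e w s →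
             (:1 :* (g :* (e :* (w :* :σ w))) :+ e :* :σ w :* :σ s :* w) :+ ((:- (e :* w :* s)) :* :σ w :+ :0)
             := e :* w :* :σ w :* (g :- (s :- :σ s))) ≡.refl ⟩
      ε * w * σ w * (g - (s′ - σ s′))
        ≈⟨ *≈0ʳ (x≈y⇒x-y≈0 (sym s′-eq)) ⟩
      0# ∎

    AB : h A B ≈ τ * σ w
    AB = begin
      h A B
        ≈⟨ h-combination τ R 0# R 1# P s R ⟩
      (τ * σ 1# * h R P + τ * σ s * h R R) + (0# * σ 1# * h R P + 0# * σ s * h R R)
        ≈⟨ +-cong (+-cong (*-cong (trans (*-congˡ σ-1) (*-identityʳ τ)) hRP) (*≈0ʳ hRR≈0)) (+≈0 (*≈0ˡ (zeroˡ _)) (*≈0ˡ (zeroˡ _))) ⟩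
      (τ * σ w + 0#) + 0#
        ≈⟨ trans (+-identityʳ _) (+-identityʳ _) ⟩
      τ * σ w ∎

    BA : h B A ≈ - ε * σ w * w
    BA = begin
      h B A
        ≈⟨ h-combination 1# P s R τ R 0# R ⟩
      (1# * σ τ * w + 1# * σ 0# * w) + (s * σ τ * h R R + s * σ 0# * h R R)
        ≈⟨ +-cong (+-cong (*-congʳ (trans (*-identityˡ _) (open-σε w))) (*≈0ˡ (*≈0ʳ σ-0))) (+≈0 (*≈0ʳ hRR≈0) (*≈0ʳ hRR≈0)) ⟩
      (- ε * σ w * w + 0#) + 0#
        ≈⟨ trans (+-identityʳ _) (+-identityʳ _) ⟩
      - ε * σ w * w ∎

    hAR : h A R ≈ 0#
    hAR = trans (h-⊕ˡ _ _ R) (+≈0 (trans (h-·ˡ τ R R) (*≈0ʳ hRR≈0)) (trans (h-·ˡ 0# R R) (*≈0ʳ hRR≈0)))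

    hBR : h B R ≈ w
    hBR = trans (h-⊕ˡ _ _ R) (trans (+-cong (trans (h-·ˡ 1# P R) (*-identityˡ _)) (trans (h-·ˡ s R R) (*≈0ʳ hRR≈0))) (+-identityʳ _))

    hAP : h A P ≈ τ * σ w
    hAP = trans (h-⊕ˡ _ _ P) (trans (+-cong (trans (h-·ˡ τ R P) (*-congˡ hRP)) (trans (h-·ˡ 0# R P) (zeroˡ _))) (+-identityʳ _))

    independent : Independent A B
    independent α β eq = α≈0 , β≈0
      where
      β≈0 : β ≈ 0#
      β≈0 = *-cancel w≉0 (trans (*-comm w β) (trans (sym (+-dropˡ (*≈0ʳ hAR))) (trans (+-congˡ (*-congˡ (sym hBR))) (functional eq R))))
      α≈0 : α ≈ 0#
      α≈0 = *-cancel (*-≉0 (*-≉0 ε≉0 w≉0) (σ-≉0 w≉0)) (trans (*-comm _ α) (trans (*-congˡ (sym hAP))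
              (trans (sym (+-dropʳ (*≈0ˡ β≈0))) (functional eq P))))

    split : SplitLine A B
    split = record
      { independent = independent
      ; isotropicˡ = trans (h-combination τ R 0# R τ R 0# R) (+≈0 (+≈0 (*≈0ʳ hRR≈0) (*≈0ʳ hRR≈0)) (+≈0 (*≈0ʳ hRR≈0) (*≈0ʳ hRR≈0)))
      ; isotropicʳ = BB
      ; alternating = trans (+-cong AB BA) (solve (⌜ ε ⌝ ∷ ⌜ w ⌝ ∷ []) (λ e w → e :* w :* :σ w :+ :- e :* :σ w :* w := :0) ≡.refl) }

    P≋ : P ≋ s′ · A ⊕ 1# · B
    P≋ = coordinate , coordinate , coordinate
      where
      coordinate : ∀ {p r} → p ≈ s′ * (τ * r + 0# * r) + 1# * (1# * p + s * r)
      coordinate {p} {r} = solve (⌜ τ ⌝ ∷ ⌜ s′ ⌝ ∷ ⌜ p ⌝ ∷ ⌜ r ⌝ ∷ []) (λ t s p r →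
        p := s :* (t :* r :+ :0 :* r) :+ :1 :* (:1 :* p :+ (:- (t :* s)) :* r)) ≡.refl

  Fixed³ : Carrier → Set ℓ
  Fixed³ x = σ^ 3 x ≈ x

  ⌜_∣³_⌝ : ∀ x → Fixed³ x → Var
  ⌜ x ∣³ p ⌝ = x of-period 3 by p

  -- The elements of F_{q³} whose trace to F_q is 0. They form a plane over F_q, and a basis of it
  -- will give the two points A and B.
  record Trace0 (v : Carrier) : Set ℓ where
    field
      fixed³ : Fixed³ v
      -- The expression is y - σ(y) for y = z + σ³(z), an element of F_{q³}.
      trace0 : v + σ v + σ^ 2 v ≈ 0#

  trace0 : ∀ z → Trace0 (z - σ z + σ^ 3 z - σ^ 4 z)
  trace0 z = record
    { fixed³ = solve (⌜ z ⌝ ∷ []) (λ z → let z₁ = :σ z; z₃ = :σ (:σ z₁); v = z :- z₁ :+ z₃ :- :σ z₃ in :σ (:σ (:σ v)) := v) ≡.refl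
    ; trace0 = solve (⌜ z ⌝ ∷ []) (λ z → let z₁ = :σ z; z₃ = :σ (:σ z₁); v = z :- z₁ :+ z₃ :- :σ z₃ in v :+ :σ v :+ :σ (:σ v) := :0) ≡.refl }

  -- The Moore determinant of v and v′, which detects independence over F_q.
  wronskian : Carrier → Carrier → Carrier
  wronskian v v′ = v * σ v′ - σ v * v′

  trace0-nonzero : ∃ λ v → Trace0 v × ¬ v ≈ 0#
  -- The expression in `trace0` has no term in σ⁵. Taking it at σ(ζ) instead of ζ produces one, with
  -- coefficient -1, as `linear-nonzero` requires.
  trace0-nonzero = _ , trace0 (σ ζ) , λ v≈0 → proj₂ generator (trans
    (solve (⌜ ζ ⌝ ∷ []) (λ ζ → let z = :σ ζ; z₁ = :σ z; z₂ = :σ z₁; z₃ = :σ z₂; z₄ = :σ z₃ in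
      :0 :* ζ :+ :1 :* z :+ :- :1 :* z₁ :+ :0 :* z₂ :+ :1 :* z₃ :+ :- :1 :* z₄ := z :- z₁ :+ z₃ :- z₄) ≡.refl) v≈0)
    where
    generator = linear-nonzero 0# 1# (- 1#) 0# 1# (neg-≉0 1≉0)
    ζ = proj₁ generator

  -- As a function of ξ, the Moore determinant of v and the element produced by `trace0 ξ` is
  -- linearized with last coefficient -v.
  trace0-partner : ∀ {v} → ¬ v ≈ 0# → ∃ λ v′ → Trace0 v′ × ¬ wronskian v v′ ≈ 0#
  trace0-partner {v} v≉0 = _ , trace0 ξ , λ D≈0 → proj₂ generator (trans
    (solve (⌜ v ⌝ ∷ ⌜ ξ ⌝ ∷ []) (λ v z → let z₁ = :σ z; z₂ = :σ z₁; z₃ = :σ z₂; z₄ = :σ z₃; z₅ = :σ z₄; w = z :- z₁ :+ z₃ :- z₄ in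
      :- :σ v :* z :+ (v :+ :σ v) :* z₁ :+ :- v :* z₂ :+ :- :σ v :* z₃ :+ (v :+ :σ v) :* z₄ :+ :- v :* z₅
      := v :* :σ w :- :σ v :* w) ≡.refl) D≈0)
    where
    generator = linear-nonzero (- σ v) (v + σ v) (- v) (- σ v) (v + σ v) (neg-≉0 v≉0)
    ξ = proj₁ generator

  -- If E is isotropic for the form h(-, φ -) but not for h, then the points
  -- v σ(h(E,E)) E + σ(v) h(E,E) φ(E) of the line joining E and φ(E) lie on the curve whenever
  -- v + σ(v) + σ²(v) = 0.
  conjugate-split : ∀ {P E s t} → h E (φ E) ≈ 0# → ¬ h E E ≈ 0# → P ≋ s · E ⊕ t · φ E → Splits P
  conjugate-split {P} {E} {s} {t} hEφE≈0 e≉0 P≋ = A , B , split , α , β , P≋AB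
    where
    e = h E E
    v v′ D : Carrier
    v = proj₁ trace0-nonzero
    v′ = proj₁ (trace0-partner (proj₂ (proj₂ trace0-nonzero)))
    D = wronskian v v′

    v-trace0 : Trace0 v
    v-trace0 = proj₁ (proj₂ trace0-nonzero)
    v′-trace0 : Trace0 v′
    v′-trace0 = proj₁ (proj₂ (trace0-partner (proj₂ (proj₂ trace0-nonzero))))
    D≉0 : ¬ D ≈ 0#
    D≉0 = proj₂ (proj₂ (trace0-partner (proj₂ (proj₂ trace0-nonzero))))

    point : Carrier → Triple
    point v = (v * σ e) · E ⊕ (σ v * e) · φ E

    A B : Triple
    A = point v
    B = point v′

    hφEE : h (φ E) E ≈ σ e
    hφEE = sym (σ-h E E)

    hφEφE : h (φ E) (φ E) ≈ σ^ 2 e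
    hφEφE = trans (sym (σ-h (φ E) E)) (σ-cong hφEE)

    -- Apart from the Moore determinant there remains only a multiple of w + σ(w) + σ²(w). What
    -- survives is antisymmetric in u and w, which gives both isotropy and the alternating
    -- condition.
    h-points : ∀ u {w} → Trace0 w → h (point u) (point w) ≈ e * σ e * σ^ 2 e * wronskian u w
    h-points u {w} w-trace0 = begin
      h (point u) (point w)
        ≈⟨ h-combination (u * σ e) E (σ u * e) (φ E) (w * σ e) E (σ w * e) (φ E) ⟩
      (u * σ e * σ (w * σ e) * e + u * σ e * σ (σ w * e) * h E (φ E))
        + (σ u * e * σ (w * σ e) * h (φ E) E + σ u * e * σ (σ w * e) * h (φ E) (φ E))
        ≈⟨ +-cong (+-dropʳ (*≈0ʳ hEφE≈0)) (+-cong (*-congˡ hφEE) (*-congˡ hφEφE)) ⟩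
      u * σ e * σ (w * σ e) * e + (σ u * e * σ (w * σ e) * σ e + σ u * e * σ (σ w * e) * σ^ 2 e)
        ≈⟨ solve (⌜ u ⌝ ∷ ⌜ w ⌝ ∷ ⌜ e ⌝ ∷ []) (λ u w e →
             u :* :σ e :* :σ (w :* :σ e) :* e :+ (:σ u :* e :* :σ (w :* :σ e) :* :σ e :+ :σ u :* e :* :σ (:σ w :* e) :* :σ (:σ e))
             := e :* :σ e :* :σ (:σ e) :* (u :* :σ w :- :σ u :* w) :+ e :* :σ e :* :σ (:σ e) :* :σ u :* (w :+ :σ w :+ :σ (:σ w))) ≡.refl ⟩
      e * σ e * σ^ 2 e * wronskian u w + e * σ e * σ^ 2 e * σ u * (w + σ w + σ^ 2 w)
        ≈⟨ +-dropʳ (*≈0ʳ (Trace0.trace0 w-trace0)) ⟩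
      e * σ e * σ^ 2 e * wronskian u w ∎

    wronskian-self : ∀ u → wronskian u u ≈ 0#
    wronskian-self u = x≈y⇒x-y≈0 (*-comm u (σ u))

    E-independent : Independent E (φ E)
    E-independent x y eq = x≈0 , y≈0
      where
      y≈0 : y ≈ 0#
      y≈0 = *-cancel (σ-≉0 (σ-≉0 e≉0)) (trans (*-comm _ y) (trans (*-congˡ (sym hφEφE))
              (trans (sym (+-dropˡ (*≈0ʳ hEφE≈0))) (functional eq (φ E)))))
      x≈0 : x ≈ 0#
      x≈0 = *-cancel e≉0 (trans (*-comm e x) (trans (sym (+-dropʳ (*≈0ˡ y≈0))) (functional eq E)))

    independent : Independent A B
    independent x y (eqX , eqY , eqZ) = x≈0 , y≈0
      where
      collect : ∀ {a b} → x * (v * σ e * a + σ v * e * b) + y * (v′ * σ e * a + σ v′ * e * b) ≈ 0# →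
                (x * v + y * v′) * σ e * a + (x * σ v + y * σ v′) * e * b ≈ 0#
      collect {a} {b} eq = trans (solve (⌜ x ⌝ ∷ ⌜ y ⌝ ∷ ⌜ v ⌝ ∷ ⌜ v′ ⌝ ∷ ⌜ e ⌝ ∷ ⌜ a ⌝ ∷ ⌜ b ⌝ ∷ []) (λ x y v v′ e a b →
        (x :* v :+ y :* v′) :* :σ e :* a :+ (x :* :σ v :+ y :* :σ v′) :* e :* b
        := x :* (v :* :σ e :* a :+ :σ v :* e :* b) :+ y :* (v′ :* :σ e :* a :+ :σ v′ :* e :* b)) ≡.refl) eq

      both = E-independent _ _ (collect eqX , collect eqY , collect eqZ)

      p₁ : x * v + y * v′ ≈ 0#
      p₁ = *-cancel (σ-≉0 e≉0) (trans (*-comm _ _) (proj₁ both))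
      p₂ : x * σ v + y * σ v′ ≈ 0#
      p₂ = *-cancel e≉0 (trans (*-comm _ _) (proj₂ both))

      x≈0 : x ≈ 0#
      x≈0 = *-cancel D≉0 (trans (solve (⌜ x ⌝ ∷ ⌜ y ⌝ ∷ ⌜ v ⌝ ∷ ⌜ v′ ⌝ ∷ []) (λ x y v v′ →
        (v :* :σ v′ :- :σ v :* v′) :* x := :σ v′ :* (x :* v :+ y :* v′) :+ :- v′ :* (x :* :σ v :+ y :* :σ v′)) ≡.refl)
        (+≈0 (*≈0ʳ p₁) (*≈0ʳ p₂)))
      y≈0 : y ≈ 0#
      y≈0 = *-cancel D≉0 (trans (solve (⌜ x ⌝ ∷ ⌜ y ⌝ ∷ ⌜ v ⌝ ∷ ⌜ v′ ⌝ ∷ []) (λ x y v v′ →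
        (v :* :σ v′ :- :σ v :* v′) :* y := :- :σ v :* (x :* v :+ y :* v′) :+ v :* (x :* :σ v :+ y :* :σ v′)) ≡.refl)
        (+≈0 (*≈0ʳ p₁) (*≈0ʳ p₂)))

    split : SplitLine A B
    split = record
      { independent = independent
      ; isotropicˡ = trans (h-points v v-trace0) (*≈0ʳ (wronskian-self v))
      ; isotropicʳ = trans (h-points v′ v′-trace0) (*≈0ʳ (wronskian-self v′))
      ; alternating = trans (+-cong (h-points v v′-trace0) (h-points v′ v-trace0))
          (solve (⌜ e ⌝ ∷ ⌜ v ⌝ ∷ ⌜ v′ ⌝ ∷ []) (λ e v v′ → let k = e :* :σ e :* :σ (:σ e) in
            k :* (v :* :σ v′ :- :σ v :* v′) :+ k :* (v′ :* :σ v :- :σ v′ :* v) := :0) ≡.refl) }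

    -- Coordinates of P in the basis A, B by Cramer's rule; the change of basis from E, φ(E) has
    -- determinant D e σ(e).
    d e′ f α β : Carrier
    d = inv D≉0
    e′ = inv e≉0
    f = inv (σ-≉0 e≉0)
    α = d * (s * σ v′ * f - t * v′ * e′)
    β = d * (t * v * e′ - s * σ v * f)

    P≋AB : P ≋ α · A ⊕ β · B
    P≋AB = let x , y , z = P≋ in coordinate x , coordinate y , coordinate z
      where
      coordinate : ∀ {p a b} → p ≈ s * a + t * b →
                   p ≈ α * (v * σ e * a + σ v * e * b) + β * (v′ * σ e * a + σ v′ * e * b)
      coordinate {p} {a} {b} eq = begin
        p                ≈⟨ eq ⟩
        s * a + t * b    ≈⟨ solve (⌜ s ⌝ ∷ ⌜ a ⌝ ∷ ⌜ t ⌝ ∷ ⌜ b ⌝ ∷ []) (λ s a t b → s :* a :+ t :* b := :1 :* (:1 :* (s :* a) :+ :1 :* (t :* b))) ≡.refl ⟩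
        1# * (1# * (s * a) + 1# * (t * b))
          ≈⟨ *-cong (inv-right D≉0) (+-cong (*-congʳ (inv-right (σ-≉0 e≉0))) (*-congʳ (inv-right e≉0))) ⟨
        D * d * (σ e * f * (s * a) + e * e′ * (t * b))
          ≈⟨ solve (⌜ d ⌝ ∷ ⌜ v ⌝ ∷ ⌜ v′ ⌝ ∷ ⌜ e ⌝ ∷ ⌜ e′ ⌝ ∷ ⌜ f ⌝ ∷ ⌜ s ⌝ ∷ ⌜ a ⌝ ∷ ⌜ t ⌝ ∷ ⌜ b ⌝ ∷ []) (λ d v v′ e e′ f s a t b →
               (v :* :σ v′ :- :σ v :* v′) :* d :* (:σ e :* f :* (s :* a) :+ e :* e′ :* (t :* b))
               := d :* (s :* :σ v′ :* f :- t :* v′ :* e′) :* (v :* :σ e :* a :+ :σ v :* e :* b)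
                  :+ d :* (t :* v :* e′ :- s :* :σ v :* f) :* (v′ :* :σ e :* a :+ :σ v′ :* e :* b)) ≡.refl ⟩
        α * (v * σ e * a + σ v * e * b) + β * (v′ * σ e * a + σ v′ * e * b) ∎

  linear₃ : ∀ {f} a b c → (∀ {x y z} → Fixed x → Fixed y → Fixed z → f x y z ≈ x * a + y * b + z * c) → Poly₃ 1 f
  linear₃ a b c eq = resp₃ eq ((mono a 1 0 0 (s≤s z≤n) (λ {x} _ _ _ →
      solve (⌜ x ⌝ ∷ ⌜ a ⌝ ∷ []) (λ x a → x :* a := a :* (x :* :1 :* (:1 :* :1))) ≡.refl)
    +₃ mono b 0 1 0 (s≤s z≤n) (λ {_} {y} _ _ _ →
      solve (⌜ y ⌝ ∷ ⌜ b ⌝ ∷ []) (λ y b → y :* b := b :* (:1 :* (y :* :1 :* :1))) ≡.refl))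
    +₃ mono c 0 0 1 (s≤s z≤n) (λ {_} {_} {z} _ _ _ →
      solve (⌜ z ⌝ ∷ ⌜ c ⌝ ∷ []) (λ z c → z :* c := c :* (:1 :* (:1 :* (z :* :1)))) ≡.refl))

  quadratic : (a b c d e f : Carrier) → Carrier → Carrier → Carrier → Carrier
  quadratic a b c d e f x y z = a * (x * x) + b * (y * y) + c * (z * z) + d * (x * y) + e * (x * z) + f * (y * z)

  quadratic₃ : ∀ {g₁ g₂ g₃} a b c d e f → Poly₃ 1 g₁ → Poly₃ 1 g₂ → Poly₃ 1 g₃ →
               Poly₃ 2 (λ x y z → quadratic a b c d e f (g₁ x y z) (g₂ x y z) (g₃ x y z))
  quadratic₃ a b c d e f p q r =
    ((((scalar a (p *₃ p) +₃ scalar b (q *₃ q)) +₃ scalar c (r *₃ r)) +₃ scalar d (p *₃ q)) +₃ scalar e (p *₃ r)) +₃ scalar f (q *₃ r)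
    where
    scalar : ∀ {d f} a → Poly₃ d f → Poly₃ d (λ x y z → a * f x y z)
    scalar a p = const₃ {0} a *₃ p

  quadratic-cong : ∀ {a b c d e f x x′ y y′ z z′} → x ≈ x′ → y ≈ y′ → z ≈ z′ →
                   quadratic a b c d e f x y z ≈ quadratic a b c d e f x′ y′ z′
  quadratic-cong x y z = +-cong (+-cong (+-cong (+-cong (+-cong (*-congˡ (*-cong x x)) (*-congˡ (*-cong y y))) (*-congˡ (*-cong z z)))
    (*-congˡ (*-cong x y))) (*-congˡ (*-cong x z))) (*-congˡ (*-cong y z))

  -- Transfers `conic` to F_{q³} through the basis 1, θ, θ² over F_q. The element θ is a trace to
  -- F_{q³} chosen with θ ≠ σ(θ), and t, σ(t), σ²(t) become linear forms in the coordinates.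
  conic-fixed³ : ∀ a b c d e f →
    (∀ {t} → Fixed³ t → Fixed (quadratic a b c d e f t (σ t) (σ^ 2 t))) →
    ∃ λ t → Fixed³ t × ¬ t ≈ 0# × quadratic a b c d e f t (σ t) (σ^ 2 t) ≈ 0#
  conic-fixed³ a b c d e f Q-fixed = t x y z , t-fixed³ x-fixed y-fixed z-fixed , t≉0 , is-zero
    where
    generator = linear-nonzero 0# 1# (- 1#) 0# 1# (neg-≉0 1≉0)
    ζ = proj₁ generator
    θ = σ ζ + σ^ 4 ζ

    θ-fixed³ : Fixed³ θ
    θ-fixed³ = solve (⌜ ζ ⌝ ∷ []) (λ ζ → let z₁ = :σ ζ; z₄ = :σ (:σ (:σ z₁)) in :σ (:σ (:σ (z₁ :+ z₄))) := z₁ :+ z₄) ≡.refl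

    θ-σθ≉0 : ¬ θ - σ θ ≈ 0#
    θ-σθ≉0 eq = proj₂ generator (trans (solve (⌜ ζ ⌝ ∷ []) (λ ζ → let z = :σ ζ; z₁ = :σ z; z₂ = :σ z₁; z₃ = :σ z₂; z₄ = :σ z₃ in
          :0 :* ζ :+ :1 :* z :+ :- :1 :* z₁ :+ :0 :* z₂ :+ :1 :* z₃ :+ :- :1 :* z₄ := (z :+ z₃) :- :σ (z :+ z₃)) ≡.refl) eq)

    t : Carrier → Carrier → Carrier → Carrier
    t x y z = x * 1# + y * θ + z * (θ * θ)

    module _ {x y z} (x-fixed : Fixed x) (y-fixed : Fixed y) (z-fixed : Fixed z) where

      vars : Vec Var 4
      vars = ⌜ x ∣ x-fixed ⌝ ∷ ⌜ y ∣ y-fixed ⌝ ∷ ⌜ z ∣ z-fixed ⌝ ∷ ⌜ θ ∣³ θ-fixed³ ⌝ ∷ []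

      t-fixed³ : Fixed³ (t x y z)
      t-fixed³ = solve vars (λ x y z θ → let t = x :* :1 :+ y :* θ :+ z :* (θ :* θ) in :σ (:σ (:σ t)) := t) ≡.refl

      σ-t : σ (t x y z) ≈ x * 1# + y * σ θ + z * σ (θ * θ)
      σ-t = solve vars (λ x y z θ → :σ (x :* :1 :+ y :* θ :+ z :* (θ :* θ)) := x :* :1 :+ y :* :σ θ :+ z :* :σ (θ :* θ)) ≡.refl

      σσ-t : σ^ 2 (t x y z) ≈ x * 1# + y * σ^ 2 θ + z * σ^ 2 (θ * θ)
      σσ-t = solve vars (λ x y z θ → :σ (:σ (x :* :1 :+ y :* θ :+ z :* (θ :* θ))) := x :* :1 :+ y :* :σ (:σ θ) :+ z :* :σ (:σ (θ :* θ))) ≡.refl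

      -- the differences of t, σ t and σ² t, divided by θ - σ θ
      t-independent : t x y z ≈ 0# → x ≈ 0# × y ≈ 0# × z ≈ 0#
      t-independent t≈0 = x≈0 , y≈0 , z≈0
        where
        slope : y + z * (θ + σ θ) ≈ 0#
        slope = *-cancel θ-σθ≉0 (trans
          (solve vars (λ x y z θ → let t = x :* :1 :+ y :* θ :+ z :* (θ :* θ) in (θ :- :σ θ) :* (y :+ z :* (θ :+ :σ θ)) := t :- :σ t) ≡.refl)
          (trans (+-cong t≈0 (-‿cong (trans (σ-cong t≈0) σ-0))) (-‿inverseʳ 0#)))
        z≈0 : z ≈ 0#
        z≈0 = *-cancel (σ-≉0 (σ-≉0 θ-σθ≉0)) (trans
          (solve vars (λ x y z θ → let s = y :+ z :* (θ :+ :σ θ) in :σ (:σ (θ :- :σ θ)) :* z := :σ s :- s) ≡.refl)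
          (trans (+-cong (trans (σ-cong slope) σ-0) (-‿cong slope)) (-‿inverseʳ 0#)))
        y≈0 : y ≈ 0#
        y≈0 = trans (sym (+-dropʳ (*≈0ˡ z≈0))) slope
        x≈0 : x ≈ 0#
        x≈0 = trans (sym (*-identityʳ x)) (trans (sym (trans (+-dropʳ (*≈0ˡ z≈0)) (+-dropʳ (*≈0ˡ y≈0)))) t≈0)

    solution : Zero (λ x y z → quadratic a b c d e f (t x y z) (σ (t x y z)) (σ^ 2 (t x y z)))
    solution = conic
      (quadratic₃ a b c d e f (linear₃ 1# θ (θ * θ) (λ _ _ _ → refl)) (linear₃ 1# (σ θ) (σ (θ * θ)) σ-t)
        (linear₃ 1# (σ^ 2 θ) (σ^ 2 (θ * θ)) σσ-t))
      (λ x y z → Q-fixed (t-fixed³ x y z))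
      (λ {x} {y} {z} x≈0 y≈0 z≈0 → let t≈0 = +≈0 (+≈0 (*≈0ˡ x≈0) (*≈0ˡ y≈0)) (*≈0ˡ z≈0) in
        trans (quadratic-cong t≈0 (trans (σ-cong t≈0) σ-0) (trans (σ-cong (trans (σ-cong t≈0) σ-0)) σ-0))
          (solve (⌜ a ⌝ ∷ ⌜ b ⌝ ∷ ⌜ c ⌝ ∷ ⌜ d ⌝ ∷ ⌜ e ⌝ ∷ ⌜ f ⌝ ∷ []) (λ a b c d e f → let o = :0 :* :0 in
            a :* o :+ b :* o :+ c :* o :+ d :* o :+ e :* o :+ f :* o := :0) ≡.refl))

    open Zero solution

    t≉0 : ¬ t x y z ≈ 0#
    t≉0 t≈0 = nontrivial (t-independent x-fixed y-fixed z-fixed t≈0)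

-- Points whose norm to F_{q²} is not in F_q

n²+n-even : ∀ n → ∃ λ t → t ℕ.+ t ≡ n ℕ.* n ℕ.+ n
n²+n-even zero    = 0 , ≡.refl
n²+n-even (suc n) = let t , eq = n²+n-even n in t ℕ.+ suc n , ≡.trans (rearrange t n) (≡.trans (≡.cong (ℕ._+ (suc n ℕ.+ suc n)) eq) (expand n))
  where
  rearrange : ∀ t n → t ℕ.+ suc n ℕ.+ (t ℕ.+ suc n) ≡ t ℕ.+ t ℕ.+ (suc n ℕ.+ suc n)
  rearrange = NatSolver.solve-∀
  expand : ∀ n → n ℕ.* n ℕ.+ n ℕ.+ (suc n ℕ.+ suc n) ≡ suc n ℕ.* suc n ℕ.+ suc n
  expand = NatSolver.solve-∀

module GenericNorm {c ℓ} (F : Field c ℓ) {q : ℕ} (q-primePower : IsPrimePower q)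
                   (card : FieldTheory.HasCard F (q ℕ.^ 6)) where
  open Splitting F q-primePower card public
  open SetoidReasoning setoid

  norm : Carrier → Carrier
  norm a = a * σ^ 2 a * σ^ 4 a

  σ-^ : ∀ x n → σ (x ^ n) ≈ σ x ^ n
  σ-^ x zero    = σ-1
  σ-^ x (suc n) = trans (σ-* x (x ^ n)) (*-congˡ (σ-^ x n))

  -- On the group of elements y with y σ³(y) = 1, of order q³ + 1, the map y ↦ y σ(y) σ²(y) is
  -- y ↦ y^(1+q+q²); its inverse is β ↦ β^(1+t(q-1)) with t = q(q+1)/2.
  root : ∀ {β} → β * σ^ 3 β ≈ 1# → ∃ λ y → y * σ^ 3 y ≈ 1# × y * σ y * σ^ 2 y ≈ β
  root {β} ββ³≈1 = y , norm-y , product-y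
    where
    t = proj₁ (n²+n-even q)
    -- Since σ³(β) is inverse to β, the element k is β^(q-1).
    k y : Carrier
    k = σ β * σ^ 3 β
    y = β * k ^ t

    kt : ∀ i → σ^ i (k ^ t) ≈ σ^ i k ^ t
    kt zero    = refl
    kt (suc i) = trans (σ-cong (kt i)) (σ-^ _ t)

    ones : 1# * 1# ≈ 1#
    ones = *-identityˡ 1#

    norm-k : k * σ^ 3 k ≈ 1#
    norm-k = trans (solve (⌜ β ⌝ ∷ []) (λ b → let k = :σ b :* :σ (:σ (:σ b)); n = b :* :σ (:σ (:σ b)) in k :* :σ (:σ (:σ k)) := :σ n :* n) ≡.refl)
      (trans (*-cong (trans (σ-cong ββ³≈1) σ-1) ββ³≈1) ones)

    norm-y : y * σ^ 3 y ≈ 1#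
    norm-y = begin
      y * σ^ 3 y                         ≈⟨ solve (⌜ β ⌝ ∷ ⌜ k ^ t ⌝ ∷ []) (λ b k → let y = b :* k in
                                              y :* :σ (:σ (:σ y)) := (b :* :σ (:σ (:σ b))) :* (k :* :σ (:σ (:σ k)))) ≡.refl ⟩
      (β * σ^ 3 β) * (k ^ t * σ^ 3 (k ^ t))   ≈⟨ *-cong ββ³≈1 (trans (*-congˡ (kt 3)) (trans (sym (*-^ k (σ^ 3 k) t)) (trans (^-congˡ t norm-k) (1^ t)))) ⟩
      1# * 1#                            ≈⟨ ones ⟩
      1#                                 ∎

    -- Being the square of σ³(β), this product raised to the power t is σ³(β) raised to q² + q,
    -- although t is only half of that.
    product-k : k * σ k * σ^ 2 k ≈ σ^ 3 β * σ^ 3 β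
    product-k = trans (solve (⌜ β ⌝ ∷ []) (λ b → let b₃ = :σ (:σ (:σ b)); k = :σ b :* b₃; n = b :* b₃ in
        k :* :σ k :* :σ (:σ k) := :σ n :* :σ (:σ n) :* (b₃ :* b₃)) ≡.refl)
      (trans (*-congʳ (trans (*-cong (trans (σ-cong ββ³≈1) σ-1) (trans (σ-cong (trans (σ-cong ββ³≈1) σ-1)) σ-1)) ones)) (*-identityˡ _))

    double-power : ∀ x → (x * x) ^ t ≈ σ (σ x) * σ x
    double-power x = begin
      (x * x) ^ t             ≈⟨ *-^ x x t ⟩
      x ^ t * x ^ t           ≈⟨ ^-+ x t t ⟨
      x ^ (t ℕ.+ t)           ≡⟨ ≡.cong (x ^_) (proj₂ (n²+n-even q)) ⟩
      x ^ (q ℕ.* q ℕ.+ q)     ≈⟨ ^-+ x (q ℕ.* q) q ⟩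
      x ^ (q ℕ.* q) * σ x     ≈⟨ *-congʳ (^-* x q q) ⟩
      σ (σ x) * σ x           ∎

    product-y : y * σ y * σ^ 2 y ≈ β
    product-y = begin
      y * σ y * σ^ 2 y
        ≈⟨ solve (⌜ β ⌝ ∷ ⌜ k ^ t ⌝ ∷ []) (λ b k → let y = b :* k in
             y :* :σ y :* :σ (:σ y) := (b :* :σ b :* :σ (:σ b)) :* (k :* :σ k :* :σ (:σ k))) ≡.refl ⟩
      (β * σ β * σ^ 2 β) * (k ^ t * σ (k ^ t) * σ^ 2 (k ^ t))
        ≈⟨ *-congˡ (trans (*-cong (*-congˡ (kt 1)) (kt 2)) (trans (*-congʳ (sym (*-^ k (σ k) t))) (sym (*-^ (k * σ k) (σ^ 2 k) t)))) ⟩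
      (β * σ β * σ^ 2 β) * (k * σ k * σ^ 2 k) ^ t
        ≈⟨ *-congˡ (trans (^-congˡ t product-k) (double-power (σ^ 3 β))) ⟩
      (β * σ β * σ^ 2 β) * (σ^ 5 β * σ^ 4 β)
        ≈⟨ solve (⌜ β ⌝ ∷ []) (λ b → let n = b :* :σ (:σ (:σ b)); b₄ = :σ (:σ (:σ (:σ b))) in
             (b :* :σ b :* :σ (:σ b)) :* (:σ b₄ :* b₄) := b :* (:σ n :* :σ (:σ n))) ≡.refl ⟩
      β * (σ (β * σ^ 3 β) * σ^ 2 (β * σ^ 3 β))
        ≈⟨ *-congˡ (trans (*-cong (trans (σ-cong ββ³≈1) σ-1) (trans (σ-cong (trans (σ-cong ββ³≈1) σ-1)) σ-1)) ones) ⟩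
      β * 1#   ≈⟨ *-identityʳ β ⟩
      β        ∎

  h-combination₃ : ∀ s₁ s₂ s₃ A B C t₁ t₂ t₃ →
    h (s₁ · A ⊕ s₂ · B ⊕ s₃ · C) (t₁ · A ⊕ t₂ · B ⊕ t₃ · C) ≈
      (s₁ * σ t₁ * h A A + s₁ * σ t₂ * h A B + s₁ * σ t₃ * h A C)
    + (s₂ * σ t₁ * h B A + s₂ * σ t₂ * h B B + s₂ * σ t₃ * h B C)
    + (s₃ * σ t₁ * h C A + s₃ * σ t₂ * h C B + s₃ * σ t₃ * h C C)
  h-combination₃ s₁ s₂ s₃ A B C t₁ t₂ t₃ =
    trans (h-⊕ˡ _ _ _) (+-cong (trans (h-⊕ˡ _ _ _) (+-cong (row s₁ A) (row s₂ B))) (row s₃ C))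
    where
    row : ∀ s V → h (s · V) (t₁ · A ⊕ t₂ · B ⊕ t₃ · C) ≈ s * σ t₁ * h V A + s * σ t₂ * h V B + s * σ t₃ * h V C
    row s V = trans (h-⊕ʳ _ _ _) (+-cong (trans (h-⊕ʳ _ _ _) (+-cong (h-·· s t₁ V A) (h-·· s t₂ V B))) (h-·· s t₃ V C))

  σ⁶-≋ : ∀ A → φ (φ (φ A)) ≋ A
  σ⁶-≋ A = σ⁶ (X A) , σ⁶ (Y A) , σ⁶ (Z A)

  ≋-refl : ∀ {A} → A ≋ A
  ≋-refl = refl , refl , refl

  -- By `σ-h` every entry of the Gram matrix of P, φ(P), φ²(P) is a conjugate of a or of b, and b
  -- lies in F_{q³}.
  module Gram (P : Triple) where
    a b : Carrier
    a = h P P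
    b = h P (φ P)

    h₁₀ : h (φ P) P ≈ σ a
    h₁₀ = sym (σ-h P P)
    h₁₁ : h (φ P) (φ P) ≈ σ^ 2 a
    h₁₁ = trans (sym (σ-h (φ P) P)) (σ-cong h₁₀)
    h₂₁ : h (φ (φ P)) (φ P) ≈ σ^ 3 a
    h₂₁ = trans (sym (σ-h (φ P) (φ P))) (σ-cong h₁₁)
    h₂₂ : h (φ (φ P)) (φ (φ P)) ≈ σ^ 4 a
    h₂₂ = trans (sym (σ-h (φ (φ P)) (φ P))) (σ-cong h₂₁)
    h₀₂ : h P (φ (φ P)) ≈ σ^ 5 a
    h₀₂ = trans (h-cong (≋-sym (σ⁶-≋ P)) ≋-refl) (trans (sym (σ-h (φ (φ P)) (φ (φ P)))) (σ-cong h₂₂))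
    h₂₀ : h (φ (φ P)) P ≈ σ b
    h₂₀ = sym (σ-h P (φ P))
    h₁₂ : h (φ P) (φ (φ P)) ≈ σ^ 2 b
    h₁₂ = trans (sym (σ-h (φ (φ P)) P)) (σ-cong h₂₀)
    b-fixed³ : Fixed³ b
    b-fixed³ = trans (σ-cong (sym h₁₂)) (trans (σ-h (φ P) (φ (φ P))) (h-cong (σ⁶-≋ P) ≋-refl))

  -- The element β = -a/σ³(a) is inverse to σ³(β), so `root` provides y with y σ(y) σ²(y) = β. For
  -- this y the form Q, which is h(E,φ(E)) as a function of t in F_{q³}, takes values in F_q, and
  -- `conic-fixed³` finds a zero.
  generic-split : ∀ {P} → ¬ h P P ≈ 0# → ¬ Fixed (norm (h P P)) → Splits P
  generic-split {P} a≉0 T-not-fixed = conjugate-split {P} {E t} E-isotropic e≉0 P≋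
    where
    open Gram P
    i β : Carrier
    i = inv a≉0
    β = - (a * σ^ 3 i)

    cancel-a : a * i ≈ 1#
    cancel-a = inv-right a≉0

    σ³1≈1 : ∀ {x} → x ≈ 1# → σ^ 3 x ≈ 1#
    σ³1≈1 x≈1 = trans (σ-cong (trans (σ-cong (trans (σ-cong x≈1) σ-1)) σ-1)) σ-1

    ββ³≈1 : β * σ^ 3 β ≈ 1#
    ββ³≈1 = trans (solve (⌜ a ⌝ ∷ ⌜ i ⌝ ∷ []) (λ a i → let β = :- (a :* :σ (:σ (:σ i))) in
        β :* :σ (:σ (:σ β)) := (a :* i) :* :σ (:σ (:σ (a :* i)))) ≡.refl)
      (trans (*-cong cancel-a (σ³1≈1 cancel-a)) (*-identityˡ 1#))

    a≈-βa³ : a ≈ - (β * σ^ 3 a)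
    a≈-βa³ = sym (trans (solve (⌜ a ⌝ ∷ ⌜ i ⌝ ∷ []) (λ a i →
        :- ((:- (a :* :σ (:σ (:σ i)))) :* :σ (:σ (:σ a))) := a :* :σ (:σ (:σ (a :* i)))) ≡.refl)
      (trans (*-congˡ (σ³1≈1 cancel-a)) (*-identityʳ a)))

    y : Carrier
    y = proj₁ (root ββ³≈1)
    y₁ y₂ y₃ y₄ y₅ ν : Carrier
    y₁ = σ^ 1 y
    y₂ = σ^ 2 y
    y₃ = σ^ 3 y
    y₄ = σ^ 4 y
    y₅ = σ^ 5 y
    ν = y * y₂ * y₄

    yy₃≈1 : y * y₃ ≈ 1#
    yy₃≈1 = proj₁ (proj₂ (root ββ³≈1))
    y₁y₄≈1 : y₁ * y₄ ≈ 1#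
    y₁y₄≈1 = trans (sym (σ-* y y₃)) (trans (σ-cong yy₃≈1) σ-1)
    y₂y₅≈1 : y₂ * y₅ ≈ 1#
    y₂y₅≈1 = trans (sym (σ-* y₁ y₄)) (trans (σ-cong y₁y₄≈1) σ-1)
    product-y : y * y₁ * y₂ ≈ β
    product-y = proj₂ (proj₂ (root ββ³≈1))

    -- The signs and powers of y are arranged so that E + y φ(E) telescopes: the terms in φ(P) and
    -- φ²(P) cancel and (1 + ν) t P remains.
    E : Carrier → Triple
    E t = t · P ⊕ (- (y * σ^ 2 t)) · φ P ⊕ (y * y₂ * σ^ 4 t) · φ (φ P)

    E′ : Carrier → Triple
    E′ t = (y₂ * y₄ * t) · P ⊕ σ^ 2 t · φ P ⊕ (- (y₂ * σ^ 4 t)) · φ (φ P)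

    φE≋E′ : ∀ t → φ (E t) ≋ E′ t
    φE≋E′ t = coordinate , coordinate , coordinate
      where
      coordinate : ∀ {p} → σ^ 2 (t * p + - (y * σ^ 2 t) * σ^ 2 p + y * y₂ * σ^ 4 t * σ^ 4 p) ≈
                   y₂ * y₄ * t * p + σ^ 2 t * σ^ 2 p + - (y₂ * σ^ 4 t) * σ^ 4 p
      coordinate {p} = solve (⌜ y ⌝ ∷ ⌜ t ⌝ ∷ ⌜ p ⌝ ∷ []) (λ y t p →
        let s2 = λ x → :σ (:σ x); y₂ = s2 y; y₄ = s2 y₂; t₂ = s2 t; t₄ = s2 t₂; p₂ = s2 p; p₄ = s2 p₂ in
        s2 (t :* p :+ :- (y :* t₂) :* p₂ :+ y :* y₂ :* t₄ :* p₄)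
        := y₂ :* y₄ :* t :* p :+ t₂ :* p₂ :+ :- (y₂ :* t₄) :* p₄) ≡.refl

    c₀₁ c₀₂ c₁₂ : Carrier
    c₀₁ = y₃ * y₅ * a + y * y₂ * σ^ 3 a
    c₀₂ = - (y₃ * σ^ 5 a + y * σ^ 2 a)
    c₁₂ = - (y₅ * σ a + y₂ * σ^ 4 a)

    Q : Carrier → Carrier
    Q t = quadratic b (σ b) (σ^ 2 b) c₀₁ c₀₂ c₁₂ t (σ t) (σ^ 2 t)

    h-E : ∀ {t} → Fixed³ t → h (E t) (φ (E t)) ≈ Q t
    h-E {t} t-fixed³ = begin
      h (E t) (φ (E t))
        ≈⟨ h-cong ≋-refl (φE≋E′ t) ⟩
      h (E t) (E′ t)
        ≈⟨ h-combination₃ t (- (y * σ^ 2 t)) (y * y₂ * σ^ 4 t) P (φ P) (φ (φ P)) (y₂ * y₄ * t) (σ^ 2 t) (- (y₂ * σ^ 4 t)) ⟩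
      _
        ≈⟨ +-cong (+-cong (+-congˡ (*-congˡ h₀₂)) (+-cong (+-cong (*-congˡ h₁₀) (*-congˡ h₁₁)) (*-congˡ h₁₂)))
                  (+-cong (+-cong (*-congˡ h₂₀) (*-congˡ h₂₁)) (*-congˡ h₂₂)) ⟩
      _
        ≈⟨ solve (⌜ y ⌝ ∷ ⌜ a ⌝ ∷ ⌜ b ∣³ b-fixed³ ⌝ ∷ ⌜ t ∣³ t-fixed³ ⌝ ∷ []) (λ y a b t →
             let y₁ = :σ y; y₂ = :σ y₁; y₃ = :σ y₂; y₄ = :σ y₃; y₅ = :σ y₄
                 a₁ = :σ a; a₂ = :σ a₁; a₃ = :σ a₂; a₄ = :σ a₃; a₅ = :σ a₄
                 b₁ = :σ b; b₂ = :σ b₁; t₁ = :σ t; t₂ = :σ t₁; t₄ = :σ (:σ t₂)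
                 s₁ = t; s₂ = :- (y :* t₂); s₃ = y :* y₂ :* t₄
                 u₁ = :σ (y₂ :* y₄ :* t); u₂ = :σ t₂; u₃ = :σ (:- (y₂ :* t₄))
                 n = y :* y₃; m = y₂ :* y₅
             in (s₁ :* u₁ :* a :+ s₁ :* u₂ :* b :+ s₁ :* u₃ :* a₅) :+ (s₂ :* u₁ :* a₁ :+ s₂ :* u₂ :* a₂ :+ s₂ :* u₃ :* b₂)
                  :+ (s₃ :* u₁ :* b₁ :+ s₃ :* u₂ :* a₃ :+ s₃ :* u₃ :* a₄)
                := b :* (t :* t) :+ n :* m :* b₁ :* (t₁ :* t₁) :+ n :* b₂ :* (t₂ :* t₂)
                  :+ (y₃ :* y₅ :* a :+ y :* y₂ :* a₃) :* (t :* t₁) :+ :- (y₃ :* a₅ :+ y :* a₂) :* (t :* t₂)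
                  :+ n :* :- (y₅ :* a₁ :+ y₂ :* a₄) :* (t₁ :* t₂)) ≡.refl ⟩
      b * (t * t) + y * y₃ * (y₂ * y₅) * σ b * (σ t * σ t) + y * y₃ * σ^ 2 b * (σ^ 2 t * σ^ 2 t)
        + c₀₁ * (t * σ t) + c₀₂ * (t * σ^ 2 t) + y * y₃ * c₁₂ * (σ t * σ^ 2 t)
        ≈⟨ +-cong (+-congʳ (+-congʳ (+-cong (+-congˡ (*-congʳ (trans (*-congʳ (trans (*-cong yy₃≈1 y₂y₅≈1) (*-identityˡ 1#))) (*-identityˡ _))))
             (*-congʳ (trans (*-congʳ yy₃≈1) (*-identityˡ _)))))) (*-congʳ (trans (*-congʳ yy₃≈1) (*-identityˡ _))) ⟩
      Q t ∎

    -- both sides are -σ(c₀₂)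
    c₀₁-eq : c₀₁ ≈ - (y₄ * a + y₁ * σ^ 3 a)
    c₀₁-eq = x-y≈0⇒x≈y (begin
      c₀₁ - - (y₄ * a + y₁ * a₃)
        ≈⟨ solve (⌜ y ⌝ ∷ ⌜ a ⌝ ∷ []) (λ y a → let y₁ = :σ y; y₂ = :σ y₁; y₃ = :σ y₂; y₄ = :σ y₃; y₅ = :σ y₄; a₃ = :σ (:σ (:σ a)) in
             (y₃ :* y₅ :* a :+ y :* y₂ :* a₃) :- :- (y₄ :* a :+ y₁ :* a₃) := a :* (y₃ :* y₅ :+ y₄) :+ a₃ :* (y :* y₂ :+ y₁)) ≡.refl ⟩
      a * (y₃ * y₅ + y₄) + a₃ * (y * y₂ + y₁)
        ≈⟨ +-congʳ (*-congʳ (trans a≈-βa³ (-‿cong (*-congʳ (sym product-y))))) ⟩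
      - (y * y₁ * y₂ * a₃) * (y₃ * y₅ + y₄) + a₃ * (y * y₂ + y₁)
        ≈⟨ solve (⌜ y ⌝ ∷ ⌜ a ⌝ ∷ []) (λ y a → let y₁ = :σ y; y₂ = :σ y₁; y₃ = :σ y₂; y₄ = :σ y₃; y₅ = :σ y₄; a₃ = :σ (:σ (:σ a)) in
             :- (y :* y₁ :* y₂ :* a₃) :* (y₃ :* y₅ :+ y₄) :+ a₃ :* (y :* y₂ :+ y₁)
             := a₃ :* (y₁ :* (:1 :- (y :* y₃) :* (y₂ :* y₅)) :+ y :* y₂ :* (:1 :- y₁ :* y₄))) ≡.refl ⟩
      a₃ * (y₁ * (1# - (y * y₃) * (y₂ * y₅)) + y * y₂ * (1# - y₁ * y₄))
        ≈⟨ *≈0ʳ (+≈0 (*≈0ʳ (x≈y⇒x-y≈0 (sym (trans (*-cong yy₃≈1 y₂y₅≈1) (*-identityˡ 1#))))) (*≈0ʳ (x≈y⇒x-y≈0 (sym y₁y₄≈1)))) ⟩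
      0# ∎)
      where a₃ = σ^ 3 a

    Q-fixed : ∀ {t} → Fixed³ t → Fixed (Q t)
    Q-fixed {t} t-fixed³ = trans (σ-cong Q≈) (trans
      (solve (⌜ y ⌝ ∷ ⌜ a ⌝ ∷ ⌜ b ∣³ b-fixed³ ⌝ ∷ ⌜ t ∣³ t-fixed³ ⌝ ∷ []) (λ y a b t →
        let y₁ = :σ y; y₂ = :σ y₁; y₃ = :σ y₂; y₄ = :σ y₃; y₅ = :σ y₄
            a₁ = :σ a; a₂ = :σ a₁; a₃ = :σ a₂; a₄ = :σ a₃; a₅ = :σ a₄
            b₁ = :σ b; b₂ = :σ b₁; t₁ = :σ t; t₂ = :σ t₁
            Q = b :* (t :* t) :+ b₁ :* (t₁ :* t₁) :+ b₂ :* (t₂ :* t₂) :+ :- (y₄ :* a :+ y₁ :* a₃) :* (t :* t₁)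
                :+ :- (y₃ :* a₅ :+ y :* a₂) :* (t :* t₂) :+ :- (y₅ :* a₁ :+ y₂ :* a₄) :* (t₁ :* t₂)
        in :σ Q := Q) ≡.refl) (sym Q≈))
      where
      Q≈ : Q t ≈ quadratic b (σ b) (σ^ 2 b) (- (y₄ * a + y₁ * σ^ 3 a)) c₀₂ c₁₂ t (σ t) (σ^ 2 t)
      Q≈ = +-congʳ (+-congʳ (+-congˡ (*-congʳ c₀₁-eq)))

    solution = conic-fixed³ b (σ b) (σ^ 2 b) c₀₁ c₀₂ c₁₂ Q-fixed

    t : Carrier
    t = proj₁ solution
    t-fixed³ : Fixed³ t
    t-fixed³ = proj₁ (proj₂ solution)
    t≉0 : ¬ t ≈ 0#
    t≉0 = proj₁ (proj₂ (proj₂ solution))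

    E-isotropic : h (E t) (φ (E t)) ≈ 0#
    E-isotropic = trans (h-E t-fixed³) (proj₂ (proj₂ (proj₂ solution)))

    -- ν = -1 would give β = -σ(y)², so that norm a = σ(norm a).
    1+ν≉0 : ¬ 1# + ν ≈ 0#
    1+ν≉0 1+ν≈0 = T-not-fixed (sym (begin
      norm a
        ≈⟨ *-cong (*-cong a-eq (σσ a-eq)) (σσ (σσ a-eq)) ⟩
      norm (y₁ * y₁ * σ^ 3 a)
        ≈⟨ solve (⌜ y ⌝ ∷ ⌜ a ⌝ ∷ []) (λ y a → let s2 = λ x → :σ (:σ x); n = λ x → x :* s2 x :* s2 (s2 x); y₁ = :σ y in
             n (y₁ :* y₁ :* :σ (:σ (:σ a))) := :σ (n y) :* :σ (n y) :* :σ (n a)) ≡.refl ⟩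
      σ ν * σ ν * σ (norm a)
        ≈⟨ *-congʳ (*-cong σν≈-1 σν≈-1) ⟩
      - 1# * - 1# * σ (norm a)
        ≈⟨ solve (⌜ σ (norm a) ⌝ ∷ []) (λ x → (:- :1) :* (:- :1) :* x := x) ≡.refl ⟩
      σ (norm a) ∎))
      where
      σσ : ∀ {x y} → x ≈ y → σ^ 2 x ≈ σ^ 2 y
      σσ eq = σ-cong (σ-cong eq)

      ν≈-1 : ν ≈ - 1#
      ν≈-1 = trans (solve (⌜ ν ⌝ ∷ []) (λ n → n := (:1 :+ n) :- :1) ≡.refl) (trans (+-congʳ 1+ν≈0) (+-identityˡ _))

      σν≈-1 : σ ν ≈ - 1#
      σν≈-1 = trans (σ-cong ν≈-1) (trans (σ-- 1#) (-‿cong σ-1))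

      yy₂-eq : y * y₂ ≈ - y₁
      yy₂-eq = begin
        y * y₂                   ≈⟨ *-identityʳ _ ⟨
        y * y₂ * 1#              ≈⟨ *-congˡ y₁y₄≈1 ⟨
        y * y₂ * (y₁ * y₄)       ≈⟨ solve (⌜ y ⌝ ∷ []) (λ y → let y₁ = :σ y; y₂ = :σ y₁; y₄ = :σ (:σ y₂) in y :* y₂ :* (y₁ :* y₄) := y :* y₂ :* y₄ :* y₁) ≡.refl ⟩
        ν * y₁                   ≈⟨ *-congʳ ν≈-1 ⟩
        - 1# * y₁                ≈⟨ trans (sym (-‿distribˡ-* 1# y₁)) (-‿cong (*-identityˡ y₁)) ⟩
        - y₁                     ∎

      a-eq : a ≈ y₁ * y₁ * σ^ 3 a
      a-eq = begin
        a                                ≈⟨ a≈-βa³ ⟩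
        - (β * σ^ 3 a)                   ≈⟨ -‿cong (*-congʳ product-y) ⟨
        - (y * y₁ * y₂ * σ^ 3 a)         ≈⟨ solve (⌜ y ⌝ ∷ ⌜ σ^ 3 a ⌝ ∷ []) (λ y a → let y₁ = :σ y; y₂ = :σ y₁ in :- (y :* y₁ :* y₂ :* a) := :- (y :* y₂) :* y₁ :* a) ≡.refl ⟩
        - (y * y₂) * y₁ * σ^ 3 a         ≈⟨ *-congʳ (*-congʳ (trans (-‿cong yy₂-eq) (-‿involutive y₁))) ⟩
        y₁ * y₁ * σ^ 3 a                 ∎

    k : Carrier
    k = (1# + ν) * t

    k≉0 : ¬ k ≈ 0#
    k≉0 = *-≉0 1+ν≉0 t≉0

    kP≋ : 1# · E t ⊕ y · φ (E t) ≋ k · P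
    kP≋ = coordinate , coordinate , coordinate
      where
      coordinate : ∀ {p} → let e = t * p + - (y * σ^ 2 t) * σ^ 2 p + y * y₂ * σ^ 4 t * σ^ 4 p in
                   1# * e + y * σ^ 2 e ≈ k * p
      coordinate {p} = solve (⌜ y ⌝ ∷ ⌜ t ⌝ ∷ ⌜ p ⌝ ∷ []) (λ y t p →
        let s2 = λ x → :σ (:σ x); y₂ = s2 y; y₄ = s2 y₂; t₂ = s2 t; t₄ = s2 t₂; p₂ = s2 p; p₄ = s2 p₂
            e = t :* p :+ :- (y :* t₂) :* p₂ :+ y :* y₂ :* t₄ :* p₄
        in :1 :* e :+ y :* s2 e := (:1 :+ y :* y₂ :* y₄) :* t :* p) ≡.refl

    -- Were h(E,E) zero, then by `σ-h` and the choice of t all four values of h on E and φ(E) would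
    -- vanish, hence also h(P,P).
    e≉0 : ¬ h (E t) (E t) ≈ 0#
    e≉0 e≈0 = a≉0 (*-cancel (*-≉0 k≉0 (σ-≉0 k≉0)) (begin
      k * σ k * a                 ≈⟨ h-·· k k P P ⟨
      h (k · P) (k · P)           ≈⟨ h-cong kP≋ kP≋ ⟨
      h (1# · E t ⊕ y · φ (E t)) (1# · E t ⊕ y · φ (E t))
        ≈⟨ h-combination 1# (E t) y (φ (E t)) 1# (E t) y (φ (E t)) ⟩
      _ ≈⟨ +≈0 (+≈0 (*≈0ʳ e≈0) (*≈0ʳ E-isotropic)) (+≈0 (*≈0ʳ hφEE≈0) (*≈0ʳ hφEφE≈0)) ⟩
      0#                          ∎))
      where
      hφEE≈0 : h (φ (E t)) (E t) ≈ 0#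
      hφEE≈0 = trans (sym (σ-h (E t) (E t))) (trans (σ-cong e≈0) σ-0)
      hφEφE≈0 : h (φ (E t)) (φ (E t)) ≈ 0#
      hφEφE≈0 = trans (sym (σ-h (φ (E t)) (E t))) (trans (σ-cong hφEE≈0) σ-0)

    P≋ : P ≋ (inv k≉0 * 1#) · E t ⊕ (inv k≉0 * y) · φ (E t)
    P≋ = let x , y , z = kP≋ in coordinate x , coordinate y , coordinate z
      where
      coordinate : ∀ {p u v} → 1# * u + y * v ≈ k * p → p ≈ inv k≉0 * 1# * u + inv k≉0 * y * v
      coordinate {p} {u} {v} eq = begin
        p                                ≈⟨ *-identityˡ p ⟨
        1# * p                           ≈⟨ *-congʳ (inv-left k≉0) ⟨
        inv k≉0 * k * p                  ≈⟨ *-assoc _ _ _ ⟩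
        inv k≉0 * (k * p)                ≈⟨ *-congˡ eq ⟨
        inv k≉0 * (1# * u + y * v)       ≈⟨ solve (⌜ inv k≉0 ⌝ ∷ ⌜ u ⌝ ∷ ⌜ y ⌝ ∷ ⌜ v ⌝ ∷ []) (λ i u y v → i :* (:1 :* u :+ y :* v) := i :* :1 :* u :+ i :* y :* v) ≡.refl ⟩
        inv k≉0 * 1# * u + inv k≉0 * y * v ∎

-- Trace conditions and rational vectors for points whose norm is in F_q

module SpecialNorm {c ℓ} (F : Field c ℓ) {q : ℕ} (q-primePower : IsPrimePower q)
                   (card : FieldTheory.HasCard F (q ℕ.^ 6)) where
  open GenericNorm F q-primePower card public
  open SetoidReasoning setoid

  -- The trace pairs each conjugate of g with its image under σ³.
  anti³⇒Tr≈0 : ∀ {g} → σ^ 3 g ≈ - g → Tr g ≈ 0#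
  anti³⇒Tr≈0 {g} eq = begin
    Tr g
      ≈⟨ solve (⌜ g ⌝ ∷ []) (λ g → let g₁ = :σ g; g₂ = :σ g₁; g₃ = :σ g₂; g₄ = :σ g₃; g₅ = :σ g₄; s = g₃ :+ g in
           g :+ g₁ :+ g₂ :+ g₃ :+ g₄ :+ g₅ := s :+ :σ s :+ :σ (:σ s)) ≡.refl ⟩
    s + σ s + σ^ 2 s
      ≈⟨ +≈0 (+≈0 s≈0 σs≈0) (trans (σ-cong σs≈0) σ-0) ⟩
    0# ∎
    where
    s = σ^ 3 g + g
    s≈0 : s ≈ 0#
    s≈0 = trans (+-congʳ eq) (-‿inverseˡ g)
    σs≈0 : σ s ≈ 0#
    σs≈0 = trans (σ-cong s≈0) σ-0

  alternating-sum : Carrier → Carrier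
  alternating-sum y = y - σ y + σ^ 2 y - σ^ 3 y + σ^ 4 y - σ^ 5 y

  ε′ : Carrier
  ε′ = inv ε≉0

  σ-ε′ : σ ε′ ≈ - ε′
  σ-ε′ = *-cancelˡ ε≉0 (begin
    ε * σ ε′          ≈⟨ *-congʳ (trans (-‿cong σ-ε) (-‿involutive ε)) ⟨
    - σ ε * σ ε′      ≈⟨ -‿distribˡ-* _ _ ⟨
    - (σ ε * σ ε′)    ≈⟨ -‿cong (trans (σ-inv ε≉0) (sym (inv-right ε≉0))) ⟩
    - (ε * ε′)        ≈⟨ -‿distribʳ-* _ _ ⟩
    ε * - ε′          ∎)

  -- Dividing by ε turns the trace into an alternating sum of conjugates, so that the condition in
  -- `rational-split` can be studied without ε.
  Tr-ε′ : ∀ y → Tr (ε′ * y) ≈ ε′ * alternating-sum y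
  Tr-ε′ y = trans (+-cong (+-cong (+-cong (+-cong (+-congˡ s₁) s₂) s₃) s₄) s₅)
    (solve (⌜ ε′ ⌝ ∷ ⌜ y ⌝ ∷ []) (λ e y → let y₁ = :σ y; y₂ = :σ y₁; y₃ = :σ y₂; y₄ = :σ y₃; y₅ = :σ y₄ in
      e :* y :+ :- e :* y₁ :+ e :* y₂ :+ :- e :* y₃ :+ e :* y₄ :+ :- e :* y₅ := e :* (y :- y₁ :+ y₂ :- y₃ :+ y₄ :- y₅)) ≡.refl)
    where
    odd : ∀ {x z} → x ≈ ε′ * z → σ x ≈ - ε′ * σ z
    odd eq = trans (σ-cong eq) (trans (σ-* _ _) (*-congʳ σ-ε′))
    even : ∀ {x z} → x ≈ - ε′ * z → σ x ≈ ε′ * σ z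
    even eq = trans (σ-cong eq) (trans (σ-* _ _) (*-congʳ (trans (σ-- ε′) (trans (-‿cong σ-ε′) (-‿involutive ε′)))))
    s₁ = odd {ε′ * y} refl
    s₂ = even s₁
    s₃ = odd s₂
    s₄ = even s₃
    s₅ = odd s₄

  Fixed² : Carrier → Set ℓ
  Fixed² x = σ^ 2 x ≈ x

  ⌜_∣²_⌝ : ∀ x → Fixed² x → Var
  ⌜ x ∣² p ⌝ = x of-period 2 by p

  -- A trace to F_{q²} that is not in F_q, so that 1, η is a basis of F_{q²} over F_q.
  η : Carrier
  η = let z = proj₁ η-generator in z + σ^ 2 z + σ^ 4 z
    where η-generator = linear-nonzero 1# (- 1#) 1# (- 1#) 1# (neg-≉0 1≉0)

  η-fixed² : Fixed² η
  η-fixed² = solve (⌜ _ ⌝ ∷ []) (λ z → let z₂ = :σ (:σ z); z₄ = :σ (:σ z₂) in :σ (:σ (z :+ z₂ :+ z₄)) := z :+ z₂ :+ z₄) ≡.refl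

  η-ση≉0 : ¬ η - σ η ≈ 0#
  η-ση≉0 eq = proj₂ (linear-nonzero 1# (- 1#) 1# (- 1#) 1# (neg-≉0 1≉0)) (trans
    (solve (⌜ _ ⌝ ∷ []) (λ z → let z₁ = :σ z; z₂ = :σ z₁; z₃ = :σ z₂; z₄ = :σ z₃; z₅ = :σ z₄; t = z :+ z₂ :+ z₄ in
      :1 :* z :+ :- :1 :* z₁ :+ :1 :* z₂ :+ :- :1 :* z₃ :+ :1 :* z₄ :+ :- :1 :* z₅ := t :- :σ t) ≡.refl) eq)

  -- An element of F_{q²} with trace 1 to F_q; it does the work of 1/2 in every characteristic.
  ω : Carrier
  ω = let θ = proj₁ trace-one in θ + σ^ 2 θ + σ^ 4 θ

  ω-fixed² : Fixed² ω
  ω-fixed² = solve (⌜ _ ⌝ ∷ []) (λ z → let z₂ = :σ (:σ z); z₄ = :σ (:σ z₂) in :σ (:σ (z :+ z₂ :+ z₄)) := z :+ z₂ :+ z₄) ≡.refl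

  ω+σω≈1 : ω + σ ω ≈ 1#
  ω+σω≈1 = trans (solve (⌜ _ ⌝ ∷ []) (λ z → let z₁ = :σ z; z₂ = :σ z₁; z₃ = :σ z₂; z₄ = :σ z₃; z₅ = :σ z₄; t = z :+ z₂ :+ z₄ in
      t :+ :σ t := z :+ z₁ :+ z₂ :+ z₃ :+ z₄ :+ z₅) ≡.refl) (proj₂ trace-one)

  -- Transfers `conic` to the three-dimensional F_q-space of pairs (t, s) with t in F_{q²} and s in
  -- F_q, through t = x + y η.
  conic-fixed² : ∀ a b c d e f →
    (∀ {t s} → Fixed² t → Fixed s → Fixed (quadratic a b c d e f t (σ t) s)) →
    ∃ λ t → ∃ λ s → Fixed² t × Fixed s × ¬ (t ≈ 0# × s ≈ 0#) × quadratic a b c d e f t (σ t) s ≈ 0#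
  conic-fixed² a b c d e f Q-fixed = t x y , z , t-fixed² x-fixed y-fixed , z-fixed , nontrivial′ , is-zero
    where
    t : Carrier → Carrier → Carrier
    t x y = x * 1# + y * η

    module _ {x y} (x-fixed : Fixed x) (y-fixed : Fixed y) where
      t-fixed² : Fixed² (t x y)
      t-fixed² = solve (⌜ x ∣ x-fixed ⌝ ∷ ⌜ y ∣ y-fixed ⌝ ∷ ⌜ η ∣² η-fixed² ⌝ ∷ []) (λ x y η → let t = x :* :1 :+ y :* η in :σ (:σ t) := t) ≡.refl

      σ-t : σ (t x y) ≈ x * 1# + y * σ η
      σ-t = solve (⌜ x ∣ x-fixed ⌝ ∷ ⌜ y ∣ y-fixed ⌝ ∷ ⌜ η ∣² η-fixed² ⌝ ∷ []) (λ x y η → :σ (x :* :1 :+ y :* η) := x :* :1 :+ y :* :σ η) ≡.refl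

      t-independent : t x y ≈ 0# → x ≈ 0# × y ≈ 0#
      t-independent t≈0 = trans (sym (*-identityʳ x)) (trans (sym (+-dropʳ (*≈0ˡ y≈0))) t≈0) , y≈0
        where
        y≈0 : y ≈ 0#
        y≈0 = *-cancel η-ση≉0 (trans
          (solve (⌜ x ∣ x-fixed ⌝ ∷ ⌜ y ∣ y-fixed ⌝ ∷ ⌜ η ∣² η-fixed² ⌝ ∷ []) (λ x y η → let t = x :* :1 :+ y :* η in (η :- :σ η) :* y := t :- :σ t) ≡.refl)
          (trans (+-cong t≈0 (-‿cong (trans (σ-cong t≈0) σ-0))) (-‿inverseʳ 0#)))

    third : ∀ {x y z} → z ≈ x * 0# + y * 0# + z * 1#
    third {x} {y} {z} = solve (⌜ x ⌝ ∷ ⌜ y ⌝ ∷ ⌜ z ⌝ ∷ []) (λ x y z → z := x :* :0 :+ y :* :0 :+ z :* :1) ≡.refl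

    solution : Zero (λ x y z → quadratic a b c d e f (t x y) (σ (t x y)) z)
    solution = conic
      (quadratic₃ a b c d e f (linear₃ 1# η 0# (λ _ _ _ → sym (+-dropʳ (zeroʳ _))))
        (linear₃ 1# (σ η) 0# (λ x y _ → trans (σ-t x y) (sym (+-dropʳ (zeroʳ _)))))
        (linear₃ 0# 0# 1# (λ _ _ _ → third)))
      (λ x y z → Q-fixed (t-fixed² x y) z)
      (λ x≈0 y≈0 z≈0 → let t≈0 = +≈0 (*≈0ˡ x≈0) (*≈0ˡ y≈0) in
        trans (quadratic-cong t≈0 (trans (σ-cong t≈0) σ-0) z≈0)
          (solve (⌜ a ⌝ ∷ ⌜ b ⌝ ∷ ⌜ c ⌝ ∷ ⌜ d ⌝ ∷ ⌜ e ⌝ ∷ ⌜ f ⌝ ∷ []) (λ a b c d e f → let o = :0 :* :0 in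
            a :* o :+ b :* o :+ c :* o :+ d :* o :+ e :* o :+ f :* o := :0) ≡.refl))

    open Zero solution

    nontrivial′ : ¬ (t x y ≈ 0# × z ≈ 0#)
    nontrivial′ (t≈0 , z≈0) = let x≈0 , y≈0 = t-independent x-fixed y-fixed t≈0 in nontrivial (x≈0 , y≈0 , z≈0)

  fixed²-inv : ∀ {x} (x≉0 : ¬ x ≈ 0#) → Fixed² x → Fixed² (inv x≉0)
  fixed²-inv {x} x≉0 x-fixed² = inv-unique (trans (*-congʳ (sym x-fixed²)) (trans (sym (σ-* _ _)) (trans (σ-cong (σ-inv x≉0)) σ-1))) (inv-right x≉0)

  -- Points spanned by rational vectors

  rational-h : ∀ {A B} → Rational B → σ (h A B) ≈ h B A
  rational-h {A} {B} B-rational = trans (σ-h A B) (h-cong B-rational ≋-refl)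

  rational-combination : ∀ {A B s t} → Rational A → Rational B → Fixed² s → Fixed² t → Rational (s · A ⊕ t · B)
  rational-combination (x , y , z) (x′ , y′ , z′) s-fixed² t-fixed² = go x x′ , go y y′ , go z z′
    where
    go : ∀ {a b} → Fixed² a → Fixed² b → Fixed² (_ * a + _ * b)
    go {a} {b} a-fixed² b-fixed² = solve (⌜ _ ∣² s-fixed² ⌝ ∷ ⌜ _ ∣² t-fixed² ⌝ ∷ ⌜ a ∣² a-fixed² ⌝ ∷ ⌜ b ∣² b-fixed² ⌝ ∷ [])
      (λ s t a b → let x = s :* a :+ t :* b in :σ (:σ x) := x) ≡.refl

  -- V itself serves as the rational point. Divided by v σ(v), the value h(P,P) is an element of F_q
  -- plus r + σ(r) with r = α/v, and both parts have alternating sum 0.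
  hyperbolic-split : ∀ {W V α} → Rational W → Rational V → h V V ≈ 0# → ¬ h W V ≈ 0# → Splits (1# · W ⊕ α · V)
  hyperbolic-split {W} {V} {α} W-rational V-rational hVV≈0 v≉0 =
    rational-split {g = ε′ * y} V-rational hVV≈0 w≉0 g-eq (trans (Tr-ε′ y) (*≈0ʳ alternating-y))
    where
    P = 1# · W ⊕ α · V
    v v′ m r y : Carrier
    v = h W V
    v′ = inv v≉0
    m = h W W
    r = α * v′
    y = m * v′ * σ v′ + (r + σ r)

    w≈v : h P V ≈ v
    w≈v = trans (h-⊕ˡ _ _ _) (trans (+-cong (trans (h-·ˡ 1# W V) (*-identityˡ v)) (trans (h-·ˡ α V V) (*≈0ʳ hVV≈0))) (+-identityʳ v))

    w≉0 : ¬ h P V ≈ 0#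
    w≉0 w≈0 = v≉0 (trans (sym w≈v) w≈0)

    m-fixed : Fixed m
    m-fixed = rational-h W-rational

    v-fixed² : Fixed² v
    v-fixed² = trans (σ-cong (rational-h V-rational)) (rational-h W-rational)

    v′-fixed² : Fixed² v′
    v′-fixed² = fixed²-inv v≉0 v-fixed²

    alternating-y : alternating-sum y ≈ 0#
    alternating-y = solve (⌜ m ∣ m-fixed ⌝ ∷ ⌜ v′ ∣² v′-fixed² ⌝ ∷ ⌜ α ⌝ ∷ []) (λ m v α →
      let r = α :* v; y = m :* v :* :σ v :+ (r :+ :σ r); y₁ = :σ y; y₂ = :σ y₁; y₃ = :σ y₂; y₄ = :σ y₃; y₅ = :σ y₄ in
      y :- y₁ :+ y₂ :- y₃ :+ y₄ :- y₅ := :0) ≡.refl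

    hPP : h P P ≈ m + σ α * v + α * σ v
    hPP = begin
      h P P
        ≈⟨ h-combination 1# W α V 1# W α V ⟩
      (1# * σ 1# * m + 1# * σ α * v) + (α * σ 1# * h V W + α * σ α * h V V)
        ≈⟨ +-cong (+-congʳ (*-congʳ (trans (*-identityˡ _) σ-1))) (+-cong (*-cong (trans (*-congˡ σ-1) (*-identityʳ α)) (sym (rational-h V-rational))) (*≈0ʳ hVV≈0)) ⟩
      (1# * m + 1# * σ α * v) + (α * σ v + 0#)
        ≈⟨ solve (⌜ m ⌝ ∷ ⌜ α ⌝ ∷ ⌜ v ⌝ ∷ []) (λ m α v → (:1 :* m :+ :1 :* :σ α :* v) :+ (α :* :σ v :+ :0) := m :+ :σ α :* v :+ α :* :σ v) ≡.refl ⟩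
      m + σ α * v + α * σ v ∎

    g-eq : ε′ * y * (ε * (h P V * σ (h P V))) ≈ h P P
    g-eq = begin
      ε′ * y * (ε * (h P V * σ (h P V)))
        ≈⟨ *-congˡ (*-congˡ (*-cong w≈v (σ-cong w≈v))) ⟩
      ε′ * y * (ε * (v * σ v))
        ≈⟨ solve (⌜ ε′ ⌝ ∷ ⌜ ε ⌝ ∷ ⌜ m ⌝ ∷ ⌜ v ⌝ ∷ ⌜ v′ ⌝ ∷ ⌜ α ⌝ ∷ []) (λ e′ e m v v′ α →
             let r = α :* v′; y = m :* v′ :* :σ v′ :+ (r :+ :σ r); n = v :* v′; o = e :* e′ in
             e′ :* y :* (e :* (v :* :σ v)) := o :* (n :* :σ n :* m :+ :σ n :* :σ α :* v :+ n :* α :* :σ v)) ≡.refl ⟩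
      ε * ε′ * (v * v′ * σ (v * v′) * m + σ (v * v′) * σ α * v + v * v′ * α * σ v)
        ≈⟨ trans (*-congʳ (inv-right ε≉0)) (*-identityˡ _) ⟩
      v * v′ * σ (v * v′) * m + σ (v * v′) * σ α * v + v * v′ * α * σ v
        ≈⟨ +-cong (+-cong (trans (*-congʳ (trans (*-cong vv′≈1 σvv′≈1) (*-identityˡ 1#))) (*-identityˡ m))
                    (*-congʳ (trans (*-congʳ σvv′≈1) (*-identityˡ _)))) (*-congʳ (trans (*-congʳ vv′≈1) (*-identityˡ α))) ⟩
      m + σ α * v + α * σ v
        ≈⟨ hPP ⟨
      h P P ∎
      where
      vv′≈1 : v * v′ ≈ 1#
      vv′≈1 = inv-right v≉0
      σvv′≈1 : σ (v * v′) ≈ 1#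
      σvv′≈1 = trans (σ-cong vv′≈1) σ-1

  -- The alternating sum of the conjugates of 1/(u σ(u)), cleared of denominators by the product of
  -- the six conjugates of u.
  Γ : Carrier → Carrier
  Γ u = σ^ 2 u * σ^ 4 u * σ^ 3 u * (σ^ 5 u - σ u) + σ^ 4 u * u * σ^ 5 u * (σ u - σ^ 3 u) + u * σ^ 2 u * σ u * (σ^ 3 u - σ^ 5 u)

  alternating-inverse : ∀ {u} (u≉0 : ¬ u ≈ 0#) → Γ u ≈ 0# → alternating-sum (inv u≉0 * σ (inv u≉0)) ≈ 0#
  alternating-inverse {u} u≉0 Γ≈0 = begin
    alternating-sum z
      ≈⟨ alternating-cong (sym (trans (*-congˡ ones) (*-identityʳ z))) ⟩
    alternating-sum (z * (n 2 * n 3 * (n 4 * n 5)))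
      ≈⟨ solve (⌜ u ⌝ ∷ ⌜ u′ ⌝ ∷ []) (λ u v →
           let u₁ = :σ u; u₂ = :σ u₁; u₃ = :σ u₂; u₄ = :σ u₃; u₅ = :σ u₄
               v₁ = :σ v; v₂ = :σ v₁; v₃ = :σ v₂; v₄ = :σ v₃; v₅ = :σ v₄
               n = λ x → x :* :σ x; m = u :* v; m₂ = :σ (:σ m); m₃ = :σ m₂; m₄ = :σ m₃; m₅ = :σ m₄
               y = v :* v₁ :* (m₂ :* m₃ :* (m₄ :* m₅)); y₁ = :σ y; y₂ = :σ y₁; y₃ = :σ y₂; y₄ = :σ y₃; y₅ = :σ y₄
           in y :- y₁ :+ y₂ :- y₃ :+ y₄ :- y₅ := v :* v₁ :* v₂ :* v₃ :* v₄ :* v₅ :*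
              (u₂ :* u₄ :* u₃ :* (u₅ :- u₁) :+ u₄ :* u :* u₅ :* (u₁ :- u₃) :+ u :* u₂ :* u₁ :* (u₃ :- u₅))) ≡.refl ⟩
    u′ * σ u′ * σ^ 2 u′ * σ^ 3 u′ * σ^ 4 u′ * σ^ 5 u′ * Γ u
      ≈⟨ *≈0ʳ Γ≈0 ⟩
    0# ∎
    where
    u′ z : Carrier
    u′ = inv u≉0
    z = u′ * σ u′
    n : ℕ → Carrier
    n i = σ^ i (u * u′)

    n≈1 : ∀ i → n i ≈ 1#
    n≈1 zero    = inv-right u≉0
    n≈1 (suc i) = trans (σ-cong (n≈1 i)) σ-1

    ones : n 2 * n 3 * (n 4 * n 5) ≈ 1#
    ones = trans (*-cong (trans (*-cong (n≈1 2) (n≈1 3)) (*-identityˡ 1#)) (trans (*-cong (n≈1 4) (n≈1 5)) (*-identityˡ 1#))) (*-identityˡ 1#)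

    alternating-cong : ∀ {x y} → x ≈ y → alternating-sum x ≈ alternating-sum y
    alternating-cong x≈y = +-cong (+-cong (+-cong (+-cong (+-cong x≈y (-‿cong (σ^-cong 1 x≈y))) (σ^-cong 2 x≈y))
      (-‿cong (σ^-cong 3 x≈y))) (σ^-cong 4 x≈y)) (-‿cong (σ^-cong 5 x≈y))

  -- Arises for tangent lines: there h(P,R) = e + τ, where the choice of R leaves τ in F_{q²} free
  -- and h(P,P) is in F_q, so only the alternating sum of 1/(u σ(u)) has to vanish.
  record AlternatingSolution (e : Carrier) : Set (c ⊔ ℓ) where
    field
      τ           : Carrier
      τ-fixed²    : Fixed² τ
      u≉0         : ¬ e + τ ≈ 0#
      alternating : alternating-sum (inv u≉0 * σ (inv u≉0)) ≈ 0#

  Γ-1 : Γ 1# ≈ 0#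
  Γ-1 = solve [] (let s1 = :σ :1; s2 = :σ s1; s3 = :σ s2; s4 = :σ s3; s5 = :σ s4 in
    s2 :* s4 :* s3 :* (s5 :- s1) :+ s4 :* :1 :* s5 :* (s1 :- s3) :+ :1 :* s2 :* s1 :* (s3 :- s5) := :0) ≡.refl

  rational-solution : ∀ {e} → Fixed² e → AlternatingSolution e
  rational-solution {e} e-fixed² = record
    { τ = 1# - e ; τ-fixed² = trans (σ-cong σ-1-e) (trans (σ-+ _ _) (+-cong σ-1 (trans (σ-- _) (-‿cong e-fixed²))))
    ; u≉0 = u≉0 ; alternating = alternating-inverse u≉0 (trans (Γ-cong u≈1) Γ-1) }
    where
    σ-1-e : σ (1# - e) ≈ 1# - σ e
    σ-1-e = trans (σ-+ _ _) (+-cong σ-1 (σ-- e))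

    u≈1 : e + (1# - e) ≈ 1#
    u≈1 = solve (⌜ e ⌝ ∷ []) (λ e → e :+ (:1 :- e) := :1) ≡.refl

    u≉0 : ¬ e + (1# - e) ≈ 0#
    u≉0 u≈0 = 1≉0 (trans (sym u≈1) u≈0)

    Γ-cong : ∀ {x y} → x ≈ y → Γ x ≈ Γ y
    Γ-cong x≈y = +-cong (+-cong (*-cong (*-cong (*-cong (σ^-cong 2 x≈y) (σ^-cong 4 x≈y)) (σ^-cong 3 x≈y)) (+-cong (σ^-cong 5 x≈y) (-‿cong (σ^-cong 1 x≈y))))
      (*-cong (*-cong (*-cong (σ^-cong 4 x≈y) x≈y) (σ^-cong 5 x≈y)) (+-cong (σ^-cong 1 x≈y) (-‿cong (σ^-cong 3 x≈y)))))
      (*-cong (*-cong (*-cong x≈y (σ^-cong 2 x≈y)) (σ^-cong 1 x≈y)) (+-cong (σ^-cong 3 x≈y) (-‿cong (σ^-cong 5 x≈y))))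

  -- For rational τ the terms of Γ (e + τ) which are cubic in τ cancel.
  module Irrational {e : Carrier} (e-not-fixed² : ¬ Fixed² e) where
    e₁ e₂ e₃ e₄ e₅ k l m : Carrier
    e₁ = σ^ 1 e
    e₂ = σ^ 2 e
    e₃ = σ^ 3 e
    e₄ = σ^ 4 e
    e₅ = σ^ 5 e
    k = - (e * (e₅ - e₁) + e₂ * (e₁ - e₃) + e₄ * (e₃ - e₅))
    l = - (e * e₃ * (e₅ - e₁) + e₂ * e₅ * (e₁ - e₃) + e₄ * e₁ * (e₃ - e₅))
    m = e₂ * e₄ * e₃ * (e₅ - e₁) + e₄ * e * e₅ * (e₁ - e₃) + e * e₂ * e₁ * (e₃ - e₅)

    :k :l :m : Expr → Expr
    :k e = let e₁ = :σ e; e₂ = :σ e₁; e₃ = :σ e₂; e₄ = :σ e₃; e₅ = :σ e₄ in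
      :- (e :* (e₅ :- e₁) :+ e₂ :* (e₁ :- e₃) :+ e₄ :* (e₃ :- e₅))
    :l e = let e₁ = :σ e; e₂ = :σ e₁; e₃ = :σ e₂; e₄ = :σ e₃; e₅ = :σ e₄ in
      :- (e :* e₃ :* (e₅ :- e₁) :+ e₂ :* e₅ :* (e₁ :- e₃) :+ e₄ :* e₁ :* (e₃ :- e₅))
    :m e = let e₁ = :σ e; e₂ = :σ e₁; e₃ = :σ e₂; e₄ = :σ e₃; e₅ = :σ e₄ in
      e₂ :* e₄ :* e₃ :* (e₅ :- e₁) :+ e₄ :* e :* e₅ :* (e₁ :- e₃) :+ e :* e₂ :* e₁ :* (e₃ :- e₅)

    -- Γ(e + τ) homogenised by s, hence a ternary quadratic form over F_q in the coordinates of τ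
    -- and s.
    Φ : Carrier → Carrier → Carrier
    Φ τ s = k * (τ * σ τ) + (l * τ - σ l * σ τ) * s + m * (s * s)

    :Φ : (e τ s : Expr) → Expr
    :Φ e τ s = :k e :* (τ :* :σ τ) :+ (:l e :* τ :- :σ (:l e) :* :σ τ) :* s :+ :m e :* (s :* s)

    Γ≈Φ : ∀ {τ} → Fixed² τ → Γ (e + τ) ≈ Φ τ 1#
    Γ≈Φ {τ} τ-fixed² = solve (⌜ e ⌝ ∷ ⌜ τ ∣² τ-fixed² ⌝ ∷ []) (λ e τ →
      let u = e :+ τ; u₁ = :σ u; u₂ = :σ u₁; u₃ = :σ u₂; u₄ = :σ u₃; u₅ = :σ u₄ in
      u₂ :* u₄ :* u₃ :* (u₅ :- u₁) :+ u₄ :* u :* u₅ :* (u₁ :- u₃) :+ u :* u₂ :* u₁ :* (u₃ :- u₅) := :Φ e τ :1) ≡.refl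

    Φ-anti : ∀ {τ s} → Fixed² τ → Fixed s → σ (Φ τ s) ≈ - Φ τ s
    Φ-anti {τ} {s} τ-fixed² s-fixed = solve (⌜ e ⌝ ∷ ⌜ τ ∣² τ-fixed² ⌝ ∷ ⌜ s ∣ s-fixed ⌝ ∷ []) (λ e τ s → :σ (:Φ e τ s) := :- :Φ e τ s) ≡.refl

    m-anti : σ m ≈ - m
    m-anti = solve (⌜ e ⌝ ∷ []) (λ e → :σ (:m e) := :- :m e) ≡.refl

    l-fixed² : Fixed² l
    l-fixed² = solve (⌜ e ⌝ ∷ []) (λ e → :σ (:σ (:l e)) := :l e) ≡.refl

    m-fixed² : Fixed² m
    m-fixed² = solve (⌜ e ⌝ ∷ []) (λ e → :σ (:σ (:m e)) := :m e) ≡.refl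

    found : ∀ {τ} → Fixed² τ → Φ τ 1# ≈ 0# → AlternatingSolution e
    found {τ} τ-fixed² Φ≈0 = record
      { τ = τ ; τ-fixed² = τ-fixed² ; u≉0 = u≉0 ; alternating = alternating-inverse u≉0 (trans (Γ≈Φ τ-fixed²) Φ≈0) }
      where
      u≉0 : ¬ e + τ ≈ 0#
      u≉0 u≈0 = e-not-fixed² (begin
        σ^ 2 e                     ≈⟨ solve (⌜ e ⌝ ∷ ⌜ τ ∣² τ-fixed² ⌝ ∷ []) (λ e τ → :σ (:σ e) := :σ (:σ (e :+ τ)) :- (e :+ τ) :+ e) ≡.refl ⟩
        σ^ 2 (e + τ) - (e + τ) + e   ≈⟨ +-congʳ (trans (+-cong (trans (σ-cong (trans (σ-cong u≈0) σ-0)) σ-0) (-‿cong u≈0)) (-‿inverseʳ 0#)) ⟩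
        0# + e                     ≈⟨ +-identityˡ e ⟩
        e                          ∎)

    -- Φ changes sign under σ; dividing it by ε gives values in F_q, as `conic-fixed²` demands.
    Ψ : Carrier → Carrier → Carrier
    Ψ τ s = quadratic 0# 0# (ε′ * m) (ε′ * k) (ε′ * l) (- (ε′ * σ l)) τ (σ τ) s

    Ψ≈ε′Φ : ∀ τ s → Ψ τ s ≈ ε′ * Φ τ s
    Ψ≈ε′Φ τ s = solve (⌜ ε′ ⌝ ∷ ⌜ k ⌝ ∷ ⌜ l ⌝ ∷ ⌜ m ⌝ ∷ ⌜ τ ⌝ ∷ ⌜ s ⌝ ∷ []) (λ e k l m τ s →
      let τ₁ = :σ τ in
      :0 :* (τ :* τ) :+ :0 :* (τ₁ :* τ₁) :+ e :* m :* (s :* s) :+ e :* k :* (τ :* τ₁) :+ e :* l :* (τ :* s) :+ (:- (e :* :σ l)) :* (τ₁ :* s)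
      := e :* (k :* (τ :* τ₁) :+ (l :* τ :- :σ l :* τ₁) :* s :+ m :* (s :* s))) ≡.refl

    Ψ-fixed : ∀ {τ s} → Fixed² τ → Fixed s → Fixed (Ψ τ s)
    Ψ-fixed {τ} {s} τ-fixed² s-fixed = begin
      σ (Ψ τ s)             ≈⟨ σ-cong (Ψ≈ε′Φ τ s) ⟩
      σ (ε′ * Φ τ s)        ≈⟨ trans (σ-* _ _) (*-cong σ-ε′ (Φ-anti τ-fixed² s-fixed)) ⟩
      - ε′ * - Φ τ s        ≈⟨ solve (⌜ ε′ ⌝ ∷ ⌜ Φ τ s ⌝ ∷ []) (λ e f → (:- e) :* (:- f) := e :* f) ≡.refl ⟩
      ε′ * Φ τ s            ≈⟨ Ψ≈ε′Φ τ s ⟨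
      Ψ τ s                 ∎

    d : Carrier
    d = e - σ^ 2 e

    d≉0 : ¬ d ≈ 0#
    d≉0 d≈0 = e-not-fixed² (sym (x-y≈0⇒x≈y d≈0))

    -- The combination l - σ³(e) k factors into conjugates of d = e - σ²(e), which is nonzero
    -- because e is not in F_{q²}.
    l≉0 : k ≈ 0# → ¬ l ≈ 0#
    l≉0 k≈0 l≈0 = *-≉0 (*-≉0 (σ-≉0 d≉0) (σ-≉0 (σ-≉0 d≉0))) (σ-≉0 (σ-≉0 (σ-≉0 d≉0))) (begin
      σ d * σ^ 2 d * σ^ 3 d     ≈⟨ solve (⌜ e ⌝ ∷ []) (λ e → let d = e :- :σ (:σ e); d₁ = :σ d; d₂ = :σ d₁; d₃ = :σ d₂ in
                                     d₁ :* d₂ :* d₃ := :l e :+ (:- :σ (:σ (:σ e))) :* :k e) ≡.refl ⟩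
      l + - e₃ * k              ≈⟨ +≈0 l≈0 (*≈0ʳ k≈0) ⟩
      0#                        ∎)

    finite-case : ∀ {τ s} → Fixed² τ → Fixed s → Φ τ s ≈ 0# → ¬ s ≈ 0# → AlternatingSolution e
    finite-case {τ} {s} τ-fixed² s-fixed Φ≈0 s≉0 = found {τ * s′} τs′-fixed² (begin
            Φ (τ * s′) 1#
              ≈⟨ +-cong (+-congˡ (*-congˡ (sym ss′≈1))) (*-congˡ (*-cong (sym ss′≈1) (sym ss′≈1))) ⟩
            k * (τ * s′ * σ (τ * s′)) + (l * (τ * s′) - σ l * σ (τ * s′)) * (s * s′) + m * (s * s′ * (s * s′))
              ≈⟨ solve (⌜ k ⌝ ∷ ⌜ l ⌝ ∷ ⌜ m ⌝ ∷ ⌜ τ ⌝ ∷ ⌜ s ⌝ ∷ ⌜ s′ ∣ fixed-inv s≉0 s-fixed ⌝ ∷ []) (λ k l m τ s s′ → let τ′ = τ :* s′ in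
                   k :* (τ′ :* :σ τ′) :+ (l :* τ′ :- :σ l :* :σ τ′) :* (s :* s′) :+ m :* (s :* s′ :* (s :* s′))
                   := s′ :* s′ :* (k :* (τ :* :σ τ) :+ (l :* τ :- :σ l :* :σ τ) :* s :+ m :* (s :* s))) ≡.refl ⟩
            s′ * s′ * Φ τ s
              ≈⟨ *≈0ʳ Φ≈0 ⟩
            0# ∎)
      where
      s′ = inv s≉0
      ss′≈1 : s * s′ ≈ 1#
      ss′≈1 = inv-right s≉0
      τs′-fixed² : Fixed² (τ * s′)
      τs′-fixed² = solve (⌜ τ ∣² τ-fixed² ⌝ ∷ ⌜ s′ ∣ fixed-inv s≉0 s-fixed ⌝ ∷ []) (λ τ s → :σ (:σ (τ :* s)) := τ :* s) ≡.refl

    -- A zero with s = 0 forces k = 0, so the equation for τ is the linear one l τ - σ(l τ) = -m. As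
    -- σ(m) = -m and ω + σ(ω) = 1, it is solved by l τ = -m ω.
    infinite-case : ∀ {τ s} → Φ τ s ≈ 0# → ¬ τ ≈ 0# → s ≈ 0# → AlternatingSolution e
    infinite-case {τ} {s} Φ≈0 τ≉0 s≈0 = found {τ₀} τ₀-fixed² (begin
            Φ τ₀ 1#
              ≈⟨ +-congʳ (trans (+-congʳ (*≈0ˡ k≈0)) (+-identityˡ _)) ⟩
            (l * τ₀ - σ l * σ τ₀) * 1# + m * (1# * 1#)
              ≈⟨ solve (⌜ l ⌝ ∷ ⌜ l′ ⌝ ∷ ⌜ m ⌝ ∷ ⌜ ω ⌝ ∷ []) (λ l l′ m ω → let n = l :* l′; τ = :- (m :* ω :* l′) in
                   (l :* τ :- :σ l :* :σ τ) :* :1 :+ m :* (:1 :* :1) := m :- n :* m :* ω :+ :σ n :* :σ m :* :σ ω) ≡.refl ⟩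
            m - l * l′ * m * ω + σ (l * l′) * σ m * σ ω
              ≈⟨ +-cong (+-congˡ (-‿cong (*-congʳ (trans (*-congʳ ll′≈1) (*-identityˡ m)))))
                   (*-congʳ (trans (*-cong (trans (σ-cong ll′≈1) σ-1) m-anti) (*-identityˡ _))) ⟩
            m - m * ω + - m * σ ω
              ≈⟨ solve (⌜ m ⌝ ∷ ⌜ ω ⌝ ∷ []) (λ m ω → m :- m :* ω :+ :- m :* :σ ω := m :* (:1 :- (ω :+ :σ ω))) ≡.refl ⟩
            m * (1# - (ω + σ ω))
              ≈⟨ *≈0ʳ (x≈y⇒x-y≈0 (sym ω+σω≈1)) ⟩
            0# ∎)
      where
      k≈0 : k ≈ 0#
      k≈0 = *-cancel (*-≉0 τ≉0 (σ-≉0 τ≉0)) (trans (*-comm _ k) (trans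
        (sym (trans (+-cong (+-dropʳ (*≈0ʳ s≈0)) (*≈0ʳ (*≈0ʳ s≈0))) (+-identityʳ _))) Φ≈0))

      l≉ : ¬ l ≈ 0#
      l≉ = l≉0 k≈0
      l′ τ₀ : Carrier
      l′ = inv l≉
      τ₀ = - (m * ω * l′)
      ll′≈1 : l * l′ ≈ 1#
      ll′≈1 = inv-right l≉
      τ₀-fixed² : Fixed² τ₀
      τ₀-fixed² = solve (⌜ m ∣² m-fixed² ⌝ ∷ ⌜ ω ∣² ω-fixed² ⌝ ∷ ⌜ l′ ∣² fixed²-inv l≉ l-fixed² ⌝ ∷ [])
        (λ m ω l → let t = :- (m :* ω :* l) in :σ (:σ t) := t) ≡.refl

    irrational-solution : AlternatingSolution e
    irrational-solution = by-cases (s ≟ 0#)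
      where
      zero-of-Ψ = conic-fixed² 0# 0# (ε′ * m) (ε′ * k) (ε′ * l) (- (ε′ * σ l)) Ψ-fixed
      τ s : Carrier
      τ = proj₁ zero-of-Ψ
      s = proj₁ (proj₂ zero-of-Ψ)

      facts : Fixed² τ × Fixed s × ¬ (τ ≈ 0# × s ≈ 0#) × Ψ τ s ≈ 0#
      facts = proj₂ (proj₂ zero-of-Ψ)

      Φ≈0 : Φ τ s ≈ 0#
      Φ≈0 = *-cancel (inv-≉0 ε≉0) (trans (sym (Ψ≈ε′Φ τ s)) (proj₂ (proj₂ (proj₂ facts))))

      by-cases : Dec (s ≈ 0#) → AlternatingSolution e
      by-cases (no  s≉0) = finite-case (proj₁ facts) (proj₁ (proj₂ facts)) Φ≈0 s≉0
      by-cases (yes s≈0) = infinite-case {τ} {s} Φ≈0 (λ τ≈0 → proj₁ (proj₂ (proj₂ facts)) (τ≈0 , s≈0)) s≈0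

  alternating-solution : ∀ e → AlternatingSolution e
  alternating-solution e = by-cases (σ^ 2 e ≟ e)
    where
    by-cases : Dec (Fixed² e) → AlternatingSolution e
    by-cases (yes e-fixed²)     = rational-solution e-fixed²
    by-cases (no  e-not-fixed²) = Irrational.irrational-solution e-not-fixed²

  -- Nondegeneracy of h over F_{q²}: a coordinate vector pairs with V to give a chosen nonzero
  -- coordinate up to sign. Its entry carries a σ because h applies another one, and σ² is trivial
  -- on F_{q²}.
  dual-vector : ∀ {V} → Rational V → NonZero V → ∃ λ R → Rational R × h V R ≈ 1#
  dual-vector {V} (x , y , z) V≉0 = [ case-X , [ case-Y , case-Z ]′ ]′ (nonzero-coordinate V≉0)
    where
    σσ : ∀ {a} → Fixed² a → (a≉0 : ¬ a ≈ 0#) → Fixed² (σ (inv a≉0))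
    σσ a-fixed² a≉0 = σ-cong (fixed²-inv a≉0 a-fixed²)

    σσ0 : Fixed² 0#
    σσ0 = trans (σ-cong σ-0) σ-0

    σσ- : ∀ {a} → Fixed² a → Fixed² (- a)
    σσ- a-fixed² = trans (σ-cong (σ-- _)) (trans (σ-- _) (-‿cong a-fixed²))

    case-X : ¬ X V ≈ 0# → _
    case-X a≉0 = ⟨ σ (inv a≉0) , 0# , 0# ⟩ , (σσ x a≉0 , σσ0 , σσ0) , trans
      (solve (⌜ X V ∣² x ⌝ ∷ ⌜ Y V ⌝ ∷ ⌜ Z V ⌝ ∷ ⌜ inv a≉0 ∣² fixed²-inv a≉0 x ⌝ ∷ []) (λ a b c i →
        a :* :σ (:σ i) :- (b :* :σ :0 :+ c :* :σ :0) := a :* i) ≡.refl) (inv-right a≉0)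

    case-Y : ¬ Y V ≈ 0# → _
    case-Y b≉0 = ⟨ 0# , 0# , - σ (inv b≉0) ⟩ , (σσ0 , σσ0 , σσ- (σσ y b≉0)) , trans
      (solve (⌜ X V ⌝ ∷ ⌜ Y V ⌝ ∷ ⌜ Z V ⌝ ∷ ⌜ inv b≉0 ∣² fixed²-inv b≉0 y ⌝ ∷ []) (λ a b c i →
        a :* :σ :0 :- (b :* :σ (:- :σ i) :+ c :* :σ :0) := b :* i) ≡.refl) (inv-right b≉0)

    case-Z : ¬ Z V ≈ 0# → _
    case-Z c≉0 = ⟨ 0# , - σ (inv c≉0) , 0# ⟩ , (σσ0 , σσ- (σσ z c≉0) , σσ0) , trans
      (solve (⌜ X V ⌝ ∷ ⌜ Y V ⌝ ∷ ⌜ Z V ⌝ ∷ ⌜ inv c≉0 ∣² fixed²-inv c≉0 z ⌝ ∷ []) (λ a b c i →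
        a :* :σ :0 :- (b :* :σ :0 :+ c :* :σ (:- :σ i)) := c :* i) ≡.refl) (inv-right c≉0)

-- A split line through every point off the curve

module Completeness {c ℓ} (F : Field c ℓ) {q : ℕ} (q-primePower : IsPrimePower q)
                    (card : FieldTheory.HasCard F (q ℕ.^ 6)) where
  open SpecialNorm F q-primePower card public
  open SetoidReasoning setoid

  -- The line is the tangent at V, so h(P,V) = 0 and V cannot serve as R. Another rational point is
  -- built from a vector R′ with h(V,R′) = 1: adding a multiple of W adjusts h(P,R) by any τ in
  -- F_{q²}, and adding a multiple of V then puts R on the curve without changing h(P,R).
  tangent-split : ∀ {W V α} → Rational W → Rational V → NonZero V → h V V ≈ 0# → h W V ≈ 0# → ¬ h W W ≈ 0# →
                  Splits (1# · W ⊕ α · V)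
  tangent-split {W} {V} {α} W-rational V-rational V≉0 hVV≈0 hWV≈0 m≉0 =
    rational-split {g = ε′ * (m * z)} R-rational hRR≈0 w≉0 g-eq Trg≈0
    where
    m κ ρ : Carrier
    m = h W W
    R′ S R P : Triple
    R′ = proj₁ (dual-vector V-rational V≉0)
    κ = h W R′
    open AlternatingSolution (alternating-solution (α + κ))

    u u′ z m′ x y : Carrier
    u = α + κ + τ
    u′ = inv u≉0
    z = u′ * σ u′
    m′ = inv m≉0
    -- Chosen so that h(W, x W) = σ(x) m = τ, since σ² fixes τ/m.
    x = σ (τ * m′)
    S = 1# · R′ ⊕ x · W
    ρ = h S S
    -- Since h(S,V) = h(V,S) = 1, isotropy of S + y V reads ρ + y + σ(y) = 0, and ω has trace 1.
    y = - (ω * ρ)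
    R = 1# · S ⊕ y · V
    P = 1# · W ⊕ α · V

    m-fixed : Fixed m
    m-fixed = rational-h W-rational

    R′-rational : Rational R′
    R′-rational = proj₁ (proj₂ (dual-vector V-rational V≉0))

    1-fixed² : Fixed² 1#
    1-fixed² = trans (σ-cong σ-1) σ-1

    τm′-fixed² : Fixed² (τ * m′)
    τm′-fixed² = solve (⌜ τ ∣² τ-fixed² ⌝ ∷ ⌜ m′ ∣ fixed-inv m≉0 m-fixed ⌝ ∷ []) (λ t m → :σ (:σ (t :* m)) := t :* m) ≡.refl

    S-rational : Rational S
    S-rational = rational-combination R′-rational W-rational 1-fixed² (σ-cong τm′-fixed²)

    ρ-fixed : Fixed ρ
    ρ-fixed = rational-h S-rational

    R-rational : Rational R
    R-rational = rational-combination S-rational V-rational 1-fixed²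
      (solve (⌜ ω ∣² ω-fixed² ⌝ ∷ ⌜ ρ ∣ ρ-fixed ⌝ ∷ []) (λ w r → let y = :- (w :* r) in :σ (:σ y) := y) ≡.refl)

    hVR′≈1 : h V R′ ≈ 1#
    hVR′≈1 = proj₂ (proj₂ (dual-vector V-rational V≉0))

    hVW≈0 : h V W ≈ 0#
    hVW≈0 = trans (sym (rational-h V-rational)) (trans (σ-cong hWV≈0) σ-0)

    hVS≈1 : h V S ≈ 1#
    hVS≈1 = trans (h-⊕ʳ _ _ _) (trans (+-cong (trans (h-·ʳ 1# V R′) (trans (*-cong σ-1 hVR′≈1) (*-identityˡ 1#)))
      (trans (h-·ʳ x V W) (*≈0ʳ hVW≈0))) (+-identityʳ 1#))

    hSV≈1 : h S V ≈ 1#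
    hSV≈1 = trans (sym (rational-h S-rational)) (trans (σ-cong hVS≈1) σ-1)

    hRR≈0 : h R R ≈ 0#
    hRR≈0 = begin
      h R R
        ≈⟨ h-combination 1# S y V 1# S y V ⟩
      (1# * σ 1# * ρ + 1# * σ y * h S V) + (y * σ 1# * h V S + y * σ y * h V V)
        ≈⟨ +-cong (+-congˡ (*-congˡ hSV≈1)) (+-cong (*-congˡ hVS≈1) (*-congˡ hVV≈0)) ⟩
      (1# * σ 1# * ρ + 1# * σ y * 1#) + (y * σ 1# * 1# + y * σ y * 0#)
        ≈⟨ solve (⌜ ω ⌝ ∷ ⌜ ρ ∣ ρ-fixed ⌝ ∷ []) (λ w r → let y = :- (w :* r) in
             (:1 :* :σ :1 :* r :+ :1 :* :σ y :* :1) :+ (y :* :σ :1 :* :1 :+ y :* :σ y :* :0) := r :* (:1 :- (w :+ :σ w))) ≡.refl ⟩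
      ρ * (1# - (ω + σ ω))
        ≈⟨ *≈0ʳ (x≈y⇒x-y≈0 (sym ω+σω≈1)) ⟩
      0# ∎

    hWS : h W S ≈ κ + τ
    hWS = begin
      h W S
        ≈⟨ h-⊕ʳ W (1# · R′) (x · W) ⟩
      h W (1# · R′) + h W (x · W)
        ≈⟨ +-cong (trans (h-·ʳ 1# W R′) (trans (*-congʳ σ-1) (*-identityˡ κ))) (trans (h-·ʳ x W W) (*-congʳ τm′-fixed²)) ⟩
      κ + τ * m′ * m
        ≈⟨ +-congˡ (trans (*-assoc τ m′ m) (trans (*-congˡ (inv-left m≉0)) (*-identityʳ τ))) ⟩
      κ + τ ∎

    w≈u : h P R ≈ u
    w≈u = begin
      h P R
        ≈⟨ h-combination 1# W α V 1# S y V ⟩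
      (1# * σ 1# * h W S + 1# * σ y * h W V) + (α * σ 1# * h V S + α * σ y * h V V)
        ≈⟨ +-cong (+-cong (*-congˡ hWS) (*-congˡ hWV≈0)) (+-cong (*-congˡ hVS≈1) (*-congˡ hVV≈0)) ⟩
      (1# * σ 1# * (κ + τ) + 1# * σ y * 0#) + (α * σ 1# * 1# + α * σ y * 0#)
        ≈⟨ solve (⌜ κ ⌝ ∷ ⌜ τ ⌝ ∷ ⌜ y ⌝ ∷ ⌜ α ⌝ ∷ []) (λ k t y a →
             (:1 :* :σ :1 :* (k :+ t) :+ :1 :* :σ y :* :0) :+ (a :* :σ :1 :* :1 :+ a :* :σ y :* :0) := a :+ k :+ t) ≡.refl ⟩
      u ∎

    w≉0 : ¬ h P R ≈ 0#
    w≉0 w≈0 = u≉0 (trans (sym w≈u) w≈0)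

    hPP : h P P ≈ m
    hPP = begin
      h P P
        ≈⟨ h-combination 1# W α V 1# W α V ⟩
      (1# * σ 1# * m + 1# * σ α * h W V) + (α * σ 1# * h V W + α * σ α * h V V)
        ≈⟨ +-cong (+-cong (*-congʳ (trans (*-identityˡ _) σ-1)) (*≈0ʳ hWV≈0)) (+≈0 (*≈0ʳ hVW≈0) (*≈0ʳ hVV≈0)) ⟩
      (1# * m + 0#) + 0#
        ≈⟨ trans (+-identityʳ _) (trans (+-identityʳ _) (*-identityˡ m)) ⟩
      m ∎

    g-eq : ε′ * (m * z) * (ε * (h P R * σ (h P R))) ≈ h P P
    g-eq = begin
      ε′ * (m * z) * (ε * (h P R * σ (h P R)))
        ≈⟨ *-congˡ (*-congˡ (*-cong w≈u (σ-cong w≈u))) ⟩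
      ε′ * (m * z) * (ε * (u * σ u))
        ≈⟨ solve (⌜ ε′ ⌝ ∷ ⌜ m ⌝ ∷ ⌜ u′ ⌝ ∷ ⌜ ε ⌝ ∷ ⌜ u ⌝ ∷ []) (λ e′ m u′ e u →
             e′ :* (m :* (u′ :* :σ u′)) :* (e :* (u :* :σ u)) := (e :* e′) :* ((u :* u′) :* :σ (u :* u′)) :* m) ≡.refl ⟩
      ε * ε′ * (u * u′ * σ (u * u′)) * m
        ≈⟨ *-congʳ (trans (*-cong (inv-right ε≉0) (trans (*-cong uu′≈1 (trans (σ-cong uu′≈1) σ-1)) (*-identityˡ 1#))) (*-identityˡ 1#)) ⟩
      1# * m
        ≈⟨ trans (*-identityˡ m) (sym hPP) ⟩
      h P P ∎
      where
      uu′≈1 : u * u′ ≈ 1#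
      uu′≈1 = inv-right u≉0

    Trg≈0 : Tr (ε′ * (m * z)) ≈ 0#
    Trg≈0 = trans (Tr-ε′ (m * z)) (*≈0ʳ (trans
      (solve (⌜ m ∣ m-fixed ⌝ ∷ ⌜ z ⌝ ∷ []) (λ m z →
        let a = λ y → let y₁ = :σ y; y₂ = :σ y₁; y₃ = :σ y₂; y₄ = :σ y₃; y₅ = :σ y₄ in y :- y₁ :+ y₂ :- y₃ :+ y₄ :- y₅ in
        a (m :* z) := m :* a z) ≡.refl) (*≈0ʳ alternating)))

  splits-resp : ∀ {P Q} → P ≋ Q → Splits Q → Splits P
  splits-resp P≋Q (A , B , split , s , t , Q≋) = A , B , split , s , t , ≋-trans P≋Q Q≋

  splits-scale : ∀ β {Q} → Splits Q → Splits (β · Q)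
  splits-scale β (A , B , split , s , t , (x , y , z)) = A , B , split , β * s , β * t , (go x , go y , go z)
    where
    go : ∀ {p a b} → p ≈ s * a + t * b → β * p ≈ β * s * a + β * t * b
    go {p} {a} {b} eq = trans (*-congˡ eq) (solve (⌜ β ⌝ ∷ ⌜ s ⌝ ∷ ⌜ t ⌝ ∷ ⌜ a ⌝ ∷ ⌜ b ⌝ ∷ [])
      (λ β s t a b → β :* (s :* a :+ t :* b) := β :* s :* a :+ β :* t :* b) ≡.refl)

  -- The coefficient of W is nonzero because P is not isotropic, and can be scaled to 1. The two
  -- cases are whether the line of W and V is the tangent at V; if it is, h(W,W) = 0 would make P
  -- isotropic.
  line-split : ∀ {P W V β γ} → ¬ h P P ≈ 0# → Rational W → Rational V → NonZero V → h V V ≈ 0# →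
               P ≋ β · W ⊕ γ · V → Splits P
  line-split {P} {W} {V} {β} {γ} a≉0 W-rational V-rational V≉0 hVV≈0 P≋ =
    splits-resp P≋βQ (splits-scale β (by-cases (h W V ≟ 0#)))
    where
    γV-isotropic : h (γ · V) (γ · V) ≈ 0#
    γV-isotropic = trans (h-·· γ γ V V) (*≈0ʳ hVV≈0)

    β≉0 : ¬ β ≈ 0#
    β≉0 β≈0 = a≉0 (trans (h-cong P≋γV P≋γV) γV-isotropic)
      where
      P≋γV : P ≋ γ · V
      P≋γV = ≋-trans P≋ (+-dropˡ (*≈0ˡ β≈0) , +-dropˡ (*≈0ˡ β≈0) , +-dropˡ (*≈0ˡ β≈0))

    α : Carrier
    α = inv β≉0 * γ
    Q : Triple
    Q = 1# · W ⊕ α · V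

    P≋βQ : P ≋ β · Q
    P≋βQ = let x , y , z = P≋ in go x , go y , go z
      where
      go : ∀ {p w v} → p ≈ β * w + γ * v → p ≈ β * (1# * w + α * v)
      go {p} {w} {v} eq = trans eq (trans (+-congˡ (*-congʳ (sym (trans (*-congʳ (inv-right β≉0)) (*-identityˡ γ)))))
        (solve (⌜ β ⌝ ∷ ⌜ w ⌝ ∷ ⌜ inv β≉0 ⌝ ∷ ⌜ γ ⌝ ∷ ⌜ v ⌝ ∷ []) (λ β w i γ v →
          β :* w :+ β :* i :* γ :* v := β :* (:1 :* w :+ i :* γ :* v)) ≡.refl))

    by-cases : Dec (h W V ≈ 0#) → Splits Q
    by-cases (no  v≉0) = hyperbolic-split W-rational V-rational hVV≈0 v≉0
    by-cases (yes v≈0) = tangent-split W-rational V-rational V≉0 hVV≈0 v≈0 λ m≈0 → a≉0 (trans (h-cong P≋ P≋)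
      (trans (h-combination β W γ V β W γ V) (+≈0 (+≈0 (*≈0ʳ m≈0) (*≈0ʳ v≈0))
        (+≈0 (*≈0ʳ (trans (sym (rational-h V-rational)) (trans (σ-cong v≈0) σ-0))) (*≈0ʳ hVV≈0)))))

  -- Every line over F_{q²} has a rational point V on the curve: with the coefficient of N
  -- restricted to F_q, the Hermitian form becomes a ternary quadratic form. V is then completed to
  -- a basis by M or by N, according to whether that coefficient is nonzero.
  plane-split : ∀ {P M N s t} → ¬ h P P ≈ 0# → Rational M → Rational N → Independent M N →
                P ≋ s · M ⊕ t · N → Splits P
  plane-split {P} {M} {N} {s} {t} a≉0 M-rational N-rational independent P≋ = by-cases (y ≟ 0#)
    where
    h-V : ∀ {x y} → Fixed y → h (x · M ⊕ y · N) (x · M ⊕ y · N) ≈ quadratic 0# 0# (h N N) (h M M) (h M N) (h N M) x (σ x) y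
    h-V {x} {y} y-fixed = trans (h-combination x M y N x M y N)
      (solve (⌜ x ⌝ ∷ ⌜ y ∣ y-fixed ⌝ ∷ ⌜ h M M ⌝ ∷ ⌜ h M N ⌝ ∷ ⌜ h N M ⌝ ∷ ⌜ h N N ⌝ ∷ []) (λ x y a b c d →
        (x :* :σ x :* a :+ x :* :σ y :* b) :+ (y :* :σ x :* c :+ y :* :σ y :* d)
        := :0 :* (x :* x) :+ :0 :* (:σ x :* :σ x) :+ d :* (y :* y) :+ a :* (x :* :σ x) :+ b :* (x :* y) :+ c :* (:σ x :* y)) ≡.refl)

    fixed⇒fixed² : ∀ {y} → Fixed y → Fixed² y
    fixed⇒fixed² y-fixed = trans (σ-cong y-fixed) y-fixed

    solution = conic-fixed² 0# 0# (h N N) (h M M) (h M N) (h N M) λ x-fixed² y-fixed →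
      trans (σ-cong (sym (h-V y-fixed))) (trans (rational-h (rational-combination M-rational N-rational x-fixed² (fixed⇒fixed² y-fixed))) (h-V y-fixed))

    x y : Carrier
    x = proj₁ solution
    y = proj₁ (proj₂ solution)

    facts : Fixed² x × Fixed y × ¬ (x ≈ 0# × y ≈ 0#) × quadratic 0# 0# (h N N) (h M M) (h M N) (h N M) x (σ x) y ≈ 0#
    facts = proj₂ (proj₂ solution)

    V : Triple
    V = x · M ⊕ y · N

    V-rational : Rational V
    V-rational = rational-combination M-rational N-rational (proj₁ facts) (fixed⇒fixed² (proj₁ (proj₂ facts)))

    V≉0 : NonZero V
    V≉0 V≋0 = proj₁ (proj₂ (proj₂ facts)) (independent x y V≋0)

    hVV≈0 : h V V ≈ 0#
    hVV≈0 = trans (h-V (proj₁ (proj₂ facts))) (proj₂ (proj₂ (proj₂ facts)))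

    by-cases : Dec (y ≈ 0#) → Splits P
    by-cases (no y≉0) = line-split a≉0 M-rational V-rational V≉0 hVV≈0 (let p , q , r = P≋ in go p , go q , go r)
      where
      i = inv y≉0
      go : ∀ {p m n} → p ≈ s * m + t * n → p ≈ (s - t * i * x) * m + t * i * (x * m + y * n)
      go {p} {m} {n} eq = trans eq (trans (+-congˡ (*-congʳ (sym (trans (*-congˡ (inv-right y≉0)) (*-identityʳ t)))))
        (solve (⌜ s ⌝ ∷ ⌜ t ⌝ ∷ ⌜ m ⌝ ∷ ⌜ n ⌝ ∷ ⌜ x ⌝ ∷ ⌜ y ⌝ ∷ ⌜ i ⌝ ∷ []) (λ s t m n x y i →
          s :* m :+ t :* (y :* i) :* n := (s :- t :* i :* x) :* m :+ t :* i :* (x :* m :+ y :* n)) ≡.refl))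
    by-cases (yes y≈0) = line-split a≉0 N-rational V-rational V≉0 hVV≈0 (let p , q , r = P≋ in go p , go q , go r)
      where
      x≉0 : ¬ x ≈ 0#
      x≉0 x≈0 = proj₁ (proj₂ (proj₂ facts)) (x≈0 , y≈0)
      i = inv x≉0
      go : ∀ {p m n} → p ≈ s * m + t * n → p ≈ t * n + s * i * (x * m + y * n)
      go {p} {m} {n} eq = trans eq (trans (+-congʳ (*-congʳ (sym (trans (*-congˡ (inv-right x≉0)) (*-identityʳ s)))))
        (trans (solve (⌜ s ⌝ ∷ ⌜ t ⌝ ∷ ⌜ m ⌝ ∷ ⌜ n ⌝ ∷ ⌜ x ⌝ ∷ ⌜ i ⌝ ∷ []) (λ s t m n x i →
          s :* (x :* i) :* m :+ t :* n := t :* n :+ s :* i :* (x :* m :+ :0)) ≡.refl)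
        (+-congˡ (*-congˡ (+-congˡ (sym (*≈0ˡ y≈0)))))))

  -- Points with linearly dependent conjugates

  -- If φ multiplies A by a scalar, dividing by a nonzero coordinate, which φ multiplies by the same
  -- scalar, gives a vector fixed by φ.
  rationalise : ∀ {A s} → NonZero A → φ A ≋ s · A → ∃ λ c → ∃ λ n → Rational n × A ≋ c · n × ¬ c ≈ 0#
  rationalise {A} {s} A≉0 (x , y , z) = [ (λ X≉0 → go X≉0 x) , [ (λ Y≉0 → go Y≉0 y) , (λ Z≉0 → go Z≉0 z) ]′ ]′ (nonzero-coordinate A≉0)
    where
    go : ∀ {c} → ¬ c ≈ 0# → σ^ 2 c ≈ s * c → ∃ λ c → ∃ λ n → Rational n × A ≋ c · n × ¬ c ≈ 0#
    go {c} c≉0 eq = c , i · A , (rational x , rational y , rational z) , (undo , undo , undo) , c≉0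
      where
      i = inv c≉0
      undo : ∀ {a} → a ≈ c * (i * a)
      undo = sym (trans (sym (*-assoc _ _ _)) (trans (*-congʳ (inv-right c≉0)) (*-identityˡ _)))

      σσi : σ^ 2 i * s ≈ i
      σσi = *-cancelˡ c≉0 (begin
        c * (σ^ 2 i * s)         ≈⟨ solve (⌜ c ⌝ ∷ ⌜ i ⌝ ∷ ⌜ s ⌝ ∷ []) (λ c i s → c :* (:σ (:σ i) :* s) := :σ (:σ i) :* (s :* c)) ≡.refl ⟩
        σ^ 2 i * (s * c)         ≈⟨ *-congˡ eq ⟨
        σ^ 2 i * σ^ 2 c          ≈⟨ trans (*-comm _ _) (trans (sym (σ-* _ _)) (trans (σ-cong (σ-inv c≉0)) σ-1)) ⟩
        1#                       ≈⟨ inv-right c≉0 ⟨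
        c * i                    ∎)

      rational : ∀ {a} → σ^ 2 a ≈ s * a → Fixed² (i * a)
      rational {a} a-eq = begin
        σ^ 2 (i * a)             ≈⟨ trans (σ-cong (σ-* i a)) (σ-* _ _) ⟩
        σ^ 2 i * σ^ 2 a          ≈⟨ *-congˡ a-eq ⟩
        σ^ 2 i * (s * a)         ≈⟨ *-assoc _ _ _ ⟨
        σ^ 2 i * s * a           ≈⟨ *-congʳ σσi ⟩
        i * a                    ∎

  record RationalPlane (P : Triple) : Set (c ⊔ ℓ) where
    field
      {M N}       : Triple
      {s t}       : Carrier
      M-rational  : Rational M
      N-rational  : Rational N
      independent : Independent M N
      P≋          : P ≋ s · M ⊕ t · N

  rational-plane-Z : ∀ {n P} → Rational n → n • P ≈ 0# → ¬ Z n ≈ 0# → RationalPlane P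
  rational-plane-Z {n} {P} (x , y , z) n•P≈0 Z≉0 = record
    { M = ⟨ 1# , 0# , - (X n * i) ⟩ ; N = ⟨ 0# , 1# , - (Y n * i) ⟩ ; s = X P ; t = Y P
    ; M-rational = 1-fixed² , 0-fixed² , ratio x ; N-rational = 0-fixed² , 1-fixed² , ratio y
    ; independent = λ s t (p , q , _) →
        trans (sym (trans (+-dropʳ (zeroʳ t)) (*-identityʳ s))) p , trans (sym (trans (+-dropˡ (zeroʳ s)) (*-identityʳ t))) q
    ; P≋ = sym (trans (+-dropʳ (zeroʳ _)) (*-identityʳ _)) , sym (trans (+-dropˡ (zeroʳ _)) (*-identityʳ _)) , third }
    where
    i : Carrier
    i = inv Z≉0

    1-fixed² : Fixed² 1#
    1-fixed² = trans (σ-cong σ-1) σ-1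
    0-fixed² : Fixed² 0#
    0-fixed² = trans (σ-cong σ-0) σ-0

    ratio : ∀ {a} → Fixed² a → Fixed² (- (a * i))
    ratio {a} a-fixed² = solve (⌜ a ∣² a-fixed² ⌝ ∷ ⌜ i ∣² fixed²-inv Z≉0 z ⌝ ∷ []) (λ a i → :σ (:σ (:- (a :* i))) := :- (a :* i)) ≡.refl

    third : Z P ≈ X P * - (X n * i) + Y P * - (Y n * i)
    third = sym (begin
      X P * - (X n * i) + Y P * - (Y n * i)
        ≈⟨ solve (⌜ X P ⌝ ∷ ⌜ Y P ⌝ ∷ ⌜ Z P ⌝ ∷ ⌜ X n ⌝ ∷ ⌜ Y n ⌝ ∷ ⌜ Z n ⌝ ∷ ⌜ i ⌝ ∷ []) (λ a b c x y z i →
             a :* :- (x :* i) :+ b :* :- (y :* i) := z :* i :* c :- i :* (x :* a :+ y :* b :+ z :* c)) ≡.refl ⟩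
      Z n * i * Z P - i * (n • P)
        ≈⟨ +-cong (trans (*-congʳ (inv-right Z≉0)) (*-identityˡ _)) (-‿cong (*≈0ʳ n•P≈0)) ⟩
      Z P - 0#
        ≈⟨ solve (⌜ Z P ⌝ ∷ []) (λ z → z :- :0 := z) ≡.refl ⟩
      Z P ∎)

  rotate-plane : ∀ {P} → RationalPlane (rotate P) → RationalPlane P
  rotate-plane record { M-rational = (mx , my , mz) ; N-rational = (nx , ny , nz) ; independent = independent ; P≋ = (y , z , x) } = record
    { M = rotate (rotate _) ; N = rotate (rotate _) ; M-rational = mz , mx , my ; N-rational = nz , nx , ny
    ; independent = λ s t (p , q , r) → independent s t (q , r , p) ; P≋ = x , y , z }

  rational-plane : ∀ {n P} → Rational n → NonZero n → n • P ≈ 0# → RationalPlane P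
  rational-plane {n} {P} n-rational@(x , y , z) n≉0 n•P≈0 = [ case-X , [ case-Y , rational-plane-Z n-rational n•P≈0 ]′ ]′ (nonzero-coordinate n≉0)
    where
    case-X : ¬ X n ≈ 0# → RationalPlane P
    case-X X≉0 = rotate-plane (rational-plane-Z {rotate n} {rotate P} (y , z , x)
      (trans (trans (+-comm _ _) (sym (+-assoc _ _ _))) n•P≈0) X≉0)

    case-Y : ¬ Y n ≈ 0# → RationalPlane P
    case-Y Y≉0 = rotate-plane (rotate-plane (rational-plane-Z {rotate (rotate n)} {rotate (rotate P)} (z , x , y)
      (trans (trans (+-assoc _ _ _) (+-comm _ _)) n•P≈0) Y≉0))

  Δ : Triple → Carrier
  Δ P = P • (φ P ⊗ φ (φ P))

  triple-product : ∀ A B C → (A ⊗ B) ⊗ (B ⊗ C) ≋ (A • (B ⊗ C)) · B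
  triple-product ⟨ a , b , c ⟩ ⟨ d , e , f ⟩ ⟨ u , v , w ⟩ =
    solve vars (λ a b c d e f u v w → (c :* d :- a :* f) :* (d :* v :- e :* u) :- (a :* e :- b :* d) :* (f :* u :- d :* w)
      := (a :* (e :* w :- f :* v) :+ b :* (f :* u :- d :* w) :+ c :* (d :* v :- e :* u)) :* d) ≡.refl ,
    solve vars (λ a b c d e f u v w → (a :* e :- b :* d) :* (e :* w :- f :* v) :- (b :* f :- c :* e) :* (d :* v :- e :* u)
      := (a :* (e :* w :- f :* v) :+ b :* (f :* u :- d :* w) :+ c :* (d :* v :- e :* u)) :* e) ≡.refl ,
    solve vars (λ a b c d e f u v w → (b :* f :- c :* e) :* (f :* u :- d :* w) :- (c :* d :- a :* f) :* (e :* w :- f :* v)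
      := (a :* (e :* w :- f :* v) :+ b :* (f :* u :- d :* w) :+ c :* (d :* v :- e :* u)) :* f) ≡.refl
    where vars = ⌜ a ⌝ ∷ ⌜ b ⌝ ∷ ⌜ c ⌝ ∷ ⌜ d ⌝ ∷ ⌜ e ⌝ ∷ ⌜ f ⌝ ∷ ⌜ u ⌝ ∷ ⌜ v ⌝ ∷ ⌜ w ⌝ ∷ []

  φ-⊗ : ∀ A B → φ (A ⊗ B) ≋ φ A ⊗ φ B
  φ-⊗ A B = minor , minor , minor
    where
    minor : ∀ {a b c d} → σ^ 2 (a * b - c * d) ≈ σ^ 2 a * σ^ 2 b - σ^ 2 c * σ^ 2 d
    minor {a} {b} {c} {d} = solve (⌜ a ⌝ ∷ ⌜ b ⌝ ∷ ⌜ c ⌝ ∷ ⌜ d ⌝ ∷ []) (λ a b c d → let s2 = λ x → :σ (:σ x) in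
      s2 (a :* b :- c :* d) := s2 a :* s2 b :- s2 c :* s2 d) ≡.refl

  -- The line N through P and φ(P) satisfies N ⊗ φ(N) = Δ φ(P) = 0, so if N is nonzero it is
  -- rational up to a scalar, and `plane-split` applies. If N is zero, P itself is rational up to a
  -- scalar and is joined to the rational point (0 : 1 : 0) of the curve.
  dependent-split : ∀ {P} → NonZero P → ¬ h P P ≈ 0# → Δ P ≈ 0# → Splits P
  dependent-split {P} P≉0 a≉0 Δ≈0 = by-cases (X N ≟ 0#) (Y N ≟ 0#) (Z N ≟ 0#)
    where
    N : Triple
    N = P ⊗ φ P

    rank-two : NonZero N → Splits P
    rank-two N≉0 =
      let s , φN≋sN = ⊗≈0⇒proportional N≉0 N⊗φN≋0
          c , n , n-rational , N≋cn , c≉0 = rationalise N≉0 φN≋sN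
          open RationalPlane (rational-plane {n} {P} n-rational (n≉0 N≋cn) (n•P≈0 N≋cn c≉0))
      in plane-split a≉0 M-rational N-rational independent P≋
      where
      N⊗φN≋0 : N ⊗ φ N ≋ 𝟎
      N⊗φN≋0 = ≋-trans (⊗-congʳ (φ-⊗ P (φ P))) (≋-trans (triple-product P (φ P) (φ (φ P))) (*≈0ˡ Δ≈0 , *≈0ˡ Δ≈0 , *≈0ˡ Δ≈0))
        where
        ⊗-congʳ : ∀ {A B B′} → B ≋ B′ → A ⊗ B ≋ A ⊗ B′
        ⊗-congʳ (x , y , z) = +-cong (*-congˡ z) (-‿cong (*-congˡ y)) , +-cong (*-congˡ x) (-‿cong (*-congˡ z)) , +-cong (*-congˡ y) (-‿cong (*-congˡ x))

      n≉0 : ∀ {c n} → N ≋ c · n → NonZero n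
      n≉0 (x , y , z) (x≈0 , y≈0 , z≈0) = N≉0 (trans x (*≈0ʳ x≈0) , trans y (*≈0ʳ y≈0) , trans z (*≈0ʳ z≈0))

      n•P≈0 : ∀ {c n} → N ≋ c · n → ¬ c ≈ 0# → n • P ≈ 0#
      n•P≈0 {c} {n} (x , y , z) c≉0 = *-cancel c≉0 (begin
        c * (n • P)
          ≈⟨ solve (⌜ c ⌝ ∷ ⌜ X n ⌝ ∷ ⌜ Y n ⌝ ∷ ⌜ Z n ⌝ ∷ ⌜ X P ⌝ ∷ ⌜ Y P ⌝ ∷ ⌜ Z P ⌝ ∷ []) (λ c x y z a b d →
               c :* (x :* a :+ y :* b :+ z :* d) := c :* x :* a :+ c :* y :* b :+ c :* z :* d) ≡.refl ⟩
        c * X n * X P + c * Y n * Y P + c * Z n * Z P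
          ≈⟨ +-cong (+-cong (*-congʳ x) (*-congʳ y)) (*-congʳ z) ⟨
        N • P
          ≈⟨ solve (⌜ X P ⌝ ∷ ⌜ Y P ⌝ ∷ ⌜ Z P ⌝ ∷ []) (λ a b c → let s2 = λ x → :σ (:σ x) in
               (b :* s2 c :- c :* s2 b) :* a :+ (c :* s2 a :- a :* s2 c) :* b :+ (a :* s2 b :- b :* s2 a) :* c := :0) ≡.refl ⟩
        0# ∎)

    rank-one : N ≋ 𝟎 → Splits P
    rank-one N≋0 =
      let s , φP≋sP = ⊗≈0⇒proportional P≉0 N≋0
          c , n , n-rational , P≋cn , c≉0 = rationalise P≉0 φP≋sP
      in line-split {W = n} {V = ⟨ 0# , 1# , 0# ⟩} {γ = 0#} a≉0 n-rational
           (trans (σ-cong σ-0) σ-0 , trans (σ-cong σ-1) σ-1 , trans (σ-cong σ-0) σ-0) (1≉0 ∘ proj₁ ∘ proj₂)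
           (solve [] (:0 :* :σ :0 :- (:1 :* :σ :0 :+ :0 :* :σ :1) := :0) ≡.refl)
           (≋-trans P≋cn (sym (+-dropʳ (zeroˡ _)) , sym (+-dropʳ (zeroˡ _)) , sym (+-dropʳ (zeroˡ _))))

    by-cases : Dec (X N ≈ 0#) → Dec (Y N ≈ 0#) → Dec (Z N ≈ 0#) → Splits P
    by-cases (yes x) (yes y) (yes z) = rank-one (x , y , z)
    by-cases (no  x) _       _       = rank-two (x ∘ proj₁)
    by-cases (yes _) (no  y) _       = rank-two (y ∘ proj₁ ∘ proj₂)
    by-cases (yes _) (yes _) (no  z) = rank-two (z ∘ proj₂ ∘ proj₂)

  -- Points with independent conjugates whose norm is fixed by σ

  module IndependentConjugates {P : Triple} (a≉0 : ¬ h P P ≈ 0#) (T-fixed : Fixed (norm (h P P))) (Δ≉0 : ¬ Δ P ≈ 0#) where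

    a i γ γ′ : Carrier
    a = h P P
    i = inv a≉0
    γ = a * σ i
    γ′ = γ * σ^ 2 γ

    ai≈1 : a * i ≈ 1#
    ai≈1 = inv-right a≉0

    σai≈1 : ∀ k → σ^ k (a * i) ≈ 1#
    σai≈1 zero    = ai≈1
    σai≈1 (suc k) = trans (σ-cong (σai≈1 k)) σ-1

    -- As γ = a/σ(a), its norm is the quotient of norm(a) by σ(norm(a)); `T-fixed` makes it 1, which
    -- is the condition for Hilbert 90.
    norm-γ : norm γ ≈ 1#
    norm-γ = begin
      norm γ
        ≈⟨ solve (⌜ a ⌝ ∷ ⌜ i ⌝ ∷ []) (λ a i → let s2 = λ x → :σ (:σ x); n = λ x → x :* s2 x :* s2 (s2 x) in
             n (a :* :σ i) := n a :* :σ (n i)) ≡.refl ⟩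
      norm a * σ (norm i)
        ≈⟨ *-congʳ T-fixed ⟨
      σ (norm a) * σ (norm i)
        ≈⟨ solve (⌜ a ⌝ ∷ ⌜ i ⌝ ∷ []) (λ a i → let s2 = λ x → :σ (:σ x); n = λ x → x :* s2 x :* s2 (s2 x); m = :σ (a :* i) in
             :σ (n a) :* :σ (n i) := m :* s2 m :* s2 (s2 m)) ≡.refl ⟩
      σ^ 1 (a * i) * σ^ 3 (a * i) * σ^ 5 (a * i)
        ≈⟨ trans (*-cong (trans (*-cong (σai≈1 1) (σai≈1 3)) (*-identityˡ 1#)) (σai≈1 5)) (*-identityˡ 1#) ⟩
      1# ∎

    γ≉0 : ¬ γ ≈ 0#
    γ≉0 = *-≉0 a≉0 (σ-≉0 (inv-≉0 a≉0))

    -- Hilbert 90 for σ²: an element μ with γ σ²(μ) = μ, hence with μ σ(μ) / a fixed by σ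
    generator = linear-nonzero 0# 1# 0# γ 0# (*-≉0 γ≉0 (σ-≉0 (σ-≉0 γ≉0)))
    ζ μ k : Carrier
    ζ = proj₁ generator
    μ = σ ζ + γ * σ^ 3 ζ + γ′ * σ^ 5 ζ
    k = μ * σ μ * i

    μ≉0 : ¬ μ ≈ 0#
    μ≉0 μ≈0 = proj₂ generator (trans (solve (⌜ ζ ⌝ ∷ ⌜ γ ⌝ ∷ ⌜ γ′ ⌝ ∷ []) (λ z c c′ →
      let z₁ = :σ z; z₂ = :σ z₁; z₃ = :σ z₂; z₄ = :σ z₃; z₅ = :σ z₄ in
      :0 :* z :+ :1 :* z₁ :+ :0 :* z₂ :+ c :* z₃ :+ :0 :* z₄ :+ c′ :* z₅ := z₁ :+ c :* z₃ :+ c′ :* z₅) ≡.refl) μ≈0)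

    μ-eq : γ * σ^ 2 μ ≈ μ
    μ-eq = begin
      γ * σ^ 2 μ
        ≈⟨ solve (⌜ ζ ⌝ ∷ ⌜ γ ⌝ ∷ []) (λ z c → let s2 = λ x → :σ (:σ x); z₁ = :σ z; z₃ = s2 z₁; z₅ = s2 z₃; c₂ = s2 c in
             c :* s2 (z₁ :+ c :* z₃ :+ c :* c₂ :* z₅) := c :* z₃ :+ c :* c₂ :* z₅ :+ c :* c₂ :* s2 c₂ :* z₁) ≡.refl ⟩
      γ * σ^ 3 ζ + γ′ * σ^ 5 ζ + norm γ * σ ζ
        ≈⟨ +-congˡ (trans (*-congʳ norm-γ) (*-identityˡ _)) ⟩
      γ * σ^ 3 ζ + γ′ * σ^ 5 ζ + σ ζ
        ≈⟨ trans (+-comm _ _) (sym (+-assoc _ _ _)) ⟩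
      μ ∎

    k-fixed : Fixed k
    k-fixed = begin
      σ k
        ≈⟨ solve (⌜ μ ⌝ ∷ ⌜ i ⌝ ∷ []) (λ m i → :σ (m :* :σ m :* i) := :σ m :* (:σ (:σ m) :* :σ i) :* :1) ≡.refl ⟩
      σ μ * (σ^ 2 μ * σ i) * 1#
        ≈⟨ *-congˡ ai≈1 ⟨
      σ μ * (σ^ 2 μ * σ i) * (a * i)
        ≈⟨ solve (⌜ μ ⌝ ∷ ⌜ a ⌝ ∷ ⌜ i ⌝ ∷ []) (λ m a i → :σ m :* (:σ (:σ m) :* :σ i) :* (a :* i) := a :* :σ i :* :σ (:σ m) :* :σ m :* i) ≡.refl ⟩
      γ * σ^ 2 μ * σ μ * i
        ≈⟨ *-congʳ (*-congʳ μ-eq) ⟩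
      k ∎

    k≉0 : ¬ k ≈ 0#
    k≉0 = *-≉0 (*-≉0 μ≉0 (σ-≉0 μ≉0)) (inv-≉0 a≉0)

    -- The vectors V, φ(V), φ²(V) are dual to P, φ(P), φ²(P), up to the factor μ.
    δ κ : Carrier
    δ = inv Δ≉0
    κ = σ^ 5 (μ * δ)
    N V : Triple
    N = φ P ⊗ φ (φ P)
    -- σ⁵ undoes the σ that h applies to its second argument; the exchange of Y and Z and the signs
    -- match the matrix of h.
    V = ⟨ κ * σ^ 5 (X N) , κ * - σ^ 5 (Z N) , κ * - σ^ 5 (Y N) ⟩

    hV : ∀ A → h A V ≈ μ * δ * (A • N)
    hV A = solve (⌜ X A ⌝ ∷ ⌜ Y A ⌝ ∷ ⌜ Z A ⌝ ∷ ⌜ X N ⌝ ∷ ⌜ Y N ⌝ ∷ ⌜ Z N ⌝ ∷ ⌜ μ * δ ⌝ ∷ []) (λ a b d x y z m →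
      let s5 = λ x → :σ (:σ (:σ (:σ (:σ x)))); k = s5 m in
      a :* :σ (k :* s5 x) :- (b :* :σ (k :* :- s5 y) :+ d :* :σ (k :* :- s5 z)) := m :* (a :* x :+ b :* y :+ d :* z)) ≡.refl

    hPV : h P V ≈ μ
    hPV = trans (hV P) (trans (*-assoc _ _ _) (trans (*-congˡ (inv-left Δ≉0)) (*-identityʳ μ)))

    hφPV : h (φ P) V ≈ 0#
    hφPV = trans (hV (φ P)) (*≈0ʳ (solve (⌜ X (φ P) ⌝ ∷ ⌜ Y (φ P) ⌝ ∷ ⌜ Z (φ P) ⌝ ∷ []) (λ x y z → let s2 = λ x → :σ (:σ x) in
      x :* (y :* s2 z :- z :* s2 y) :+ y :* (z :* s2 x :- x :* s2 z) :+ z :* (x :* s2 y :- y :* s2 x) := :0) ≡.refl))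

    hφφPV : h (φ (φ P)) V ≈ 0#
    hφφPV = trans (hV (φ (φ P))) (*≈0ʳ (solve (⌜ X (φ P) ⌝ ∷ ⌜ Y (φ P) ⌝ ∷ ⌜ Z (φ P) ⌝ ∷ []) (λ x y z → let s2 = λ x → :σ (:σ x) in
      s2 x :* (y :* s2 z :- z :* s2 y) :+ s2 y :* (z :* s2 x :- x :* s2 z) :+ s2 z :* (x :* s2 y :- y :* s2 x) := :0) ≡.refl))

    h-φφ : ∀ A B → h (φ A) (φ B) ≈ σ^ 2 (h A B)
    h-φφ A B = trans (sym (σ-h (φ B) A)) (σ-cong (sym (σ-h A B)))

    hPφV : h P (φ V) ≈ 0#
    hPφV = trans (h-cong (≋-sym (σ⁶-≋ P)) ≋-refl) (trans (h-φφ (φ (φ P)) V) (trans (σ-cong (trans (σ-cong hφφPV) σ-0)) σ-0))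

    hPφφV : h P (φ (φ V)) ≈ 0#
    hPφφV = trans (h-cong (≋-sym (σ⁶-≋ P)) ≋-refl) (trans (h-φφ (φ (φ P)) (φ V)) (trans (σ-cong (trans (σ-cong
      (trans (h-φφ (φ P) V) (trans (σ-cong (trans (σ-cong hφPV) σ-0)) σ-0))) σ-0)) σ-0))

    -- For t in F_{q³} the map φ permutes the three summands cyclically, so their sum is rational.
    -- Paired with P, only the multiple of φ⁰(V) = V contributes.
    R : Carrier → Triple
    R t = t · V ⊕ σ^ 2 t · φ V ⊕ σ t · φ (φ V)

    R-rational : ∀ {t} → Fixed³ t → Rational (R t)
    R-rational {t} t-fixed³ = coordinate , coordinate , coordinate
      where
      coordinate : ∀ {v} → Fixed² (t * v + σ^ 2 t * σ^ 2 v + σ t * σ^ 4 v)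
      coordinate {v} = solve (⌜ t ∣³ t-fixed³ ⌝ ∷ ⌜ v ⌝ ∷ []) (λ t v → let s2 = λ x → :σ (:σ x); r = t :* v :+ s2 t :* s2 v :+ :σ t :* s2 (s2 v) in
        s2 r := r) ≡.refl

    hPR : ∀ t → h P (R t) ≈ σ t * μ
    hPR t = trans (h-⊕ʳ _ _ _) (trans (+-cong (trans (h-⊕ʳ _ _ _) (trans (+-cong (trans (h-·ʳ t P V) (*-congˡ hPV)) (trans (h-·ʳ _ P (φ V)) (*≈0ʳ hPφV)))
      (+-identityʳ _))) (trans (h-·ʳ _ P (φ (φ V))) (*≈0ʳ hPφφV))) (+-identityʳ _))

    q₁ q₂ q₃ q₄ q₅ q₆ : Carrier
    q₁ = h V (φ V)
    q₂ = h (φ (φ V)) V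
    q₃ = h (φ V) (φ (φ V))
    q₄ = h V V + h (φ (φ V)) (φ V)
    q₅ = h V (φ (φ V)) + h (φ V) (φ V)
    q₆ = h (φ V) V + h (φ (φ V)) (φ (φ V))

    hRR : ∀ {t} → Fixed³ t → h (R t) (R t) ≈ quadratic q₁ q₂ q₃ q₄ q₅ q₆ t (σ t) (σ^ 2 t)
    hRR {t} t-fixed³ = trans (h-combination₃ t (σ^ 2 t) (σ t) V (φ V) (φ (φ V)) t (σ^ 2 t) (σ t))
      (solve (⌜ t ∣³ t-fixed³ ⌝ ∷ ⌜ h V V ⌝ ∷ ⌜ q₁ ⌝ ∷ ⌜ h V (φ (φ V)) ⌝ ∷ ⌜ h (φ V) V ⌝ ∷ ⌜ h (φ V) (φ V) ⌝ ∷ ⌜ q₃ ⌝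
          ∷ ⌜ q₂ ⌝ ∷ ⌜ h (φ (φ V)) (φ V) ⌝ ∷ ⌜ h (φ (φ V)) (φ (φ V)) ⌝ ∷ []) (λ t aa ab ac ba bb bc ca cb cc →
        let t₁ = :σ t; t₂ = :σ t₁; t₃ = :σ t₂ in
        (t :* t₁ :* aa :+ t :* t₃ :* ab :+ t :* t₂ :* ac) :+ (t₂ :* t₁ :* ba :+ t₂ :* t₃ :* bb :+ t₂ :* t₂ :* bc)
          :+ (t₁ :* t₁ :* ca :+ t₁ :* t₃ :* cb :+ t₁ :* t₂ :* cc)
        := ab :* (t :* t) :+ ca :* (t₁ :* t₁) :+ bc :* (t₂ :* t₂) :+ (aa :+ cb) :* (t :* t₁) :+ (ac :+ bb) :* (t :* t₂) :+ (ba :+ cc) :* (t₁ :* t₂)) ≡.refl)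

    solution = conic-fixed³ q₁ q₂ q₃ q₄ q₅ q₆ λ t-fixed³ →
      trans (σ-cong (sym (hRR t-fixed³))) (trans (rational-h (R-rational t-fixed³)) (hRR t-fixed³))

    t r w g : Carrier
    t = proj₁ solution
    w = h P (R t)

    t-fixed³ : Fixed³ t
    t-fixed³ = proj₁ (proj₂ solution)

    t≉0 : ¬ t ≈ 0#
    t≉0 = proj₁ (proj₂ (proj₂ solution))

    -- Here w σ(w) = r a with r in F_{q³}, so g = 1/(ε r) is negated by σ³ and has trace 0.
    r = k * (σ t * σ^ 2 t)

    r≉0 : ¬ r ≈ 0#
    r≉0 = *-≉0 k≉0 (*-≉0 (σ-≉0 t≉0) (σ-≉0 (σ-≉0 t≉0)))

    r-fixed³ : Fixed³ r
    r-fixed³ = solve (⌜ k ∣ k-fixed ⌝ ∷ ⌜ t ∣³ t-fixed³ ⌝ ∷ []) (λ k t → let r = k :* (:σ t :* :σ (:σ t)) in :σ (:σ (:σ r)) := r) ≡.refl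

    g = ε′ * inv r≉0

    g-eq : g * (ε * (w * σ w)) ≈ a
    g-eq = begin
      g * (ε * (w * σ w))
        ≈⟨ *-congˡ (*-congˡ (*-cong (hPR t) (σ-cong (hPR t)))) ⟩
      g * (ε * (σ t * μ * σ (σ t * μ)))
        ≈⟨ solve (⌜ ε′ ⌝ ∷ ⌜ inv r≉0 ⌝ ∷ ⌜ ε ⌝ ∷ ⌜ t ⌝ ∷ ⌜ μ ⌝ ∷ []) (λ e′ r e t m →
             e′ :* r :* (e :* (:σ t :* m :* :σ (:σ t :* m))) := (e :* e′) :* (r :* (m :* :σ m :* :1 :* (:σ t :* :σ (:σ t))))) ≡.refl ⟩
      ε * ε′ * (inv r≉0 * (μ * σ μ * 1# * (σ t * σ^ 2 t)))
        ≈⟨ *-cong (inv-right ε≉0) (*-congˡ (*-congʳ (*-congˡ (sym ai≈1)))) ⟩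
      1# * (inv r≉0 * (μ * σ μ * (a * i) * (σ t * σ^ 2 t)))
        ≈⟨ solve (⌜ inv r≉0 ⌝ ∷ ⌜ μ ⌝ ∷ ⌜ a ⌝ ∷ ⌜ i ⌝ ∷ ⌜ t ⌝ ∷ []) (λ r m a i t →
             :1 :* (r :* (m :* :σ m :* (a :* i) :* (:σ t :* :σ (:σ t)))) := r :* (m :* :σ m :* i :* (:σ t :* :σ (:σ t))) :* a) ≡.refl ⟩
      inv r≉0 * r * a
        ≈⟨ trans (*-congʳ (inv-left r≉0)) (*-identityˡ a) ⟩
      a ∎

    σ³-inv-r : σ^ 3 (inv r≉0) ≈ inv r≉0
    σ³-inv-r = inv-unique (trans (*-congʳ (sym r-fixed³)) (trans
      (solve (⌜ r ⌝ ∷ ⌜ inv r≉0 ⌝ ∷ []) (λ r s → :σ (:σ (:σ r)) :* :σ (:σ (:σ s)) := :σ (:σ (:σ (r :* s)))) ≡.refl)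
      (trans (σ-cong (trans (σ-cong (trans (σ-cong (inv-right r≉0)) σ-1)) σ-1)) σ-1))) (inv-right r≉0)

    g-anti : σ^ 3 g ≈ - g
    g-anti = begin
      σ^ 3 g                        ≈⟨ solve (⌜ ε′ ⌝ ∷ ⌜ inv r≉0 ⌝ ∷ []) (λ e r → :σ (:σ (:σ (e :* r))) := :σ (:σ (:σ e)) :* :σ (:σ (:σ r))) ≡.refl ⟩
      σ^ 3 ε′ * σ^ 3 (inv r≉0)      ≈⟨ *-cong σ³ε′ σ³-inv-r ⟩
      - ε′ * inv r≉0                ≈⟨ -‿distribˡ-* ε′ (inv r≉0) ⟨
      - g                           ∎
      where
      σ³ε′ : σ^ 3 ε′ ≈ - ε′
      σ³ε′ = trans (σ-cong (trans (σ-cong σ-ε′) (trans (σ-- ε′) (trans (-‿cong σ-ε′) (-‿involutive ε′))))) σ-ε′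

    w≉0 : ¬ w ≈ 0#
    w≉0 w≈0 = *-≉0 (σ-≉0 t≉0) μ≉0 (trans (sym (hPR t)) w≈0)

    splits : Splits P
    splits = rational-split (R-rational t-fixed³) (trans (hRR t-fixed³) (proj₂ (proj₂ (proj₂ solution)))) w≉0 g-eq (anti³⇒Tr≈0 g-anti)

  splits : ∀ {P} → NonZero P → ¬ h P P ≈ 0# → Splits P
  splits {P} P≉0 a≉0 = by-cases (σ (norm (h P P)) ≟ norm (h P P)) (Δ P ≟ 0#)
    where
    by-cases : Dec (Fixed (norm (h P P))) → Dec (Δ P ≈ 0#) → Splits P
    by-cases (no  T-not-fixed) _         = generic-split a≉0 T-not-fixed
    by-cases (yes T-fixed)     (yes Δ≈0) = dependent-split P≉0 a≉0 Δ≈0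
    by-cases (yes T-fixed)     (no  Δ≉0) = IndependentConjugates.splits a≉0 T-fixed Δ≉0

  -- Supplies the q + 1 collinear points that the definition of an arc asks for, on the line X = 0.
  -- The factor ε makes the two mixed values of h opposite.
  rational-line : SplitLine ⟨ 0# , 1# , 0# ⟩ ⟨ 0# , 0# , ε ⟩
  rational-line = record
    { independent = λ s t (_ , y , z) → trans (sym (trans (+-dropʳ (zeroʳ t)) (*-identityʳ s))) y ,
        *-cancel ε≉0 (trans (*-comm ε t) (trans (sym (+-dropˡ (zeroʳ s))) z))
    ; isotropicˡ = solve [] (:0 :* :σ :0 :- (:1 :* :σ :0 :+ :0 :* :σ :1) := :0) ≡.refl
    ; isotropicʳ = solve (⌜ ε ⌝ ∷ []) (λ e → :0 :* :σ :0 :- (:0 :* :σ e :+ e :* :σ :0) := :0) ≡.refl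
    ; alternating = trans (solve (⌜ ε ⌝ ∷ []) (λ e → (:0 :* :σ :0 :- (:1 :* :σ e :+ :0 :* :σ :0)) :+ (:0 :* :σ :0 :- (:0 :* :σ :0 :+ e :* :σ :1))
        := :- (:σ e :+ e)) ≡.refl) (trans (-‿cong (trans (+-congʳ σ-ε) (-‿inverseˡ ε))) (solve [] (:- :0 := :0) ≡.refl)) }

  complete-arc : FieldTheory.IsCompleteArc F (Hermitian q) (q ℕ.+ 1)
  complete-arc = ((line , line-NonZero , collinear-points) , λ L L≉0 points →
      no-more L L≉0 (≡.subst (λ n → CollinearIn (Hermitian q) (suc n) L) (ℕ.+-comm q 1) points)) , λ P P≉0 P∉H →
      let A , B , split , _ , _ , P≋ = splits P≉0 (λ a≈0 → P∉H (isotropic⇒hermitian P≉0 a≈0))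
      in SplitLine.line split , SplitLine.line-NonZero split , SplitLine.with-point split P≉0 P∉H P≋
    where open SplitLine rational-line

mainTheorem1 : Σ ℕ λ q₀ → (q : ℕ) → q₀ ℕ.≤ q → IsPrimePower q →
    (F : Field 0ℓ 0ℓ) → FieldTheory.HasCard F (q ℕ.^ 6) →
    FieldTheory.IsCompleteArc F (FieldTheory.Hermitian F q) (q ℕ.+ 1)
mainTheorem1 = 0 , λ q _ q-primePower F card → Completeness.complete-arc F q-primePower card
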